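{- There is a computable function $f$ such that the following holds for every $\varepsilon>0$. Given a connected $n$-vertex graph $G$ with cluster vertex deletion number $\mathrm{cvd}$ and a vertex $s\in V(G)$, one can find a broadcast protocol for $(G,s)$ with at most $(2+\varepsilon)\cdot b(G,s)$ rounds in time $f(\mathrm{cvd},\varepsilon)\cdot n^{O(1)}$.
   Context: All graphs are finite, undirected and loopless. Telephone model: at the start exactly one vertex, the source $s$, is informed; in each round every informed vertex may send the message to at most one of its uninformed neighbors, which is informed by the end of that round. For a connected graph $G$ and $s\in V(G)$, $b(G,s)$ is the minimum number of rounds needed to inform all vertices of $G$ starting from $s$. A broadcast protocol for $(G,s)$ with $t$ rounds is a spanning tree $T$ of $G$ rooted at $s$ together with a function $\tau\colon E(T)\to\{1,\dots,t\}$ that is a proper edge coloring of $T$ and such that for each $v\ne s$ the edge from $v$ to its parent has the minimum $\tau$-value among all edges of $T$ incident with $v$. Here $\tau(uv)$, with $u$ the parent of $v$, is the round in which $u$ forwards the message to $v$. A set $S\subseteq V(G)$ is a cluster vertex deletion set of $G$ if each connected component of $G-S$ is a complete graph; the cluster vertex deletion number of $G$ is the minimum size of such a set. -}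

module Defs where

open import Data.Bool.Base using (Bool; true; false; T; if_then_else_)
open import Data.Fin.Base using (Fin; zero; suc; toℕ)
open import Data.Fin.Subset using (Subset; _∈_; _∉_; ⁅_⁆; ⊤; ∣_∣)
open import Data.Integer.Base as ℤ using (+_)
open import Data.List.Base as List using (List; []; _∷_; _∷ʳ_; length; last)
open import Data.List.Relation.Unary.Linked using (Linked)
open import Data.List.Relation.Unary.Unique.Propositional using (Unique)
open import Data.Maybe.Base using (Maybe; just)
open import Data.Nat.Base using (ℕ; zero; suc; _+_; _≤_)
open import Data.Product.Base using (_×_; ∃-syntax)
open import Data.Rational.Base as ℚ using (ℚ; 0ℚ)
open import Data.Sum.Base using (_⊎_)
open import Data.Vec.Base as Vec using (Vec; []; _∷_)
open import Function.Bundles using (_⇔_)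
open import Relation.Binary.Construct.Closure.ReflexiveTransitive using (Star)
open import Relation.Binary.PropositionalEquality using (_≡_; _≢_)
open import Relation.Nullary using (¬_)

IsMinimum : (ℕ → Set) → ℕ → Set
IsMinimum P m = P m × (∀ k → P k → m ≤ k)

fromℕ : ℕ → ℚ
fromℕ n = + n ℚ./ 1

------------------------------------------------------------------------
-- Graphs

record Graph (n : ℕ) : Set where
  field
    adj       : Fin n → Fin n → Bool
    symmetric : ∀ u v → adj u v ≡ adj v u
    loopless  : ∀ v → adj v v ≡ false

  Adj : Fin n → Fin n → Set
  Adj u v = T (adj u v)

open Graph public

private
  variable
    n : ℕ

Connected : Graph n → Set
Connected G = ∀ u v → Star (Adj G) u v

-- A cycle is a closed walk u , xs , u of length at least three in which
-- only the end vertex u is repeated.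
Acyclic : Graph n → Set
Acyclic G = ∀ u xs → 2 ≤ length xs → Unique (u ∷ xs) →
            ¬ Linked (Adj G) (u ∷ xs ∷ʳ u)

IsTree : Graph n → Set
IsTree G = Connected G × Acyclic G

-- In the tree H rooted at s, the path from v to s starts with the edge vu.
IsParent : (H : Graph n) (s v u : Fin n) → Set
IsParent H s v u =
  ∃[ xs ] Linked (Adj H) (v ∷ u ∷ xs) × Unique (v ∷ u ∷ xs) ×
          last (v ∷ u ∷ xs) ≡ just s

------------------------------------------------------------------------
-- Cluster vertex deletion

AdjOutside : Graph n → Subset n → Fin n → Fin n → Set
AdjOutside G S u v = u ∉ S × v ∉ S × Adj G u v

IsClusterVertexDeletionSet : Graph n → Subset n → Set
IsClusterVertexDeletionSet G S =
  ∀ u v → u ∉ S → v ∉ S → Star (AdjOutside G S) u v → u ≢ v → Adj G u v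

IsClusterVertexDeletionNumber : Graph n → ℕ → Set
IsClusterVertexDeletionNumber G =
  IsMinimum (λ k → ∃[ S ] IsClusterVertexDeletionSet G S × ∣ S ∣ ≡ k)

------------------------------------------------------------------------
-- The telephone model

-- One round turns the set I of informed vertices into I′.  As `call` is a
-- function, every vertex sends the message to at most one neighbour.
record Round (G : Graph n) (I I′ : Subset n) : Set where
  field
    call    : Fin n → Maybe (Fin n)
    valid   : ∀ u v → call u ≡ just v → u ∈ I × v ∉ I × Adj G u v
    informs : ∀ v → v ∈ I′ ⇔ (v ∈ I ⊎ ∃[ u ] call u ≡ just v)

data Rounds (G : Graph n) : ℕ → Subset n → Subset n → Set where
  done : ∀ {I} → Rounds G 0 I I
  next : ∀ {r I J K} → Round G I J → Rounds G r J K → Rounds G (suc r) I K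

-- b(G,s) = b
IsBroadcastTime : Graph n → Fin n → ℕ → Set
IsBroadcastTime G s = IsMinimum (λ r → Rounds G r ⁅ s ⁆ ⊤)

-- The values of τ on pairs that are not edges of the tree are irrelevant.
record Protocol (G : Graph n) (s : Fin n) (t : ℕ) : Set where
  field
    tree       : Graph n
    isTree     : IsTree tree
    subgraph   : ∀ u v → Adj tree u v → Adj G u v
    τ          : Fin n → Fin n → ℕ
    τ-sym      : ∀ u v → Adj tree u v → τ u v ≡ τ v u
    τ-range    : ∀ u v → Adj tree u v → 1 ≤ τ u v × τ u v ≤ t
    proper     : ∀ u v w → Adj tree v u → Adj tree v w → u ≢ w →
                 τ v u ≢ τ v w
    parent-min : ∀ v u w → v ≢ s → IsParent tree s v u → Adj tree v w →
                 τ v u ≤ τ v w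

------------------------------------------------------------------------
-- Computation

-- Programs are terms of a call-by-value functional language whose data are
-- binary trees.  Evaluation uses environments and closures and takes one
-- step per rule.  Environments have a length bounded by the program and
-- values are shared, so for a fixed program a step is a constant number of
-- operations of a pointer machine, and running times agree with those of
-- Turing machines up to a polynomial.

data Term (m : ℕ) : Set where
  var  : Fin m → Term m
  nil  : Term m
  cons : Term m → Term m → Term m
  -- In the last branch, variable 0 is the head and variable 1 the tail.
  case : Term m → Term m → Term (2 + m) → Term m
  -- A recursive function: variable 0 is its argument, variable 1 is itself.
  rec  : Term (2 + m) → Term m
  app  : Term m → Term m → Term m

data Value : Set where
  nil  : Value
  cons : Value → Value → Value
  clo  : ∀ {m} → Vec Value m → Term (2 + m) → Value

infix 4 _⊢_⇓_[_]

-- ρ ⊢ e ⇓ v [ c ] : in environment ρ, e evaluates to v in c steps.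
data _⊢_⇓_[_] {m} (ρ : Vec Value m) : Term m → Value → ℕ → Set where

  var     : ∀ {x} → ρ ⊢ var x ⇓ Vec.lookup ρ x [ 1 ]

  nil     : ρ ⊢ nil ⇓ nil [ 1 ]

  cons    : ∀ {e₁ e₂ v₁ v₂ c₁ c₂} →
            ρ ⊢ e₁ ⇓ v₁ [ c₁ ] → ρ ⊢ e₂ ⇓ v₂ [ c₂ ] →
            ρ ⊢ cons e₁ e₂ ⇓ cons v₁ v₂ [ suc (c₁ + c₂) ]

  case-nil  : ∀ {e e₁ e₂ v c c₁} →
              ρ ⊢ e ⇓ nil [ c ] → ρ ⊢ e₁ ⇓ v [ c₁ ] →
              ρ ⊢ case e e₁ e₂ ⇓ v [ suc (c + c₁) ]

  case-cons : ∀ {e e₁ e₂ v₁ v₂ v c c₂} →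
              ρ ⊢ e ⇓ cons v₁ v₂ [ c ] →
              (v₁ ∷ v₂ ∷ ρ) ⊢ e₂ ⇓ v [ c₂ ] →
              ρ ⊢ case e e₁ e₂ ⇓ v [ suc (c + c₂) ]

  rec     : ∀ {e} → ρ ⊢ rec e ⇓ clo ρ e [ 1 ]

  app     : ∀ {e₁ e₂ k} {ρ′ : Vec Value k} {e v₂ v c₁ c₂ c} →
            ρ ⊢ e₁ ⇓ clo ρ′ e [ c₁ ] → ρ ⊢ e₂ ⇓ v₂ [ c₂ ] →
            (v₂ ∷ clo ρ′ e ∷ ρ′) ⊢ e ⇓ v [ c ] →
            ρ ⊢ app e₁ e₂ ⇓ v [ suc (c₁ + c₂ + c) ]

Program : Set
Program = Term 1

-- Program p on input x outputs y after c steps.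
Runs : Program → Value → Value → ℕ → Set
Runs p x y c = (x ∷ []) ⊢ p ⇓ y [ c ]

encodeℕ : ℕ → Value
encodeℕ zero    = nil
encodeℕ (suc k) = cons nil (encodeℕ k)

encodeBool : Bool → Value
encodeBool false = nil
encodeBool true  = cons nil nil

encodeList : List Value → Value
encodeList = List.foldr cons nil

encodeMatrix : (Fin n → Fin n → Value) → Value
encodeMatrix a =
  encodeList (List.tabulate λ u → encodeList (List.tabulate λ v → a u v))

-- The adjacency matrix together with the source; the number of vertices is
-- the number of rows.
encodeInstance : Graph n → Fin n → Value
encodeInstance G s =
  cons (encodeMatrix (λ u v → encodeBool (adj G u v))) (encodeℕ (toℕ s))

-- The matrix of τ, with entry 0 for pairs that are not edges of the tree.
encodeProtocol : ∀ {G : Graph n} {s t} → Protocol G s t → Value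
encodeProtocol P =
  encodeMatrix (λ u v → encodeℕ (if adj tree u v then τ u v else 0))
  where open Protocol P

-- Only the values of f at positive rationals matter, so the sign of ε is
-- not part of the input.
Computable : (ℕ → ℚ → ℕ) → Set
Computable f =
  ∃[ p ] ∀ k ε → 0ℚ ℚ.< ε →
  ∃[ c ] Runs p (cons (encodeℕ k)
                      (cons (encodeℕ ℤ.∣ ℚ.↥ ε ∣) (encodeℕ (ℚ.↧ₙ ε))))
                (encodeℕ (f k ε)) c

{-# OPTIONS --safe #-}
module Submission where

-- Let b = b(G,s).  A maximal family of disjoint induced P₃s yields a set S with
-- |S| ≤ 3 cvd outside of which adjacency is transitive, so every shortest path
-- between vertices of S leaves S for at most two vertices at a time, and S can
-- be informed within 3|S| rounds.  In an optimal protocol every clique of G - S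
-- without informed vertices is entered from S, and each vertex of S enters at
-- most b of them; augmenting paths find an assignment of the cliques to S with
-- this load.  Once entered, a clique of size at most n ≤ 2^b is informed within
-- b further rounds, for a total of 2b + 3|S|.
--
-- With M the denominator of ε, so that 1/M ≤ ε, this is at most (2 + ε) b if
-- 2^(3M|S|) < n, for then 3M|S| < b.  Otherwise n is bounded in terms of cvd and
-- ε, and an optimal protocol is found by exhaustive search.
--
-- A protocol is represented by a parent and a round for every vertex.  The
-- algorithm is written in a typed language of loops over the vertices, whose
-- compiler into terms comes with a cost bound read off the syntax: a polynomial
-- in n and in (2n)^n, which bounds the size of the search tree of an enumeration.

open import Defs
open import Data.Bool.Base using (Bool; true; false; T; if_then_else_)
open import Data.Bool.Properties using (T?)
open import Data.Empty using (⊥; ⊥-elim)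
open import Data.Fin.Base using (Fin; zero; suc; toℕ; fromℕ<)
open import Data.Fin.Patterns using (0F; 1F; 2F; 3F; 4F; 5F; 6F; 7F; 8F; 9F)
open import Data.Fin.Properties using (_≟_; toℕ<n; toℕ-fromℕ<; toℕ-injective; any?)
open import Data.Fin.Subset as Subset using (Subset; ∣_∣; ⁅_⁆; _∈_; _∉_)
open import Data.Fin.Subset.Properties using (_∈?_; ∈⊤; x∈⁅x⁆; x∈⁅y⁆⇒x≡y; ∣p∣≤n; p⊂q⇒∣p∣<∣q∣; ⊆-antisym; ∣⁅x⁆∣≡1)
open import Data.Integer.Base as ℤ using ()
open import Data.Integer.Properties using () renaming (pos-* to ℤ-pos-*)
open import Data.List.Base as List using (List; []; _∷_; _∷ʳ_; length; foldl; allFin; tabulate; last)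
open import Data.List.Membership.Propositional as Mem using ()
open import Data.List.Properties using (tabulate-cong; map-tabulate; length-tabulate; length-replicate)
open import Data.List.Relation.Unary.All as All using (All; []; _∷_)
open import Data.List.Relation.Unary.AllPairs using ([]; _∷_)
open import Data.List.Relation.Unary.Any using (here; there)
open import Data.List.Relation.Unary.Linked using (Linked; []; [-]; _∷_)
open import Data.List.Relation.Unary.Unique.Propositional using (Unique)
open import Data.Maybe.Base using (just)
open import Data.Maybe.Properties using (just-injective)
open import Data.Nat.Base using (ℕ; zero; suc; _+_; _*_; _^_; _∸_; _≤_; _<_; z≤n; s≤s; ⌊_/2⌋)
open import Data.Nat.Properties hiding (_≟_)
open import Data.Nat.Tactic.RingSolver using (solve-∀)
open import Data.Product.Base using (_×_; _,_; proj₁; proj₂; ∃-syntax; Σ-syntax)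
open import Data.Rational.Base as ℚ using (ℚ; 0ℚ)
open import Data.Rational.Properties using (toℚᵘ-cancel-≤; toℚᵘ-fromℚᵘ; toℚᵘ-homo-+; toℚᵘ-homo-*)
open import Data.Rational.Unnormalised.Base as ℚᵘ using ()
open import Data.Rational.Unnormalised.Properties using ()
  renaming (module ≤-Reasoning to ℚᵘ-Reasoning; *-cong to ℚᵘ-*-cong; +-cong to ℚᵘ-+-cong; ≃-refl to ℚᵘ-refl)
open import Data.Sum.Base using (_⊎_; inj₁; inj₂; [_,_]′)
open import Data.Unit.Base using (⊤; tt)
open import Data.Vec.Base as Vec using (Vec; []; _∷_)
open import Data.Vec.Properties using ([]=⇒lookup)
open import Function.Base using (_∘_; id)
open import Function.Bundles using (Equivalence)
open import Relation.Binary.Construct.Closure.ReflexiveTransitive using (Star; ε; _◅_; _◅◅_)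
open import Relation.Binary.PropositionalEquality using (_≡_; _≢_; refl; sym; trans; cong; cong₂; subst; subst₂; module ≡-Reasoning)
open import Relation.Nullary using (¬_; Dec; yes; no)
open import Relation.Nullary.Decidable using (decidable-stable; _×-dec_; ¬?)
open import Algebra.Properties.CommutativeMonoid.Sum +-0-commutativeMonoid using (sum; sum-cong-≗; ∑-distrib-+; ∑-comm)
open import Algebra.Properties.Semiring.Sum +-*-semiring using (*-distribˡ-sum)

-- The program knows neither b nor cvd. It decides between the two cases by S, M and n alone; the
-- optimal protocol and a minimum deletion set occur only in the analysis. The load limit of the
-- assignment is raised step by step, and b is merely the limit at which Hall's condition is known
-- to hold. Rounds are never simulated: every vertex carries a clock, a call is placed in the round
-- after the clock of its caller, whatever the order in which calls are generated, and each phase is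
-- analysed by bounding clocks.
--
-- The delicate phase is the last. The informed vertices of a clique enter it with different clocks,
-- so their number need not double from round to round. What persists is the sum of 2^(K - clock)
-- over them, which never falls below 2^b, where K is the round in which the phase has to end.
--
-- One time bound has to serve both cases and all ε. Therefore ε enters the program through the
-- literal M only, which may affect coefficients but not the degree in n, and only the branch that
-- is taken may be charged, as the search is exponential in n.

module Language where

  -- A typed language of loops, its compiler, and the cost of compiled terms

  infixr 6 _⊗_

  data Ty : Set where
    bool num idx : Ty
    arr          : Ty → Ty
    _⊗_          : Ty → Ty → Ty

  ⟦_⟧ : Ty → ℕ → Set
  ⟦ bool ⟧ N = Bool
  ⟦ num ⟧ N = ℕ
  ⟦ idx ⟧ N = Fin (suc N)
  ⟦ arr τ ⟧ N = Fin (suc N) → ⟦ τ ⟧ N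
  ⟦ σ ⊗ τ ⟧ N = ⟦ σ ⟧ N × ⟦ τ ⟧ N

  enc : ∀ τ {N} → ⟦ τ ⟧ N → Value
  enc bool b = encodeBool b
  enc num k = encodeℕ k
  enc idx i = encodeℕ (toℕ i)
  enc (arr τ) f = encodeList (tabulate (λ i → enc τ (f i)))
  enc (σ ⊗ τ) (x , y) = cons (enc σ x) (enc τ y)

  Env : ∀ {k} → Vec Ty k → ℕ → Set
  Env [] N = ⊤
  Env (τ ∷ Γ) N = ⟦ τ ⟧ N × Env Γ N

  look : ∀ {k} (Γ : Vec Ty k) {N} → Env Γ N → (i : Fin k) → ⟦ Vec.lookup Γ i ⟧ N
  look (τ ∷ Γ) (x , γ) zero = x
  look (τ ∷ Γ) (x , γ) (suc i) = look Γ γ i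

  private
    variable
      k l m N : ℕ
      Γ Δ : Vec Ty k
      σ τ : Ty

  -- The constructs are chosen so that costs depend on n alone, never on computed values: `leq`
  -- compares a possibly huge number with an index, which ends its recursion within n steps, `half`
  -- applies to indices, and the count of `rep` is a literal. The only exponential construct is
  -- `enum`.
  data Exp : ∀ {k} → Vec Ty k → Ty → Set
  data Args {k} (Γ : Vec Ty k) : ∀ {l} → Vec Ty l → Set

  data Exp where
    ref     : (i : Fin k) → Exp Γ (Vec.lookup Γ i)
    tru fal : Exp Γ bool
    ite     : Exp Γ bool → Exp Γ τ → Exp Γ τ → Exp Γ τ
    pair    : Exp Γ σ → Exp Γ τ → Exp Γ (σ ⊗ τ)
    fst     : Exp Γ (σ ⊗ τ) → Exp Γ σ
    snd     : Exp Γ (σ ⊗ τ) → Exp Γ τ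
    zer     : Exp Γ idx
    asNum   : Exp Γ idx → Exp Γ num
    inc     : Exp Γ num → Exp Γ num
    leq     : Exp Γ num → Exp Γ idx → Exp Γ bool
    half    : Exp Γ idx → Exp Γ idx
    tab     : Exp (idx ∷ Γ) τ → Exp Γ (arr τ)
    get     : Exp Γ (arr τ) → Exp Γ idx → Exp Γ τ
    fold    : Exp Γ τ → Exp (idx ∷ τ ∷ Γ) τ → Exp Γ τ
    rep     : ℕ → Exp Γ τ → Exp (τ ∷ Γ) τ → Exp Γ τ
    enum    : Exp Γ τ → Exp (arr idx ∷ τ ∷ Γ) τ → Exp Γ τ
    call    : Exp Δ τ → Args Γ Δ → Exp Γ τ

  data Args Γ where
    []  : Args Γ []
    _∷_ : Exp Γ σ → Args Γ Δ → Args Γ (σ ∷ Δ)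

  _≤ᴮ_ : ℕ → ℕ → Bool
  zero ≤ᴮ n = true
  suc m ≤ᴮ zero = false
  suc m ≤ᴮ suc n = m ≤ᴮ n

  halve : Fin m → Fin m
  halve i = fromℕ< (≤-<-trans (⌊n/2⌋≤n (toℕ i)) (toℕ<n i))

  -- Opaque, as otherwise conversion checking unrolls the first iteration of every loop.
  opaque
    foldFin : ∀ {A : Set} → A → (Fin m → A → A) → A
    foldFin a f = foldl (λ acc i → f i acc) a (allFin _)

    foldFin-foldl : ∀ {A : Set} (a : A) (f : Fin m → A → A) →
                    foldl (λ acc i → f i acc) a (allFin m) ≡ foldFin a f
    foldFin-foldl a f = refl

  -- Keeps calls folded during conversion checking.
  opaque
    apply : ∀ {A B : Set} → (A → B) → A → B
    apply f x = f x

    apply-def : ∀ {A B : Set} (f : A → B) x → f x ≡ apply f x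
    apply-def f x = refl

  iter : ∀ {A : Set} → ℕ → A → (A → A) → A
  iter n a f = foldl (λ acc _ → f acc) a (List.replicate n tt)

  -- Positions beyond the end of the list read as zero.
  nth : List (Fin (suc N)) → Fin k → Fin (suc N)
  nth [] i = zero
  nth (x ∷ xs) zero = x
  nth (x ∷ xs) (suc i) = nth xs i

  -- A depth-first traversal of all extensions of `xs` by j values, with one accumulator threaded
  -- through the leaves.
  foldLists : ∀ {A : Set} → ℕ → List (Fin (suc N)) → A → ((Fin (suc N) → Fin (suc N)) → A → A) → A
  foldLists zero xs a f = f (nth xs) a
  foldLists (suc j) xs a f = foldFin a (λ v acc → foldLists j (v ∷ xs) acc f)

  sem : {Γ : Vec Ty k} → Exp Γ τ → Env Γ N → ⟦ τ ⟧ N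
  semArgs : {Γ : Vec Ty k} {Δ : Vec Ty l} → Args Γ Δ → Env Γ N → Env Δ N

  sem {Γ = Γ} (ref i) γ = look Γ γ i
  sem tru γ = true
  sem fal γ = false
  sem (ite e e₁ e₂) γ = if sem e γ then sem e₁ γ else sem e₂ γ
  sem (pair e₁ e₂) γ = sem e₁ γ , sem e₂ γ
  sem (fst e) γ = proj₁ (sem e γ)
  sem (snd e) γ = proj₂ (sem e γ)
  sem zer γ = zero
  sem (asNum e) γ = toℕ (sem e γ)
  sem (inc e) γ = suc (sem e γ)
  sem (leq e₁ e₂) γ = sem e₁ γ ≤ᴮ toℕ (sem e₂ γ)
  sem (half e) γ = halve (sem e γ)
  sem (tab e) γ = λ i → sem e (i , γ)
  sem (get e₁ e₂) γ = sem e₁ γ (sem e₂ γ)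
  sem (fold e₁ e₂) γ = foldFin (sem e₁ γ) (λ i acc → sem e₂ (i , acc , γ))
  sem (rep n e₁ e₂) γ = iter n (sem e₁ γ) (λ acc → sem e₂ (acc , γ))
  sem {N = N} (enum e₁ e₂) γ = foldLists (suc N) [] (sem e₁ γ) (λ a acc → sem e₂ (a , acc , γ))
  sem (call f es) γ = apply (sem f) (semArgs es γ)

  semArgs [] γ = tt
  semArgs (e ∷ es) γ = sem e γ , semArgs es γ

  infixr 5 _▸_

  _▸_ : ∀ {A : Set} → A → (Fin k → A) → Fin (suc k) → A
  (x ▸ r) zero = x
  (x ▸ r) (suc i) = r i

  pattern 10F = suc 9F
  pattern 11F = suc 10F
  pattern 12F = suc 11F
  pattern 13F = suc 12F

  -- Weakenings past the variables bound by generated code: the second branch of a `case` and the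
  -- body of a `rec` bind two each.
  s2 : Fin m → Fin (2 + m)
  s2 i = suc (suc i)

  s4 : Fin m → Fin (4 + m)
  s4 i = s2 (s2 i)

  s6 : Fin m → Fin (6 + m)
  s6 i = s2 (s4 i)

  s8 : Fin m → Fin (8 + m)
  s8 i = s2 (s6 i)

  -- Functions are unary, so both numbers arrive as one pair, and the `nil` branch of the outer
  -- `case` is unreachable. The recursion descends in both numbers at once.
  leqB : Term (2 + m)
  leqB = case (var 0F) nil
               (case (var 0F) (cons nil nil)
                 (case (var 3F) nil
                   (app (var 7F) (cons (var 3F) (var 1F)))))

  halfB : Term (2 + m)
  halfB = case (var 0F) nil (case (var 1F) nil (cons nil (app (var 5F) (var 1F))))

  getB : Term (2 + m)
  getB = case (var 0F) nil
               (case (var 1F)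
                 (case (var 0F) nil (var 0F))
                 (case (var 2F) nil
                   (app (var 7F) (cons (var 1F) (var 3F)))))

  -- The step of a loop sees the current element as variable 0 and the
  -- accumulator as variable 3.
  loopT : Term (6 + m) → Term (2 + m)
  loopT b = case (var 0F) nil (case (var 0F) (var 1F) (app (var 5F) (cons (var 1F) b)))

  unaryT : ℕ → Term m
  unaryT zero = nil
  unaryT (suc n) = cons nil (unaryT n)

  tabT : Term (4 + m) → Term (2 + m)
  tabT b = case (var 0F) nil (cons b (app (var 3F) (var 1F)))

  -- The argument packs a list whose length is the number of values still to be chosen, the values
  -- chosen so far, and the accumulator. The inner loop tries every index as the next value;
  -- variable 13 in it is the enclosing recursive function.
  enumT : Term (6 + m) → Fin m → Term (2 + m)
  enumT b i = case (var 0F) nil (case (var 1F) nil (case (var 2F) b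
    (app (rec (loopT (app (var 13F) (cons (var 7F) (cons (cons (var 0F) (var 8F)) (var 3F))))))
         (cons (var (s8 i)) (var 3F)))))

  -- compile e r i is a term with the variables of e at the positions r and the
  -- list of all indices at position i.
  compile : {Γ : Vec Ty k} → Exp Γ τ → (Fin k → Fin m) → Fin m → Term m
  -- Calls are inlined. An applied `rec` acts as a let for each argument; the continuation receives
  -- the weakening `w` past these bindings and the positions `q` of the arguments.
  compileArgs : {Γ : Vec Ty k} {Δ : Vec Ty l} → Args Γ Δ → (Fin k → Fin m) → Fin m →
                (∀ {m′} → (Fin m → Fin m′) → (Fin l → Fin m′) → Term m′) → Term m

  compile (ref x) r i = var (r x)
  compile tru r i = cons nil nil
  compile fal r i = nil
  compile (ite e e₁ e₂) r i = case (compile e r i) (compile e₂ r i) (compile e₁ (s2 ∘ r) (s2 i))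
  compile (pair e₁ e₂) r i = cons (compile e₁ r i) (compile e₂ r i)
  compile (fst e) r i = case (compile e r i) nil (var 0F)
  compile (snd e) r i = case (compile e r i) nil (var 1F)
  compile zer r i = nil
  compile (asNum e) r i = compile e r i
  compile (inc e) r i = cons nil (compile e r i)
  compile (leq e₁ e₂) r i = app (rec leqB) (cons (compile e₁ r i) (compile e₂ r i))
  compile (half e) r i = app (rec halfB) (compile e r i)
  compile (tab e) r i = app (rec (tabT (compile e (0F ▸ s4 ∘ r) (s4 i)))) (var i)
  compile (get e₁ e₂) r i = app (rec getB) (cons (compile e₁ r i) (compile e₂ r i))
  compile (fold e₁ e₂) r i =
    app (rec (loopT (compile e₂ (0F ▸ 3F ▸ s6 ∘ r) (s6 i)))) (cons (var i) (compile e₁ r i))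
  compile (rep n e₁ e₂) r i =
    app (rec (loopT (compile e₂ (3F ▸ s6 ∘ r) (s6 i)))) (cons (unaryT n) (compile e₁ r i))
  compile (enum e₁ e₂) r i =
    app (rec (enumT (compile e₂ (0F ▸ 1F ▸ s6 ∘ r) (s6 i)) i))
        (cons (var i) (cons nil (compile e₁ r i)))
  compile (call f es) r i = compileArgs es r i (λ w q → compile f q (w i))

  compileArgs [] r i K = K id (λ ())
  compileArgs (e ∷ es) r i K =
    app (rec (compileArgs es (s2 ∘ r) (s2 i) (λ w q → K (w ∘ s2) (w 0F ▸ q)))) (compile e r i)

  -- Costs are kept as syntax, so that a coefficient, a degree in n and an exponent of `X` can be
  -- computed from them. The factor of `⊛` is the literal of a `rep` and stays apart from the powers
  -- of n.
  data Cost : Set where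
    con  : ℕ → Cost
    _⊕_  : Cost → Cost → Cost
    n⊛_  : Cost → Cost
    X⊛_  : Cost → Cost
    _⊛_  : ℕ → Cost → Cost

  infixr 6 _⊕_
  infixr 7 n⊛_ X⊛_ _⊛_

  -- Bounds the number of nodes of the search tree of enum.
  X : ℕ → ℕ
  X n = (2 * n) ^ n

  ⟪_⟫ : Cost → ℕ → ℕ
  ⟪ con c ⟫ n = c
  ⟪ c ⊕ d ⟫ n = ⟪ c ⟫ n + ⟪ d ⟫ n
  ⟪ n⊛ c ⟫ n = n * ⟪ c ⟫ n
  ⟪ X⊛ c ⟫ n = X n * ⟪ c ⟫ n
  ⟪ m ⊛ c ⟫ n = m * ⟪ c ⟫ n

  cost : {Γ : Vec Ty k} → Exp Γ τ → Cost
  costArgs : {Γ : Vec Ty k} {Δ : Vec Ty l} → Args Γ Δ → Cost → Cost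

  cost (ref i) = con 1
  cost tru = con 3
  cost fal = con 1
  cost (ite e e₁ e₂) = con 1 ⊕ cost e ⊕ cost e₁ ⊕ cost e₂
  cost (pair e₁ e₂) = con 1 ⊕ cost e₁ ⊕ cost e₂
  cost (fst e) = con 2 ⊕ cost e
  cost (snd e) = con 2 ⊕ cost e
  cost zer = con 1
  cost (asNum e) = cost e
  cost (inc e) = con 2 ⊕ cost e
  cost (leq e₁ e₂) = con 3 ⊕ (cost e₁ ⊕ cost e₂) ⊕ n⊛ con 20
  cost (half e) = con 2 ⊕ cost e ⊕ n⊛ con 20
  cost (tab e) = con 10 ⊕ n⊛ (con 10 ⊕ cost e)
  cost (get e₁ e₂) = con 3 ⊕ (cost e₁ ⊕ cost e₂) ⊕ n⊛ con 20
  cost (fold e₁ e₂) = con 10 ⊕ cost e₁ ⊕ n⊛ (con 10 ⊕ cost e₂)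
  cost (rep m e₁ e₂) = con 10 ⊕ cost e₁ ⊕ m ⊛ (con 12 ⊕ cost e₂)
  cost (enum e₁ e₂) = con 10 ⊕ cost e₁ ⊕ X⊛ (con 50 ⊕ cost e₂)
  cost (call f es) = costArgs es (cost f)

  costArgs [] c = c
  costArgs (e ∷ es) c = con 2 ⊕ cost e ⊕ costArgs es c

  infix 4 _⊢_⇓_≤[_]

  _⊢_⇓_≤[_] : Vec Value m → Term m → Value → ℕ → Set
  ρ ⊢ e ⇓ v ≤[ B ] = ∃[ c ] ρ ⊢ e ⇓ v [ c ] × c ≤ B

  private
    variable
      ρ : Vec Value m
      e e₁ e₂ : Term m
      v v₁ v₂ : Value
      A B B₁ B₂ : ℕ

  relax : B₁ ≤ B₂ → ρ ⊢ e ⇓ v ≤[ B₁ ] → ρ ⊢ e ⇓ v ≤[ B₂ ]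
  relax p (c , d , q) = c , d , ≤-trans q p

  ⇓var : ∀ {x : Fin m} → Vec.lookup ρ x ≡ v → ρ ⊢ var x ⇓ v ≤[ 1 ]
  ⇓var refl = 1 , var , ≤-refl

  ⇓nil : ρ ⊢ nil ⇓ nil ≤[ 1 ]
  ⇓nil = 1 , nil , ≤-refl

  ⇓cons : ρ ⊢ e₁ ⇓ v₁ ≤[ B₁ ] → ρ ⊢ e₂ ⇓ v₂ ≤[ B₂ ] → ρ ⊢ cons e₁ e₂ ⇓ cons v₁ v₂ ≤[ suc (B₁ + B₂) ]
  ⇓cons (_ , d₁ , p₁) (_ , d₂ , p₂) = _ , cons d₁ d₂ , s≤s (+-mono-≤ p₁ p₂)

  ⇓case-nil : ∀ {e : Term m} {e₁ e₂ v B B₁} → ρ ⊢ e ⇓ nil ≤[ B ] → ρ ⊢ e₁ ⇓ v ≤[ B₁ ] →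
              ρ ⊢ case e e₁ e₂ ⇓ v ≤[ suc (B + B₁) ]
  ⇓case-nil (_ , d₁ , p₁) (_ , d₂ , p₂) = _ , case-nil d₁ d₂ , s≤s (+-mono-≤ p₁ p₂)

  ⇓case-cons : ∀ {e : Term m} {e₁ e₂ v v₁ v₂ B B₂} → ρ ⊢ e ⇓ cons v₁ v₂ ≤[ B ] →
               (v₁ ∷ v₂ ∷ ρ) ⊢ e₂ ⇓ v ≤[ B₂ ] → ρ ⊢ case e e₁ e₂ ⇓ v ≤[ suc (B + B₂) ]
  ⇓case-cons (_ , d₁ , p₁) (_ , d₂ , p₂) = _ , case-cons d₁ d₂ , s≤s (+-mono-≤ p₁ p₂)

  ⇓app : ∀ {e₁ : Term m} {e₂} {ρ′ : Vec Value k} {b : Term (2 + k)} {v₁ v B₁ B₂ B₃} →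
         ρ ⊢ e₁ ⇓ clo ρ′ b ≤[ B₁ ] → ρ ⊢ e₂ ⇓ v₁ ≤[ B₂ ] →
         (v₁ ∷ clo ρ′ b ∷ ρ′) ⊢ b ⇓ v ≤[ B₃ ] →
         ρ ⊢ app e₁ e₂ ⇓ v ≤[ suc (B₁ + B₂ + B₃) ]
  ⇓app (_ , d₁ , p₁) (_ , d₂ , p₂) (_ , d₃ , p₃) =
    _ , app d₁ d₂ d₃ , s≤s (+-mono-≤ (+-mono-≤ p₁ p₂) p₃)

  ⇓rec : ∀ {b : Term (2 + m)} → ρ ⊢ rec b ⇓ clo ρ b ≤[ 1 ]
  ⇓rec = 1 , rec , ≤-refl

  ⇓self : ∀ {x : Fin m} {ρ′ : Vec Value k} {b : Term (2 + k)} {v₁ v B₂ B₃} →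
          Vec.lookup ρ x ≡ clo ρ′ b → ρ ⊢ e₂ ⇓ v₁ ≤[ B₂ ] →
          (v₁ ∷ clo ρ′ b ∷ ρ′) ⊢ b ⇓ v ≤[ B₃ ] →
          ρ ⊢ app (var x) e₂ ⇓ v ≤[ suc (1 + B₂ + B₃) ]
  ⇓self p = ⇓app (⇓var p)

  encIdx : Fin m → Value
  encIdx i = encodeℕ (toℕ i)

  encIds : ℕ → Value
  encIds n = encodeList (List.map encIdx (allFin n))

  ⇓unary : ∀ n → ρ ⊢ unaryT n ⇓ encodeList (List.map (λ _ → nil) (List.replicate n tt)) ≤[ 1 + n * 2 ]
  ⇓unary zero = ⇓nil
  ⇓unary (suc n) = ⇓cons ⇓nil (⇓unary n)

  ⇓leq : ∀ x y → (cons (encodeℕ x) (encodeℕ y) ∷ clo {m} ρ leqB ∷ ρ) ⊢ leqB ⇓ encodeBool (x ≤ᴮ y) ≤[ suc y * 15 ]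
  ⇓leq zero y = relax (m≤m+n 7 _) (⇓case-cons (⇓var refl) (⇓case-nil (⇓var refl) (⇓cons ⇓nil ⇓nil)))
  ⇓leq (suc x) zero = relax (m≤m+n 7 _) (⇓case-cons (⇓var refl) (⇓case-cons (⇓var refl)
    (⇓case-nil (⇓var refl) ⇓nil)))
  ⇓leq (suc x) (suc y) = relax (m≤n+m _ 4) (⇓case-cons (⇓var refl) (⇓case-cons (⇓var refl)
    (⇓case-cons (⇓var refl) (⇓self refl (⇓cons (⇓var refl) (⇓var refl)) (⇓leq x y)))))

  ⇓half : ∀ x → (encodeℕ x ∷ clo {m} ρ halfB ∷ ρ) ⊢ halfB ⇓ encodeℕ ⌊ x /2⌋ ≤[ suc x * 15 ]
  ⇓half zero = relax (m≤m+n 3 _) (⇓case-nil (⇓var refl) ⇓nil)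
  ⇓half (suc zero) = relax (m≤m+n 5 _) (⇓case-cons (⇓var refl) (⇓case-nil (⇓var refl) ⇓nil))
  ⇓half (suc (suc x)) = relax (m≤n+m _ 21) (⇓case-cons (⇓var refl) (⇓case-cons (⇓var refl)
    (⇓cons ⇓nil (⇓self refl (⇓var refl) (⇓half x)))))

  ⇓get : ∀ {n} (f : Fin n → Value) i →
         (cons (encodeList (tabulate f)) (encIdx i) ∷ clo {m} ρ getB ∷ ρ) ⊢ getB ⇓ f i ≤[ suc (toℕ i) * 15 ]
  ⇓get f zero = relax (m≤m+n 7 _) (⇓case-cons (⇓var refl) (⇓case-nil (⇓var refl)
    (⇓case-cons (⇓var refl) (⇓var refl))))
  ⇓get f (suc i) = relax (m≤n+m _ 4) (⇓case-cons (⇓var refl) (⇓case-cons (⇓var refl)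
    (⇓case-cons (⇓var refl) (⇓self refl (⇓cons (⇓var refl) (⇓var refl)) (⇓get (f ∘ suc) i)))))

  module _ {A B : Set} {encA : A → Value} {encB : B → Value} {f : A → B → A} {b : Term (6 + m)}
           {ρ : Vec Value m} {β : ℕ}
           (step : ∀ x a {v₁ v₂ v₃ v₄} →
             (encB x ∷ v₁ ∷ v₂ ∷ encA a ∷ v₃ ∷ v₄ ∷ ρ) ⊢ b ⇓ encA (f a x) ≤[ β ]) where

    ⇓loop : ∀ xs a →
            (cons (encodeList (List.map encB xs)) (encA a) ∷ clo ρ (loopT b) ∷ ρ) ⊢ loopT b
            ⇓ encA (foldl f a xs) ≤[ 5 + length xs * (10 + β) ]
    ⇓loop [] a = ⇓case-cons (⇓var refl) (⇓case-nil (⇓var refl) (⇓var refl))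
    ⇓loop (x ∷ xs) a = relax (eq β (length xs * (10 + β)))
      (⇓case-cons (⇓var refl) (⇓case-cons (⇓var refl)
        (⇓self refl (⇓cons (⇓var refl) (step x a)) (⇓loop xs (f a x)))))
      where
      eq : ∀ β r → suc (1 + suc (1 + suc (1 + suc (1 + β) + (5 + r)))) ≤ 5 + ((10 + β) + r)
      eq β r = ≤-trans (≤-reflexive (lem β r)) (m≤n+m _ 2)
        where
        lem : ∀ β r → suc (1 + suc (1 + suc (1 + suc (1 + β) + (5 + r)))) ≡ 5 + ((8 + β) + r)
        lem = solve-∀

  module _ {B : Set} {encB : B → Value} {g : B → Value} {b : Term (4 + m)} {ρ : Vec Value m} {β : ℕ}
           (step : ∀ x {v₁ v₂ v₃} → (encB x ∷ v₁ ∷ v₂ ∷ v₃ ∷ ρ) ⊢ b ⇓ g x ≤[ β ]) where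

    ⇓tab : ∀ xs → (encodeList (List.map encB xs) ∷ clo ρ (tabT b) ∷ ρ) ⊢ tabT b
           ⇓ encodeList (List.map g xs) ≤[ 3 + length xs * (10 + β) ]
    ⇓tab [] = ⇓case-nil (⇓var refl) ⇓nil
    ⇓tab (x ∷ xs) = relax (eq β (length xs * (10 + β)))
      (⇓case-cons (⇓var refl) (⇓cons (step x) (⇓self refl (⇓var refl) (⇓tab xs))))
      where
      eq : ∀ β r → suc (1 + suc (β + suc (1 + 1 + (3 + r)))) ≤ 3 + ((10 + β) + r)
      eq β r = ≤-trans (≤-reflexive (lem β r)) (m≤n+m _ 4)
        where
        lem : ∀ β r → suc (1 + suc (β + suc (1 + 1 + (3 + r)))) ≡ 3 + ((6 + β) + r)
        lem = solve-∀

  ⇓≡ : ∀ {e : Term m} {v v′ B} → v ≡ v′ → ρ ⊢ e ⇓ v ≤[ B ] → ρ ⊢ e ⇓ v′ ≤[ B ]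
  ⇓≡ refl d = d

  module _ {A : Set} {encA : A → Value} {f : (Fin (suc N) → Fin (suc N)) → A → A}
           {b : Term (6 + m)} {i : Fin m} {ρ : Vec Value m} {β : ℕ}
           (ids : Vec.lookup ρ i ≡ encIds (suc N))
           (step : ∀ xs a {v₁ v₂ v₃ v₄} → length xs ≡ suc N →
             (encodeList (List.map encIdx xs) ∷ encA a ∷ v₁ ∷ v₂ ∷ v₃ ∷ v₄ ∷ ρ) ⊢ b
             ⇓ encA (f (nth xs) a) ≤[ β ]) where

    enumBound : ℕ → ℕ
    enumBound zero = 6 + β
    enumBound (suc j) = 16 + suc N * (19 + enumBound j)

    ⇓enum : ∀ (js : List (Fin (suc N))) xs a → length js + length xs ≡ suc N →
            (cons (encodeList (List.map encIdx js)) (cons (encodeList (List.map encIdx xs)) (encA a))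
              ∷ clo ρ (enumT b i) ∷ ρ) ⊢ enumT b i
            ⇓ encA (foldLists (length js) xs a f) ≤[ enumBound (length js) ]
    ⇓enum [] xs a p = ⇓case-cons (⇓var refl) (⇓case-cons (⇓var refl) (⇓case-nil (⇓var refl) (step xs a p)))
    ⇓enum (_ ∷ js) xs a p =
      relax (≤-reflexive (cong (λ z → 16 + z * (19 + enumBound (length js))) (length-tabulate {n = suc N} id)))
      (⇓case-cons (⇓var refl) (⇓case-cons (⇓var refl) (⇓case-cons (⇓var refl)
        (⇓≡ (cong encA (foldFin-foldl _ _)) (⇓app ⇓rec (⇓cons (⇓var ids) (⇓var refl))
          (⇓loop
            (λ v a′ → ⇓self refl (⇓cons (⇓var refl) (⇓cons (⇓cons (⇓var refl) (⇓var refl)) (⇓var refl)))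
              (⇓enum js (v ∷ xs) a′ (trans (+-suc (length js) (length xs)) p)))
            (allFin (suc N)) a))))))

    -- The summand 35 closes the induction, with n = `suc N`: one level adds 16 + 19n steps, and the
    -- doubled branching factor 2n leaves 70n for these and for the summand itself. This is why the
    -- base of `X` is 2n and not n.
    enumBound≤ : ∀ j → 35 + enumBound j ≤ (2 * suc N) ^ j * (50 + β)
    enumBound≤ zero = ≤-trans (+-monoˡ-≤ β (m≤n+m 41 9)) (≤-reflexive (sym (+-identityʳ (50 + β))))
    enumBound≤ (suc j) = begin
      35 + (16 + suc N * (19 + g))                                   ≤⟨ m≤m+n _ _ ⟩
      35 + (16 + suc N * (19 + g)) + (N * 51 + suc N * g)            ≡⟨ lem N g ⟩
      2 * suc N * (35 + g)                                           ≤⟨ *-monoʳ-≤ (2 * suc N) (enumBound≤ j) ⟩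
      2 * suc N * ((2 * suc N) ^ j * (50 + β))                       ≡⟨ *-assoc (2 * suc N) ((2 * suc N) ^ j) (50 + β) ⟨
      (2 * suc N) ^ suc j * (50 + β)                                 ∎
      where
      open ≤-Reasoning
      g = enumBound j
      lem : ∀ N g → 35 + (16 + suc N * (19 + g)) + (N * 51 + suc N * g) ≡ 2 * suc N * (35 + g)
      lem = solve-∀

  record Fits {Γ : Vec Ty k} (γ : Env Γ N) (ρ : Vec Value m) (r : Fin k → Fin m) (i : Fin m) : Set where
    constructor fits
    field
      at  : ∀ x → Vec.lookup ρ (r x) ≡ enc (Vec.lookup Γ x) (look Γ γ x)
      ids : Vec.lookup ρ i ≡ encIds (suc N)

  tabulate-nth : ∀ (xs : List (Fin (suc N))) {k} → length xs ≡ k →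
                 encodeList (List.map encIdx xs) ≡ encodeList (tabulate {n = k} (λ i → encIdx (nth xs i)))
  tabulate-nth [] refl = refl
  tabulate-nth (x ∷ xs) refl = cong (cons (encIdx x)) (tabulate-nth xs refl)

  length-allFin : ∀ n → length (allFin n) ≡ n
  length-allFin n = length-tabulate {n = n} id

  compile-correct : {Γ : Vec Ty k} (e : Exp Γ τ) {γ : Env Γ N} {ρ : Vec Value m} {r : Fin k → Fin m} {i : Fin m} →
       Fits {Γ = Γ} γ ρ r i → ρ ⊢ compile e r i ⇓ enc τ (sem e γ) ≤[ ⟪ cost e ⟫ (suc N) ]

  compileArgs-correct : {Γ : Vec Ty k} {Δ : Vec Ty l} (es : Args Γ Δ) {γ : Env Γ N}
           {ρ : Vec Value m} {r : Fin k → Fin m} {i : Fin m} {v : Value} {c : Cost} →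
           Fits {Γ = Γ} γ ρ r i →
           {K : ∀ {m′} → (Fin m → Fin m′) → (Fin l → Fin m′) → Term m′} →
           (∀ {m′} {ρ′ : Vec Value m′} {w : Fin m → Fin m′} {q} →
             (∀ x → Vec.lookup ρ′ (w x) ≡ Vec.lookup ρ x) →
             (∀ x → Vec.lookup ρ′ (q x) ≡ enc (Vec.lookup Δ x) (look Δ (semArgs es γ) x)) →
             ρ′ ⊢ K w q ⇓ v ≤[ ⟪ c ⟫ (suc N) ]) →
           ρ ⊢ compileArgs es r i K ⇓ v ≤[ ⟪ costArgs es c ⟫ (suc N) ]

  compile-correct (ref x) F = ⇓var (Fits.at F x)
  compile-correct tru F = ⇓cons ⇓nil ⇓nil
  compile-correct fal F = ⇓nil
  compile-correct {N = N} (ite e e₁ e₂) {γ} F with sem e γ | compile-correct e F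
  ... | true  | d = relax (s≤s (+-monoʳ-≤ (⟪ cost e ⟫ (suc N)) (m≤m+n _ _)))
                      (⇓case-cons d (compile-correct e₁ (fits (Fits.at F) (Fits.ids F))))
  ... | false | d = relax (s≤s (+-monoʳ-≤ (⟪ cost e ⟫ (suc N)) (m≤n+m _ _))) (⇓case-nil d (compile-correct e₂ F))
  compile-correct (pair e₁ e₂) F = ⇓cons (compile-correct e₁ F) (compile-correct e₂ F)
  compile-correct (fst e) {γ} F = relax (≤-reflexive (cong suc (+-comm _ 1))) (⇓case-cons (compile-correct e F) (⇓var refl))
  compile-correct (snd e) {γ} F = relax (≤-reflexive (cong suc (+-comm _ 1))) (⇓case-cons (compile-correct e F) (⇓var refl))
  compile-correct zer F = ⇓nil
  compile-correct (asNum e) F = compile-correct e F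
  compile-correct (inc e) F = ⇓cons ⇓nil (compile-correct e F)
  compile-correct {N = N} (leq e₁ e₂) {γ} F =
    relax (lem (⟪ cost e₁ ⟫ (suc N) + ⟪ cost e₂ ⟫ (suc N)) (toℕ<n (sem e₂ γ)))
      (⇓app ⇓rec (⇓cons (compile-correct e₁ F) (compile-correct e₂ F)) (⇓leq (sem e₁ γ) (toℕ (sem e₂ γ))))
    where
    lem : ∀ a {x n} → x < n → suc (1 + suc a + suc x * 15) ≤ 3 + (a + n * 20)
    lem a p = s≤s (s≤s (s≤s (+-monoʳ-≤ a (*-mono-≤ p (m≤m+n 15 5)))))
  compile-correct {N = N} (half e) {γ} F =
    relax (lem (⟪ cost e ⟫ (suc N)) (toℕ<n (sem e γ)))
      (⇓≡ (cong encodeℕ (sym (toℕ-fromℕ< _)))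
        (⇓app ⇓rec (compile-correct e F) (⇓half (toℕ (sem e γ)))))
    where
    lem : ∀ a {x n} → x < n → suc (1 + a + suc x * 15) ≤ 2 + (a + n * 20)
    lem a p = s≤s (s≤s (+-monoʳ-≤ a (*-mono-≤ p (m≤m+n 15 5))))
  compile-correct {τ = arr τ} {N = N} (tab e) {γ} {ρ} {r} {i} F =
    relax (≤-trans (≤-reflexive (cong (λ z → 6 + z * (10 + ⟪ cost e ⟫ (suc N))) (length-allFin (suc N))))
                   (m≤n+m _ 4))
      (⇓≡ (cong encodeList (map-tabulate id (λ j → enc τ (sem e (j , γ)))))
        (⇓app ⇓rec (⇓var (Fits.ids F))
          (⇓tab (λ x → compile-correct e (fits (λ { zero → refl ; (suc y) → Fits.at F y }) (Fits.ids F)))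
                (allFin (suc N)))))
  compile-correct {τ = τ} {N = N} (get e₁ e₂) {γ} F =
    relax (lem (⟪ cost e₁ ⟫ (suc N) + ⟪ cost e₂ ⟫ (suc N)) (toℕ<n (sem e₂ γ)))
      (⇓app ⇓rec (⇓cons (compile-correct e₁ F) (compile-correct e₂ F)) (⇓get (λ j → enc τ (sem e₁ γ j)) (sem e₂ γ)))
    where
    lem : ∀ a {x n} → x < n → suc (1 + suc a + suc x * 15) ≤ 3 + (a + n * 20)
    lem a p = s≤s (s≤s (s≤s (+-monoʳ-≤ a (*-mono-≤ p (m≤m+n 15 5)))))
  compile-correct {τ = τ} {N = N} (fold e₁ e₂) {γ} F =
    relax (lem (⟪ cost e₁ ⟫ (suc N)) _ (cong (_* (10 + ⟪ cost e₂ ⟫ (suc N))) (length-allFin (suc N))))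
      (⇓≡ (cong (enc τ) (foldFin-foldl _ _)) (⇓app ⇓rec (⇓cons (⇓var (Fits.ids F)) (compile-correct e₁ F))
        (⇓loop {encA = enc τ} {encB = encIdx} {f = λ acc x → sem e₂ (x , acc , γ)}
          (λ x a → compile-correct e₂ (fits (λ { zero → refl ; (suc zero) → refl ; (suc (suc y)) → Fits.at F y })
                               (Fits.ids F)))
          (allFin (suc N)) (sem e₁ γ))))
    where
    lem : ∀ a x {y} → x ≡ y → suc (1 + suc (1 + a) + (5 + x)) ≤ 10 + (a + y)
    lem a x refl = ≤-trans (≤-reflexive (eq a x)) (m≤n+m _ 1)
      where
      eq : ∀ a x → suc (1 + suc (1 + a) + (5 + x)) ≡ 9 + (a + x)
      eq = solve-∀
  compile-correct {τ = τ} {N = N} (rep n e₁ e₂) {γ} F =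
    relax (lem (⟪ cost e₁ ⟫ (suc N)) n (⟪ cost e₂ ⟫ (suc N)) (length-replicate n))
      (⇓app ⇓rec (⇓cons (⇓unary n) (compile-correct e₁ F))
        (⇓loop {encA = enc τ} {encB = λ _ → nil} {f = λ acc _ → sem e₂ (acc , γ)}
          (λ x a → compile-correct e₂ (fits (λ { zero → refl ; (suc y) → Fits.at F y }) (Fits.ids F)))
          (List.replicate n tt) (sem e₁ γ)))
    where
    lem : ∀ a n b {x} → x ≡ n → suc (1 + suc (1 + n * 2 + a) + (5 + x * (10 + b))) ≤ 10 + (a + n * (12 + b))
    lem a n b refl = ≤-trans (≤-reflexive (eq a n b)) (m≤n+m _ 1)
      where
      eq : ∀ a n b → suc (1 + suc (1 + n * 2 + a) + (5 + n * (10 + b))) ≡ 9 + (a + n * (12 + b))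
      eq = solve-∀
  compile-correct {τ = τ} {N = N} (enum e₁ e₂) {γ} {ρ} {r} {i} F =
    relax (≤-trans (≤-reflexive (eq (⟪ cost e₁ ⟫ (suc N)) (bd (length js))))
            (+-monoʳ-≤ 10 (+-monoʳ-≤ (⟪ cost e₁ ⟫ (suc N))
              (≤-trans (m≤n+m _ 35) (≤-trans (enumBound≤ {encA = enc τ} {f = g} {i = i} ids step (length js))
                (≤-reflexive (cong (λ z → (2 * suc N) ^ z * (50 + ⟪ cost e₂ ⟫ (suc N))) (length-allFin (suc N)))))))))
      (⇓≡ (cong (λ z → enc τ (foldLists z [] (sem e₁ γ) g)) (length-allFin (suc N)))
        (⇓app ⇓rec (⇓cons (⇓var ids) (⇓cons ⇓nil (relax (m≤n+m _ 4) (compile-correct e₁ F))))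
          (⇓enum {encA = enc τ} {f = g} {i = i} ids step js [] (sem e₁ γ) (trans (+-identityʳ _) (length-allFin (suc N))))))
    where
    ids = Fits.ids F
    js = allFin (suc N)
    step : ∀ xs a {v₁ v₂ v₃ v₄} → length xs ≡ suc N →
           (encodeList (List.map encIdx xs) ∷ enc τ a ∷ v₁ ∷ v₂ ∷ v₃ ∷ v₄ ∷ ρ)
             ⊢ compile e₂ (0F ▸ 1F ▸ s6 ∘ r) (s6 i) ⇓ enc τ (sem e₂ (nth xs , a , γ)) ≤[ ⟪ cost e₂ ⟫ (suc N) ]
    step xs a p = compile-correct e₂ (fits (λ { zero → tabulate-nth xs p ; (suc zero) → refl ; (suc (suc y)) → Fits.at F y }) ids)
    g = λ a acc → sem e₂ (a , acc , γ)
    bd = enumBound {encA = enc τ} {f = g} {i = i} {ρ = ρ} ids step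
    eq : ∀ a x → suc (1 + suc (1 + suc (1 + (4 + a))) + x) ≡ 10 + (a + x)
    eq = solve-∀
  compile-correct {τ = τ} (call f es) {γ} {i = i} F = ⇓≡ (cong (enc τ) (apply-def (sem f) _)) (
    compileArgs-correct es {c = cost f} F (λ ww qq → compile-correct f (fits qq (trans (ww i) (Fits.ids F)))))

  compileArgs-correct [] F ok = ok (λ _ → refl) (λ ())
  compileArgs-correct {N = N} (e ∷ es) {c = c} F ok =
    ⇓app ⇓rec (compile-correct e F)
        (compileArgs-correct es {c = c} (fits (Fits.at F) (Fits.ids F))
          (λ ww qq → ok (λ x → ww (s2 x)) (λ { zero → ww 0F ; (suc y) → qq y })))

open Language

-- The algorithm as functions on vertices

module Programs where

  private
    variable
      k m N : ℕ
      Γ : Vec Ty k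
      τ : Ty

  infixr 7 _&_
  infixr 6 _or_

  -- Opaque so that the arguments can be inferred from a type T (a & b).
  opaque
    _&_ _or_ : Bool → Bool → Bool
    a & b = if a then b else false
    a or b = if a then true else b

    not : Bool → Bool
    not a = if a then false else true

    _==_ : Fin m → Fin m → Bool
    i == j = (toℕ i ≤ᴮ toℕ j) & (toℕ j ≤ᴮ toℕ i)

  anyB allB : (Fin m → Bool) → Bool
  anyB f = foldFin false (λ i acc → f i or acc)
  allB f = not (anyB (λ i → not (f i)))

  lastIdx : ∀ N → Fin (suc N)
  lastIdx N = foldFin zero (λ i _ → i)

  module Algorithm {N : ℕ} where

    V : Set
    V = Fin (suc N)

    -- Per vertex: whether it is informed, its parent, the round in which it was
    -- informed, and the last round in which it was busy.
    State : Set
    State = V → Bool × V × ℕ × ℕ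

    inf : State → V → Bool
    inf st u = proj₁ (st u)

    par : State → V → V
    par st u = proj₁ (proj₂ (st u))

    birth clk : State → V → ℕ
    birth st u = proj₁ (proj₂ (proj₂ (st u)))
    clk st u = proj₂ (proj₂ (proj₂ (st u)))

    initial : V → State
    initial s w = w == s , w , 0 , 0

    extend : V → V → State → State
    extend u v st w =
      if w == v then (true , u , suc (clk st u) , suc (clk st u))
      else if w == u then (inf st w , par st w , birth st w , suc (clk st u))
      else st w

    -- An assignment maps a vertex j to (true , x) if x is to call into the
    -- clique of j.
    Assignment : Set
    Assignment = V → Bool × V

    -- If nx x is (true , j , y) then x can get rid of its job j by passing it to y.
    Next : Set
    Next = V → Bool × V × V

    assigned : Assignment → V → V → Bool
    assigned A j x = proj₁ (A j) & (proj₂ (A j) == x)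

    load : Assignment → V → ℕ
    load A x = foldFin 0 (λ j acc → if assigned A j x then suc acc else acc)

    nonfull : V → Assignment → V → Bool
    nonfull L A x = suc (load A x) ≤ᴮ toℕ L

    good : V → Assignment → Next → V → Bool
    good L A nx x = nonfull L A x or proj₁ (nx x)

    module _ (E : V → V → Bool) (L : V) where

      -- Backward search for augmenting paths: a server opens when one of its jobs could move to a
      -- server that is good already. An entry is made once and never overwritten.
      closeStep : Assignment → V → V → Next → Next
      closeStep A j y nx =
        if proj₁ (A j) & not (good L A nx (proj₂ (A j))) & E j y & good L A nx y
        then (λ z → if z == proj₂ (A j) then (true , j , y) else nx z)
        else nx

      closePass : Assignment → Next → Next
      closePass A nx = foldFin nx (λ j nx → foldFin nx (λ y nx → closeStep A j y nx))

      close : Assignment → Next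
      close A = foldFin {suc N} (λ z → false , z , z) (λ _ nx → closePass A nx)

      findServer : Assignment → Next → V → Bool × V
      findServer A nx j = foldFin (false , j) (λ x acc →
        if not (proj₁ acc) & E j x & good L A nx x then (true , x) else acc)

      place : Assignment → V → V → Assignment
      place A j x i = if i == j then (true , x) else A i

      exchange : Assignment → V → V → V → Assignment
      exchange A j x j′ i = if i == j′ then (false , i) else (if i == j then (true , x) else A i)

      -- The state holds a job j on its way to the server x. A server with an entry takes j and
      -- hands on the job recorded there; one without an entry has room and ends the chain.
      follow : Next → Assignment × Bool × V × V → Assignment × Bool × V × V
      follow nx (A , active , j , x) =
        if active
        then (if proj₁ (nx x)
              then (exchange A j x (proj₁ (proj₂ (nx x))) , true , proj₂ (nx x))
              else (place A j x , false , j , x))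
        else (A , active , j , x)

      augment : Next → Assignment → V → Bool × V → Assignment
      augment nx A j r = proj₁ (foldFin {suc N} (A , proj₁ r , j , proj₂ r) (λ _ z → follow nx z))

      insert : V → Assignment → Assignment
      insert j A = augment (close A) A j (findServer A (close A) j)

    within : V → (V → ℕ) → Bool
    within t f = allB (λ v → f v ≤ᴮ toℕ t)

    -- Maxima are compared through a threshold that is an index, because `leq` only compares with
    -- indices.
    better : (V → ℕ) → (V → ℕ) → Bool
    better f g = anyB (λ t → within t f & not (within t g))

    matrix : (V → V) × (V → ℕ) → V → V → ℕ
    matrix (p , f) u v = if p v == u then f v else if p u == v then f u else 0

    module _ (a : V → V → Bool) where

      send : V → V → State → State
      send u v st = if inf st u & not (inf st v) & a u v then extend u v st else st

      near : V → V → Bool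
      near c d = a c d or (c == d)

      isP₃ : V → V → V → (V → Bool) → Bool
      isP₃ u v w S = not (S u) & not (S v) & not (S w) & a u v & a v w & not (u == w) & not (a u w)

      addP₃ : V → V → V → (V → Bool) → (V → Bool)
      addP₃ u v w S = if isP₃ u v w S then (λ z → S z or (z == u or (z == v or z == w))) else S

      modulator : V → Bool
      modulator = foldFin (λ _ → false) (λ u S → foldFin S (λ v S → foldFin S (λ w S → addP₃ u v w S)))

      module _ (S : V → Bool) where

        reachStep : V → V → V → V → State → State
        reachStep u c d x st =
          if inf st u & S x & not (inf st x) & near u c & near c d & near d x
          then send d x (send c d (send u c st)) else st

        reachPass : State → State
        reachPass st = foldFin st (λ u st → foldFin st (λ c st →
          foldFin st (λ d st → foldFin st (λ x st → reachStep u c d x st))))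

        reach : State → State
        reach st = foldFin {suc N} st (λ _ st → reachPass st)

        link : V → V → Bool
        link j x = S x & anyB (λ c → not (S c) & near c j & a x c)

        handled : State → Assignment → V → Bool
        handled st A j = anyB (λ c → not (S c) & near c j & (inf st c or proj₁ (A c)))

        assignStep : State → V → V → Assignment → Assignment
        assignStep st L j A = if not (S j) & not (handled st A j) then insert link L j A else A

        -- As b is unknown, all limits are tried in increasing order, and cliques left over are
        -- tried again under the next one. No clique is left once the limit b has been processed,
        -- and the remaining limits then change nothing.
        assign : State → Assignment
        assign st = foldFin (λ j → false , j) (λ L A → foldFin A (λ j A → assignStep st L j A))

        touched : State → V → Bool
        touched st j = anyB (λ c → not (S c) & near c j & inf st c)

        serveStep : Assignment → V → V → State → State
        serveStep A j c st =
          if proj₁ (A j) & not (S c) & near c j & not (touched st j) then send (proj₂ (A j)) c st else st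

        serve : Assignment → State → State
        serve A st = foldFin st (λ j st → foldFin st (λ c st → serveStep A j c st))

        -- The two comparisons say that the clock of u is t. Taking callers in the order of their
        -- clocks makes the calls inside a clique follow the order of rounds.
        spreadStep : V → V → V → State → State
        spreadStep t u v st =
          if not (S u) & not (S v) & inf st u & (clk st u ≤ᴮ toℕ t) & not (suc (clk st u) ≤ᴮ toℕ t)
          then send u v st else st

        spread : State → State
        spread st = foldFin st (λ t st → foldFin st (λ u st → foldFin st (λ v st → spreadStep t u v st)))

        finish : State → State
        finish st = spread (serve (assign st) st)

      module _ (s : V) where

        approximate : (V → V) × (V → ℕ)
        approximate = par st , birth st
          where st = finish modulator (reach modulator (initial s))

        valid : (V → V) → (V → V) → Bool
        valid p f =
          p s == s & toℕ (f s) ≤ᴮ 0 &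
          allB (λ v → v == s or (a (p v) v & suc (toℕ (f (p v))) ≤ᴮ toℕ (f v))) &
          allB (λ v → allB (λ w → v == s or w == s or v == w or not (p v == p w) or not (f v == f w)))

        improve : (V → V) → (V → V) → (V → V) × (V → ℕ) → (V → V) × (V → ℕ)
        improve p f best =
          if valid p f & better (λ v → toℕ (f v)) (proj₂ best) then (p , λ v → toℕ (f v)) else best

        -- Starting from the approximate solution makes every intermediate best a broadcast.
        optimum : (V → V) × (V → ℕ)
        optimum = foldLists (suc N) [] approximate (λ p acc →
                  foldLists (suc N) [] acc (λ f acc → improve p f acc))

      -- The halvings amount to dividing N by 2 ^ (3 M ∣ S ∣).
      large : ℕ → Bool
      large M = not (toℕ (iter M (lastIdx N) (λ y → foldFin y (λ i y →
                  if modulator i then halve (halve (halve y)) else y))) ≤ᴮ 0)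

  -- The same functions as expressions of the language

  andE orE : Exp Γ bool → Exp Γ bool → Exp Γ bool
  andE x y = ite x y fal
  orE x y = ite x tru y

  notE : Exp Γ bool → Exp Γ bool
  notE x = ite x fal tru

  eqE : Exp Γ idx → Exp Γ idx → Exp Γ bool
  eqE x y = andE (leq (asNum x) y) (leq (asNum y) x)

  pattern v0 = ref 0F
  pattern v1 = ref 1F
  pattern v2 = ref 2F
  pattern v3 = ref 3F
  pattern v4 = ref 4F
  pattern v5 = ref 5F
  pattern v6 = ref 6F
  pattern v7 = ref 7F
  pattern v8 = ref 8F
  pattern v9 = ref 9F
  pattern v10 = ref 10F
  pattern v11 = ref 11F
  pattern v12 = ref 12F
  pattern v13 = ref 13F

  anyE allE : Exp (arr bool ∷ []) bool
  anyE = fold fal (orE (get v2 v0) v1)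
  allE = notE (call anyE (tab (notE (get v1 v0)) ∷ []))

  someE everyE : Exp (idx ∷ Γ) bool → Exp Γ bool
  someE e = call anyE (tab e ∷ [])
  everyE e = call allE (tab e ∷ [])

  setTy graphTy vertexTy stateTy assignTy nextTy treeTy : Ty
  setTy = arr bool
  graphTy = arr setTy
  vertexTy = bool ⊗ idx ⊗ num ⊗ num
  stateTy = arr vertexTy
  assignTy = arr (bool ⊗ idx)
  nextTy = arr (bool ⊗ idx ⊗ idx)
  treeTy = arr idx ⊗ arr num

  initialE : Exp (idx ∷ []) stateTy
  initialE = tab (pair (eqE v0 v1) (pair v0 (pair (asNum zer) (asNum zer))))

  sendE : Exp (graphTy ∷ idx ∷ idx ∷ stateTy ∷ []) stateTy
  sendE =
    ite (andE (fst (get v3 v1)) (andE (notE (fst (get v3 v2))) (get (get v0 v1) v2)))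
      (tab (ite (eqE v0 v3) (pair tru (pair v2 (pair t t)))
             (ite (eqE v0 v2)
               (pair (fst (get v4 v0)) (pair (fst (snd (get v4 v0))) (pair (fst (snd (snd (get v4 v0)))) t)))
               (get v4 v0))))
      v3
    where
    t : Exp (idx ∷ graphTy ∷ idx ∷ idx ∷ stateTy ∷ []) num
    t = inc (snd (snd (snd (get v4 v2))))

  nearE : Exp Γ graphTy → Exp Γ idx → Exp Γ idx → Exp Γ bool
  nearE a c d = orE (get (get a c) d) (eqE c d)

  addP₃E : Exp (graphTy ∷ idx ∷ idx ∷ idx ∷ setTy ∷ []) setTy
  addP₃E =
    ite (andE (notE (get v4 v1)) (andE (notE (get v4 v2)) (andE (notE (get v4 v3))
          (andE (get (get v0 v1) v2) (andE (get (get v0 v2) v3)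
            (andE (notE (eqE v1 v3)) (notE (get (get v0 v1) v3))))))))
      (tab (orE (get v5 v0) (orE (eqE v0 v2) (orE (eqE v0 v3) (eqE v0 v4)))))
      v4

  modulatorE : Exp (graphTy ∷ []) setTy
  modulatorE = fold (tab fal) (fold v1 (fold v1 (call addP₃E (v6 ∷ v4 ∷ v2 ∷ v0 ∷ v1 ∷ []))))

  reachStepE : Exp (graphTy ∷ setTy ∷ idx ∷ idx ∷ idx ∷ idx ∷ stateTy ∷ []) stateTy
  reachStepE =
    ite (andE (fst (get v6 v2)) (andE (get v1 v5) (andE (notE (fst (get v6 v5)))
          (andE (nearE v0 v2 v3) (andE (nearE v0 v3 v4) (nearE v0 v4 v5))))))
      (call sendE (v0 ∷ v4 ∷ v5 ∷
        call sendE (v0 ∷ v3 ∷ v4 ∷ call sendE (v0 ∷ v2 ∷ v3 ∷ v6 ∷ []) ∷ []) ∷ []))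
      v6

  reachE : Exp (graphTy ∷ setTy ∷ stateTy ∷ []) stateTy
  reachE = fold v2 (fold v1 (fold v1 (fold v1 (fold v1
    (call reachStepE (v10 ∷ v11 ∷ v6 ∷ v4 ∷ v2 ∷ v0 ∷ v1 ∷ []))))))

  linkE : Exp (graphTy ∷ setTy ∷ []) graphTy
  linkE = tab (tab (andE (get v3 v0)
    (someE (andE (notE (get v4 v0)) (andE (nearE v3 v0 v2) (get (get v3 v1) v0))))))

  assignedE : Exp Γ assignTy → Exp Γ idx → Exp Γ idx → Exp Γ bool
  assignedE A j x = andE (fst (get A j)) (eqE (snd (get A j)) x)

  goodE : Exp (idx ∷ assignTy ∷ nextTy ∷ idx ∷ []) bool
  goodE = orE (leq (inc (fold (asNum zer) (ite (assignedE v3 v0 v5) (inc v1) v1))) v0) (fst (get v2 v3))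

  closeStepE : Exp (graphTy ∷ idx ∷ assignTy ∷ idx ∷ idx ∷ nextTy ∷ []) nextTy
  closeStepE =
    ite (andE (fst (get v2 v3)) (andE (notE (call goodE (v1 ∷ v2 ∷ v5 ∷ snd (get v2 v3) ∷ [])))
          (andE (get (get v0 v3) v4) (call goodE (v1 ∷ v2 ∷ v5 ∷ v4 ∷ [])))))
      (tab (ite (eqE v0 (snd (get v3 v4))) (pair tru (pair v4 v5)) (get v6 v0)))
      v5

  closeE : Exp (graphTy ∷ idx ∷ assignTy ∷ []) nextTy
  closeE = fold (tab (pair fal (pair v0 v0)))
    (fold v1 (fold v1 (call closeStepE (v6 ∷ v7 ∷ v8 ∷ v2 ∷ v0 ∷ v1 ∷ []))))

  findServerE : Exp (graphTy ∷ idx ∷ assignTy ∷ nextTy ∷ idx ∷ []) (bool ⊗ idx)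
  findServerE = fold (pair fal v4)
    (ite (andE (notE (fst v1)) (andE (get (get v2 v6) v0) (call goodE (v3 ∷ v4 ∷ v5 ∷ v0 ∷ []))))
      (pair tru v0) v1)

  followE : Exp (nextTy ∷ assignTy ⊗ bool ⊗ idx ⊗ idx ∷ []) (assignTy ⊗ bool ⊗ idx ⊗ idx)
  followE =
    ite (fst (snd v1))
      (ite (fst (get v0 (snd (snd (snd v1)))))
        (pair (tab (ite (eqE v0 (fst (snd (get v1 (snd (snd (snd v2)))))))
                     (pair fal v0)
                     (ite (eqE v0 (fst (snd (snd v2)))) (pair tru (snd (snd (snd v2)))) (get (fst v2) v0))))
              (pair tru (snd (get v0 (snd (snd (snd v1)))))))
        (pair (tab (ite (eqE v0 (fst (snd (snd v2)))) (pair tru (snd (snd (snd v2)))) (get (fst v2) v0)))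
              (pair fal (pair (fst (snd (snd v1))) (snd (snd (snd v1)))))))
      (pair (fst v1) (pair (fst (snd v1)) (pair (fst (snd (snd v1))) (snd (snd (snd v1))))))

  augmentE : Exp (nextTy ∷ assignTy ∷ idx ∷ bool ⊗ idx ∷ []) assignTy
  augmentE = fst (fold (pair v1 (pair (fst v3) (pair v2 (snd v3)))) (call followE (v2 ∷ v1 ∷ [])))

  insertE : Exp (graphTy ∷ idx ∷ idx ∷ assignTy ∷ []) assignTy
  insertE = call augmentE (close₀ ∷ v3 ∷ v2 ∷ call findServerE (v0 ∷ v1 ∷ v3 ∷ close₀ ∷ v2 ∷ []) ∷ [])
    where
    close₀ : Exp (graphTy ∷ idx ∷ idx ∷ assignTy ∷ []) nextTy
    close₀ = call closeE (v0 ∷ v1 ∷ v3 ∷ [])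

  assignStepE : Exp (graphTy ∷ setTy ∷ stateTy ∷ idx ∷ idx ∷ assignTy ∷ []) assignTy
  assignStepE =
    ite (andE (notE (get v1 v4)) (notE (someE
          (andE (notE (get v2 v0)) (andE (nearE v1 v0 v5) (orE (fst (get v3 v0)) (fst (get v6 v0))))))))
      (call insertE (call linkE (v0 ∷ v1 ∷ []) ∷ v3 ∷ v4 ∷ v5 ∷ []))
      v5

  assignE : Exp (graphTy ∷ setTy ∷ stateTy ∷ []) assignTy
  assignE = fold (tab (pair fal v0)) (fold v1 (call assignStepE (v4 ∷ v5 ∷ v6 ∷ v2 ∷ v0 ∷ v1 ∷ [])))

  serveStepE : Exp (graphTy ∷ setTy ∷ assignTy ∷ idx ∷ idx ∷ stateTy ∷ []) stateTy
  serveStepE =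
    ite (andE (fst (get v2 v3)) (andE (notE (get v1 v4)) (andE (nearE v0 v4 v3)
          (notE (someE (andE (notE (get v2 v0)) (andE (nearE v1 v0 v4) (fst (get v6 v0)))))))))
      (call sendE (v0 ∷ snd (get v2 v3) ∷ v4 ∷ v5 ∷ []))
      v5

  serveE : Exp (graphTy ∷ setTy ∷ assignTy ∷ stateTy ∷ []) stateTy
  serveE = fold v3 (fold v1 (call serveStepE (v4 ∷ v5 ∷ v6 ∷ v2 ∷ v0 ∷ v1 ∷ [])))

  spreadStepE : Exp (graphTy ∷ setTy ∷ idx ∷ idx ∷ idx ∷ stateTy ∷ []) stateTy
  spreadStepE =
    ite (andE (notE (get v1 v3)) (andE (notE (get v1 v4)) (andE (fst (get v5 v3))
          (andE (leq c v2) (notE (leq (inc c) v2))))))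
      (call sendE (v0 ∷ v3 ∷ v4 ∷ v5 ∷ []))
      v5
    where
    c : Exp (graphTy ∷ setTy ∷ idx ∷ idx ∷ idx ∷ stateTy ∷ []) num
    c = snd (snd (snd (get v5 v3)))

  spreadE : Exp (graphTy ∷ setTy ∷ stateTy ∷ []) stateTy
  spreadE = fold v2 (fold v1 (fold v1 (call spreadStepE (v6 ∷ v7 ∷ v4 ∷ v2 ∷ v0 ∷ v1 ∷ []))))

  finishE : Exp (graphTy ∷ setTy ∷ stateTy ∷ []) stateTy
  finishE = call spreadE (v0 ∷ v1 ∷ call serveE (v0 ∷ v1 ∷ call assignE (v0 ∷ v1 ∷ v2 ∷ []) ∷ v2 ∷ []) ∷ [])

  treeE : Exp (stateTy ∷ []) treeTy
  treeE = pair (tab (fst (snd (get v1 v0)))) (tab (fst (snd (snd (get v1 v0)))))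

  approximateE : Exp (graphTy ∷ idx ∷ []) treeTy
  approximateE = call treeE (call finishE (v0 ∷ S ∷ call reachE (v0 ∷ S ∷ call initialE (v1 ∷ []) ∷ []) ∷ []) ∷ [])
    where
    S : Exp (graphTy ∷ idx ∷ []) setTy
    S = call modulatorE (v0 ∷ [])

  validE : Exp (graphTy ∷ idx ∷ arr idx ∷ arr idx ∷ []) bool
  validE =
    andE (eqE (get v2 v1) v1) (andE (leq (asNum (get v3 v1)) zer) (andE
      (everyE (orE (eqE v0 v2) (andE (get (get v1 (get v3 v0)) v0)
        (leq (inc (asNum (get v4 (get v3 v0)))) (get v4 v0)))))
      (everyE (everyE (orE (eqE v1 v3) (orE (eqE v0 v3) (orE (eqE v1 v0)
        (orE (notE (eqE (get v4 v1) (get v4 v0))) (notE (eqE (get v5 v1) (get v5 v0)))))))))))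

  betterE : Exp (arr num ∷ arr num ∷ []) bool
  betterE = someE (andE (everyE (leq (get v2 v0) v1)) (notE (everyE (leq (get v3 v0) v1))))

  improveE : Exp (graphTy ∷ idx ∷ arr idx ∷ arr idx ∷ treeTy ∷ []) treeTy
  improveE =
    ite (andE (call validE (v0 ∷ v1 ∷ v2 ∷ v3 ∷ [])) (call betterE (tab (asNum (get v4 v0)) ∷ snd v4 ∷ [])))
      (pair v2 (tab (asNum (get v4 v0))))
      v4

  optimumE : Exp (graphTy ∷ idx ∷ []) treeTy
  optimumE = enum approximateE (enum v1 (call improveE (v4 ∷ v5 ∷ v2 ∷ v0 ∷ v1 ∷ [])))

  matrixE : Exp (treeTy ∷ []) (arr (arr num))
  matrixE = tab (tab
    (ite (eqE (get (fst v2) v0) v1) (get (snd v2) v0)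
      (ite (eqE (get (fst v2) v1) v0) (get (snd v2) v1) (asNum zer))))

  largeE : ℕ → Exp (graphTy ∷ idx ∷ []) bool
  largeE M = notE (leq (asNum (rep M (fold zer v0)
    (fold v0 (ite (get (call modulatorE (v3 ∷ [])) v0) (half (half (half v1))) v1)))) zer)

  module _ {N} (a : Fin (suc N) → Fin (suc N) → Bool) where
    open Algorithm {N}

    opaque
      unfolding apply _&_ _or_ not _==_

      -- The functions above are written to mirror the expressions; with calls and Boolean
      -- operations unfolded, both sides agree by definition.
      sem-modulator : apply (sem modulatorE) (a , tt) ≡ modulator a
      sem-modulator = refl

      sem-initial : ∀ s → apply (sem initialE) (s , tt) ≡ initial s
      sem-initial s = refl

      sem-reach : ∀ S st → apply (sem reachE) (a , S , st , tt) ≡ reach a S st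
      sem-reach S st = refl

      sem-assign : ∀ S st → apply (sem assignE) (a , S , st , tt) ≡ assign a S st
      sem-assign S st = refl

      sem-serve : ∀ S A st → apply (sem serveE) (a , S , A , st , tt) ≡ serve a S A st
      sem-serve S A st = refl

      sem-spread : ∀ S st → apply (sem spreadE) (a , S , st , tt) ≡ spread a S st
      sem-spread S st = refl

      sem-tree : ∀ st → apply (sem treeE) (st , tt) ≡ (par st , birth st)
      sem-tree st = refl

      sem-matrix : ∀ t → sem matrixE (t , tt) ≡ matrix t
      sem-matrix t = refl

      sem-large : ∀ s M → sem (largeE M) (a , s , tt) ≡ large a M
      sem-large s M = refl

    sem-finish : ∀ S st → apply (sem finishE) (a , S , st , tt) ≡ finish a S st
    sem-finish S st = begin
      apply (sem finishE) (a , S , st , tt)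
        ≡⟨ apply-def (sem finishE) (a , S , st , tt) ⟨
      apply (sem spreadE) (a , S , apply (sem serveE) (a , S , A₀ , st , tt) , tt)
        ≡⟨ cong (λ z → apply (sem spreadE) (a , S , z , tt)) (sem-serve S A₀ st) ⟩
      apply (sem spreadE) (a , S , serve a S A₀ st , tt)
        ≡⟨ cong (λ A → apply (sem spreadE) (a , S , serve a S A st , tt)) (sem-assign S st) ⟩
      apply (sem spreadE) (a , S , serve a S (assign a S st) st , tt)
        ≡⟨ sem-spread S (serve a S (assign a S st) st) ⟩
      finish a S st ∎
      where
      open ≡-Reasoning
      A₀ = apply (sem assignE) (a , S , st , tt)

    sem-approximate : ∀ s → sem approximateE (a , s , tt) ≡ approximate a s
    sem-approximate s = begin
      F S₀ (apply (sem reachE) (a , S₀ , apply (sem initialE) (s , tt) , tt))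
        ≡⟨ cong (λ z → F S₀ (apply (sem reachE) (a , S₀ , z , tt))) (sem-initial s) ⟩
      F S₀ (apply (sem reachE) (a , S₀ , initial s , tt))
        ≡⟨ cong (λ S → F S (apply (sem reachE) (a , S , initial s , tt))) sem-modulator ⟩
      F S₁ (apply (sem reachE) (a , S₁ , initial s , tt))
        ≡⟨ cong (F S₁) (sem-reach S₁ (initial s)) ⟩
      F S₁ (reach a S₁ (initial s))
        ≡⟨ cong (λ st → apply (sem treeE) (st , tt)) (sem-finish S₁ (reach a S₁ (initial s))) ⟩
      apply (sem treeE) (finish a S₁ (reach a S₁ (initial s)) , tt)
        ≡⟨ sem-tree (finish a S₁ (reach a S₁ (initial s))) ⟩
      approximate a s ∎
      where
      open ≡-Reasoning
      S₀ = apply (sem modulatorE) (a , tt)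
      S₁ = modulator a
      F : (V → Bool) → State → (V → V) × (V → ℕ)
      F S st = apply (sem treeE) (apply (sem finishE) (a , S , st , tt) , tt)

    sem-optimum : ∀ s → sem optimumE (a , s , tt) ≡ optimum a s
    sem-optimum s = trans
      (cong (λ z → foldLists (suc N) [] z (λ p acc →
        foldLists (suc N) [] acc (λ f acc → apply (sem improveE) (a , s , p , f , acc , tt)))) (sem-approximate s))
      (improveLoop (approximate a s))
      where
      opaque
        unfolding apply _&_ _or_ not _==_
        improveLoop : ∀ z → foldLists (suc N) [] z (λ p acc →
          foldLists (suc N) [] acc (λ f acc → apply (sem improveE) (a , s , p , f , acc , tt))) ≡
          foldLists (suc N) [] z (λ p acc → foldLists (suc N) [] acc (λ f acc → improve a s p f acc))
        improveLoop z = refl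

open Programs

-- Boolean tests, loop invariants and double counting

module Counting where

  private
    variable
      m n : ℕ
      a b c : Bool
      i j : Fin m

  opaque
    unfolding _&_ _or_ not

    &-elim : T (a & b) → T a × T b
    &-elim {true} {true} _ = tt , tt

    &-intro : T a → T b → T (a & b)
    &-intro {true} _ q = q

    or-elim : T (a or b) → T a ⊎ T b
    or-elim {true} _ = inj₁ tt
    or-elim {false} q = inj₂ q

    or-introˡ : T a → T (a or b)
    or-introˡ {true} _ = tt

    or-introʳ : T b → T (a or b)
    or-introʳ {a = true} _ = tt
    or-introʳ {a = false} q = q

    not-elim : T (not a) → ¬ T a
    not-elim {false} _ ()

    not-intro : ¬ T a → T (not a)
    not-intro {true} f = f tt
    not-intro {false} f = tt

  if-T : ∀ {A : Set} {x y : A} → T a → (if a then x else y) ≡ x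
  if-T {true} _ = refl

  if-F : ∀ {A : Set} {x y : A} → ¬ T a → (if a then x else y) ≡ y
  if-F {true} p = ⊥-elim (p tt)
  if-F {false} p = refl

  ≤ᴮ⇒≤ : ∀ x {y} → T (x ≤ᴮ y) → x ≤ y
  ≤ᴮ⇒≤ zero _ = z≤n
  ≤ᴮ⇒≤ (suc x) {suc y} p = s≤s (≤ᴮ⇒≤ x p)

  ≤⇒≤ᴮ : ∀ {x y} → x ≤ y → T (x ≤ᴮ y)
  ≤⇒≤ᴮ z≤n = tt
  ≤⇒≤ᴮ (s≤s p) = ≤⇒≤ᴮ p

  opaque
    unfolding _==_

    ==⇒≡ : ∀ (i j : Fin m) → T (i == j) → i ≡ j
    ==⇒≡ i j p = let p₁ , p₂ = &-elim p in toℕ-injective (≤-antisym (≤ᴮ⇒≤ (toℕ i) p₁) (≤ᴮ⇒≤ (toℕ j) p₂))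

    ==-refl : ∀ (i : Fin m) → T (i == i)
    ==-refl i = &-intro (≤⇒≤ᴮ (≤-refl {toℕ i})) (≤⇒≤ᴮ (≤-refl {toℕ i}))

    ≡⇒== : i ≡ j → T (i == j)
    ≡⇒== {i = i} refl = ==-refl i

  module _ {A : Set} where

    foldl-tabulate-ind : ∀ {B : Set} {f : A → B → A} (g : Fin n → B) {x} (P : ℕ → A → Set) →
                         (∀ i x → P (toℕ i) x → P (suc (toℕ i)) (f x (g i))) → P 0 x →
                         P n (foldl f x (tabulate g))
    foldl-tabulate-ind {n = zero} g P s p = p
    foldl-tabulate-ind {n = suc n} g P s p =
      foldl-tabulate-ind (g ∘ suc) (P ∘ suc) (λ i → s (suc i)) (s zero _ p)

    foldFin-ind : ∀ {f : Fin m → A → A} {x} (P : ℕ → A → Set) →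
                  (∀ i x → P (toℕ i) x → P (suc (toℕ i)) (f i x)) → P 0 x → P m (foldFin x f)
    foldFin-ind {f = f} {x} P s p = subst (P _) (foldFin-foldl x f) (foldl-tabulate-ind id P s p)

    foldFin-inv : ∀ {f : Fin m → A → A} {x} (P : A → Set) →
                  (∀ i x → P x → P (f i x)) → P x → P (foldFin x f)
    foldFin-inv P s p = foldFin-ind (λ _ → P) s p

    -- Shows that a loop achieves what its iteration i achieves: P survives until then, and Q
    -- survives afterwards. Nested loops are handled by nesting it.
    foldFin-hit : ∀ {f : Fin m → A → A} {x} (i : Fin m) (P Q : A → Set) →
                  (∀ j x → P x → P (f j x)) → (∀ x → P x → Q (f i x)) →
                  (∀ j x → P x → Q x → Q (f j x)) → P x → Q (foldFin x f)
    foldFin-hit {m = m} {f = f} i P Q s h t p = proj₂ (foldFin-ind R step (p , λ ())) (toℕ<n i)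
      where
      R : ℕ → A → Set
      R k x = P x × (toℕ i < k → Q x)
      step : ∀ j x → R (toℕ j) x → R (suc (toℕ j)) (f j x)
      step j x (p , q) with j ≟ i
      ... | yes refl = s j x p , λ _ → h x p
      ... | no j≢i = s j x p , λ lt → t j x p (q (≤∧≢⇒< (≤-pred lt) (λ e → j≢i (sym (toℕ-injective e)))))

  anyB-elim : (f : Fin m → Bool) → T (anyB f) → ∃[ i ] T (f i)
  anyB-elim f = foldFin-inv (λ acc → T acc → ∃[ i ] T (f i))
    (λ i acc ih p → [ (λ q → i , q) , ih ]′ (or-elim p)) (λ ())

  anyB-intro : (f : Fin m → Bool) (i : Fin m) → T (f i) → T (anyB f)
  anyB-intro f i p = foldFin-hit i (λ _ → ⊤) T (λ _ _ _ → tt) (λ _ _ → or-introˡ p)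
    (λ j x _ q → or-introʳ {a = f j} q) tt

  allB-elim : (f : Fin m → Bool) → T (allB f) → ∀ i → T (f i)
  allB-elim f p i with T? (f i)
  ... | yes q = q
  ... | no ¬q = ⊥-elim (not-elim p (anyB-intro _ i (not-intro ¬q)))

  allB-intro : (f : Fin m → Bool) → (∀ i → T (f i)) → T (allB f)
  allB-intro f p = not-intro (λ q → let i , r = anyB-elim _ q in not-elim r (p i))

  sum-mono : {f g : Fin m → ℕ} → (∀ i → f i ≤ g i) → sum f ≤ sum g
  sum-mono {zero} p = z≤n
  sum-mono {suc m} p = +-mono-≤ (p zero) (sum-mono (p ∘ suc))

  term≤sum : (f : Fin m → ℕ) (i : Fin m) → f i ≤ sum f
  term≤sum f zero = m≤m+n _ _
  term≤sum f (suc i) = ≤-trans (term≤sum (f ∘ suc) i) (m≤n+m _ _)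

  sum-zero : {f : Fin m → ℕ} → (∀ i → f i ≡ 0) → sum f ≡ 0
  sum-zero {zero} p = refl
  sum-zero {suc m} p = cong₂ _+_ (p zero) (sum-zero (p ∘ suc))

  sum-single : {f : Fin m → ℕ} (x : Fin m) → (∀ i → i ≢ x → f i ≡ 0) → sum f ≡ f x
  sum-single {f = f} zero p =
    trans (cong (f zero +_) (sum-zero {f = f ∘ suc} (λ i → p (suc i) (λ ())))) (+-identityʳ _)
  sum-single (suc x) p =
    cong₂ _+_ (p zero (λ ())) (sum-single x (λ i i≢x → p (suc i) (λ { refl → i≢x refl })))

  δ : Fin m → ℕ → Fin m → ℕ
  δ x k i = if i == x then k else 0

  δ-at : ∀ (x : Fin m) k → δ x k x ≡ k
  δ-at x k = if-T (==-refl x)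

  δ-off : ∀ {i x : Fin m} {k} → i ≢ x → δ x k i ≡ 0
  δ-off {i = i} {x} p = if-F (λ q → p (==⇒≡ i x q))

  sum-δ : ∀ (x : Fin m) k → sum (δ x k) ≡ k
  sum-δ x k = trans (sum-single x (λ i → δ-off)) (δ-at x k)

  -- Moving the value of g at v over to u keeps its sum and makes it dominate f everywhere. In the
  -- application the sums are the potentials of a clique before and after a call from u to v.
  sum-merge : {f g : Fin m → ℕ} (u v : Fin m) → u ≢ v → (∀ i → i ≢ u → i ≢ v → f i ≤ g i) →
              f v ≡ 0 → f u ≤ g u + g v → sum f ≤ sum g
  sum-merge {f = f} {g} u v u≢v other fv fu = +-cancelʳ-≤ (g v) (sum f) (sum g) (begin
    sum f + g v                       ≡⟨ cong (sum f +_) (sum-δ v (g v)) ⟨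
    sum f + sum (δ v (g v))           ≡⟨ ∑-distrib-+ f (δ v (g v)) ⟨
    sum (λ i → f i + δ v (g v) i)     ≤⟨ sum-mono pointwise ⟩
    sum (λ i → g i + δ u (g v) i)     ≡⟨ ∑-distrib-+ g (δ u (g v)) ⟩
    sum g + sum (δ u (g v))           ≡⟨ cong (sum g +_) (sum-δ u (g v)) ⟩
    sum g + g v                       ∎)
    where
    open ≤-Reasoning
    pointwise : ∀ i → f i + δ v (g v) i ≤ g i + δ u (g v) i
    pointwise i with i ≟ v | i ≟ u
    ... | yes refl | _ = ≤-trans (≤-reflexive (cong₂ _+_ fv (δ-at v (g v)))) (m≤m+n (g v) _)
    ... | no i≢v | yes refl = begin
      f u + δ v (g v) u ≡⟨ cong (f u +_) (δ-off i≢v) ⟩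
      f u + 0           ≡⟨ +-identityʳ (f u) ⟩
      f u               ≤⟨ fu ⟩
      g u + g v         ≡⟨ cong (g u +_) (δ-at u (g v)) ⟨
      g u + δ u (g v) u ∎
    ... | no i≢v | no i≢u = begin
      f i + δ v (g v) i ≡⟨ cong (f i +_) (δ-off i≢v) ⟩
      f i + 0           ≡⟨ +-identityʳ (f i) ⟩
      f i               ≤⟨ other i i≢u i≢v ⟩
      g i               ≤⟨ m≤m+n (g i) _ ⟩
      g i + δ u (g v) i ∎

  [_]ᴮ : Bool → ℕ
  [ b ]ᴮ = if b then 1 else 0

  []ᴮ≤1 : ∀ b → [ b ]ᴮ ≤ 1
  []ᴮ≤1 true = ≤-refl
  []ᴮ≤1 false = z≤n

  []ᴮ-mono : (T a → T b) → [ a ]ᴮ ≤ [ b ]ᴮ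
  []ᴮ-mono {true} {true} p = ≤-refl
  []ᴮ-mono {true} {false} p = ⊥-elim (p tt)
  []ᴮ-mono {false} p = z≤n

  count : (Fin m → Bool) → ℕ
  count P = sum (λ i → [ P i ]ᴮ)

  module _ {P Q : Fin m → Bool} where

    count-mono : (∀ i → T (P i) → T (Q i)) → count P ≤ count Q
    count-mono p = sum-mono (λ i → []ᴮ-mono (p i))

    count-union : ∀ {R : Fin m → Bool} → (∀ i → T (P i) → T (Q i) ⊎ T (R i)) → count P ≤ count Q + count R
    count-union {R} p = ≤-trans (sum-mono pointwise) (≤-reflexive (∑-distrib-+ (λ i → [ Q i ]ᴮ) (λ i → [ R i ]ᴮ)))
      where
      pointwise : ∀ i → [ P i ]ᴮ ≤ [ Q i ]ᴮ + [ R i ]ᴮ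
      pointwise i with P i in eq
      ... | false = z≤n
      ... | true with p i (subst T (sym eq) tt)
      ...   | inj₁ q = ≤-trans ([]ᴮ-mono {true} (λ _ → q)) (m≤m+n _ _)
      ...   | inj₂ r = ≤-trans ([]ᴮ-mono {true} (λ _ → r)) (m≤n+m _ _)

    count-disjoint : ∀ {R : Fin m → Bool} → (∀ i → T (Q i) → T (P i)) → (∀ i → T (R i) → T (P i)) →
                     (∀ i → T (Q i) → ¬ T (R i)) → count Q + count R ≤ count P
    count-disjoint {R} q r d =
      ≤-trans (≤-reflexive (sym (∑-distrib-+ (λ i → [ Q i ]ᴮ) (λ i → [ R i ]ᴮ)))) (sum-mono pointwise)
      where
      pointwise : ∀ i → [ Q i ]ᴮ + [ R i ]ᴮ ≤ [ P i ]ᴮ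
      pointwise i with Q i | R i | q i | r i | d i
      ... | true  | true  | q | r | d = ⊥-elim (d tt tt)
      ... | true  | false | q | r | d = []ᴮ-mono q
      ... | false | true  | q | r | d = []ᴮ-mono r
      ... | false | false | q | r | d = z≤n

  count-single : (x : Fin m) → count (_== x) ≡ 1
  count-single x = sum-δ x 1

  module _ {P Q : Fin m → Bool} where

    count-< : ∀ x → T (Q x) → ¬ T (P x) → (∀ i → T (P i) → T (Q i)) → count P < count Q
    count-< x q ¬p sub = subst (_≤ count Q) (cong (_+ count P) (count-single x))
      (count-disjoint (λ i e → subst (T ∘ Q) (sym (==⇒≡ i x e)) q) sub
        (λ i e p → ¬p (subst (T ∘ P) (==⇒≡ i x e) p)))

    count-insert : ∀ x → (∀ i → T (Q i) → T (P i) ⊎ i ≡ x) → count Q ≤ suc (count P)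
    count-insert x p = subst (count Q ≤_) (cong (_+ count P) (count-single x))
      (count-union {P = Q} {Q = _== x} {R = P} (λ i q → [ inj₂ , (λ e → inj₁ (≡⇒== e)) ]′ (p i q)))

  count≤ : (P : Fin m → Bool) → count P ≤ m
  count≤ {zero} P = z≤n
  count≤ {suc m} P = +-mono-≤ ([]ᴮ≤1 (P zero)) (count≤ (P ∘ suc))

  count-true : ∀ m → count {m} (λ _ → true) ≡ m
  count-true zero = refl
  count-true (suc m) = cong suc (count-true m)

  count-missing : {P : Fin m → Bool} (x : Fin m) → ¬ T (P x) → count P < m
  count-missing {m} {P} x ¬p = subst (count P <_) (count-true m) (count-< {P = P} {Q = λ _ → true} x tt ¬p (λ _ _ → tt))

  count-unique : {P : Fin m → Bool} → (∀ i j → T (P i) → T (P j) → i ≡ j) → count P ≤ 1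
  count-unique {P = P} u with any? (λ i → T? (P i))
  ... | yes (x , p) = subst (count P ≤_) (count-single x) (count-mono (λ i q → ≡⇒== (u i x q p)))
  ... | no none = ≤-trans (≤-reflexive (sum-zero zeros)) z≤n
    where
    zeros : ∀ i → [ P i ]ᴮ ≡ 0
    zeros i = if-F (λ p → none (i , p))

  opaque
    unfolding _&_

    []ᴮ-& : ∀ a b → [ a & b ]ᴮ ≡ [ a ]ᴮ * [ b ]ᴮ
    []ᴮ-& true b = sym (+-identityʳ _)
    []ᴮ-& false b = refl

  module _ {P : Fin m → Bool} {Q : Fin n → Bool} (R : Fin m → Fin n → Bool) (k : ℕ) where

    private
      swap : sum (λ i → sum (λ y → [ Q y & P i & R i y ]ᴮ)) ≡
             sum (λ y → [ Q y ]ᴮ * count (λ i → P i & R i y))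
      swap = trans (∑-comm (λ i y → [ Q y & P i & R i y ]ᴮ)) (sum-cong-≗ (λ y →
               trans (sum-cong-≗ (λ i → []ᴮ-& (Q y) (P i & R i y)))
                     (sym (*-distribˡ-sum [ Q y ]ᴮ (λ i → [ P i & R i y ]ᴮ)))))

      scale : sum (λ y → [ Q y ]ᴮ * k) ≡ k * count Q
      scale = trans (sum-cong-≗ (λ y → *-comm [ Q y ]ᴮ k)) (sym (*-distribˡ-sum k (λ y → [ Q y ]ᴮ)))

    -- The pairs in R are counted from both sides: every i of P contributes at least one, every y of
    -- Q at most k.
    count-fibres≤ : (∀ i → T (P i) → ∃[ y ] T (Q y) × T (R i y)) →
                    (∀ y → T (Q y) → count (λ i → P i & R i y) ≤ k) → count P ≤ k * count Q
    count-fibres≤ total bounded = begin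
      sum (λ i → [ P i ]ᴮ)                                ≤⟨ sum-mono below ⟩
      sum (λ i → sum (λ y → [ Q y & P i & R i y ]ᴮ))      ≡⟨ swap ⟩
      sum (λ y → [ Q y ]ᴮ * count (λ i → P i & R i y))    ≤⟨ sum-mono (λ y → fibre y (Q y) (bounded y)) ⟩
      sum (λ y → [ Q y ]ᴮ * k)                            ≡⟨ scale ⟩
      k * count Q                                         ∎
      where
      open ≤-Reasoning
      below : ∀ i → [ P i ]ᴮ ≤ sum (λ y → [ Q y & P i & R i y ]ᴮ)
      below i with T? (P i)
      ... | no ¬p = ≤-trans (≤-reflexive (if-F ¬p)) z≤n
      ... | yes p = let y , q , r = total i p in
        ≤-trans ([]ᴮ-mono (λ _ → &-intro q (&-intro p r))) (term≤sum (λ y → [ Q y & P i & R i y ]ᴮ) y)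
      fibre : ∀ y b → (T b → count (λ i → P i & R i y) ≤ k) → [ b ]ᴮ * count (λ i → P i & R i y) ≤ [ b ]ᴮ * k
      fibre y true le = *-monoʳ-≤ 1 (le tt)
      fibre y false le = z≤n

    -- The same count of pairs with both estimates reversed, R being functional on P.
    count-fibres≥ : (∀ i y z → T (P i) → T (R i y) → T (R i z) → y ≡ z) →
                    (∀ y → T (Q y) → k ≤ count (λ i → P i & R i y)) → k * count Q ≤ count P
    count-fibres≥ functional bounded = begin
      k * count Q                                         ≡⟨ scale ⟨
      sum (λ y → [ Q y ]ᴮ * k)                            ≤⟨ sum-mono (λ y → fibre y (Q y) (bounded y)) ⟩
      sum (λ y → [ Q y ]ᴮ * count (λ i → P i & R i y))    ≡⟨ swap ⟨
      sum (λ i → sum (λ y → [ Q y & P i & R i y ]ᴮ))      ≤⟨ sum-mono above ⟩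
      sum (λ i → [ P i ]ᴮ)                                ∎
      where
      open ≤-Reasoning
      above : ∀ i → sum (λ y → [ Q y & P i & R i y ]ᴮ) ≤ [ P i ]ᴮ
      above i with T? (P i)
      ... | no ¬p = ≤-trans (≤-reflexive (sum-zero {f = λ y → [ Q y & P i & R i y ]ᴮ} (λ y → if-F (λ t → ¬p (proj₁ (&-elim (proj₂ (&-elim t)))))))) z≤n
      ... | yes p = ≤-trans
        (count-unique {P = λ y → Q y & P i & R i y} (λ y z s t → functional i y z p (proj₂ (&-elim (proj₂ (&-elim s)))) (proj₂ (&-elim (proj₂ (&-elim t))))))
        ([]ᴮ-mono {true} (λ _ → p))
      fibre : ∀ y b → (T b → k ≤ count (λ i → P i & R i y)) → [ b ]ᴮ * k ≤ [ b ]ᴮ * count (λ i → P i & R i y)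
      fibre y true le = *-monoʳ-≤ 1 (le tt)
      fibre y false le = z≤n

  foldFin-count : (P : Fin m → Bool) → foldFin 0 (λ i acc → if P i then suc acc else acc) ≡ count P
  foldFin-count P = trans (sym (foldFin-foldl 0 _)) (go id 0)
    where
    go : ∀ {n} (g : Fin n → Fin _) k →
         foldl (λ acc i → if P i then suc acc else acc) k (tabulate g) ≡ k + count (P ∘ g)
    go {zero} g k = sym (+-identityʳ k)
    go {suc n} g k with P (g zero)
    ... | true = trans (go (g ∘ suc) (suc k)) (sym (+-suc k _))
    ... | false = go (g ∘ suc) k

open Counting

-- Broadcasts as parents and times, and their extraction from rounds

record Broadcast {n} (a : Fin n → Fin n → Bool) (s : Fin n) (p : Fin n → Fin n) (f : Fin n → ℕ) : Set where
  field
    root     : p s ≡ s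
    rootTime    : f s ≡ 0
    edge     : ∀ v → v ≢ s → T (a (p v) v)
    -- Times that increase strictly away from the root exclude cycles and make the edge to the
    -- parent the earliest at v; `distinct` is properness of the coloring among siblings.
    later    : ∀ v → v ≢ s → f (p v) < f v
    distinct : ∀ v w → v ≢ s → w ≢ s → v ≢ w → p v ≡ p w → f v ≢ f w

module _ {n} (G : Graph n) where

  -- `Broadcast` relative to an arbitrary set I of informed vertices, which is what an induction
  -- over the remaining rounds requires.
  record History (I : Subset n) (r : ℕ) : Set where
    field
      p        : Fin n → Fin n
      f        : Fin n → ℕ
      old      : ∀ v → v ∈ I → p v ≡ v × f v ≡ 0
      positive : ∀ v → v ∉ I → 1 ≤ f v
      bounded  : ∀ v → f v ≤ r
      edge     : ∀ v → v ∉ I → Adj G (p v) v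
      later    : ∀ v → v ∉ I → f (p v) < f v
      distinct : ∀ v w → v ∉ I → w ∉ I → v ≢ w → p v ≡ p w → f v ≢ f w

  history : ∀ {r I} → Rounds G r I Subset.⊤ → History I r
  history done = record
    { p = id ; f = λ _ → 0 ; old = λ _ _ → refl , refl ; bounded = λ _ → z≤n
    ; positive = λ v p → ⊥-elim (p ∈⊤) ; edge = λ v p → ⊥-elim (p ∈⊤)
    ; later = λ v p → ⊥-elim (p ∈⊤) ; distinct = λ v _ p → ⊥-elim (p ∈⊤) }
  history (next {r} {I} {J} R rest) = record
    { p = λ v → proj₁ (view v) ; f = λ v → proj₁ (proj₂ (view v))
    ; old = λ v → old′ (proj₂ (proj₂ (view v))) ; positive = λ v → positive′ (proj₂ (proj₂ (view v)))
    ; bounded = λ v → bounded′ (proj₂ (proj₂ (view v))) ; edge = λ v → edge′ (proj₂ (proj₂ (view v)))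
    ; later = λ v → later′ (proj₂ (proj₂ (view v))) (proj₂ (proj₂ (view _)))
    ; distinct = λ v w → distinct′ (proj₂ (proj₂ (view v))) (proj₂ (proj₂ (view w))) }
    where
    module R = Round R
    module H = History (history rest)

    -- The parent and the time of v depend on whether v is informed before, in or after the first of
    -- the rounds; the times in the remaining rounds shift by one.
    data View (v : Fin n) : Fin n → ℕ → Set where
      before : v ∈ I → View v v 0
      now    : ∀ {u} → v ∈ J → R.call u ≡ just v → View v u 1
      after  : v ∉ J → View v (H.p v) (suc (H.f v))

    view : ∀ v → ∃[ u ] ∃[ k ] View v u k
    view v with v ∈? I | v ∈? J
    ... | yes i | _ = v , 0 , before i
    ... | no _  | no j = _ , _ , after j
    ... | no i  | yes j with Equivalence.to (R.informs v) j
    ...   | inj₁ i′ = ⊥-elim (i i′)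
    -- Several vertices may call v in the same round; any one of them can serve as its parent.
    ...   | inj₂ (u , e) = u , 1 , now j e

    I⊆J : ∀ {v} → v ∈ I → v ∈ J
    I⊆J {v} i = Equivalence.from (R.informs v) (inj₁ i)

    old′ : ∀ {v u k} → View v u k → v ∈ I → u ≡ v × k ≡ 0
    old′ (before _) i = refl , refl
    old′ (now _ e) i = ⊥-elim (proj₁ (proj₂ (R.valid _ _ e)) i)
    old′ (after j) i = ⊥-elim (j (I⊆J i))

    positive′ : ∀ {v u k} → View v u k → v ∉ I → 1 ≤ k
    positive′ (before i) ¬i = ⊥-elim (¬i i)
    positive′ (now _ _) _ = ≤-refl
    positive′ (after _) _ = s≤s z≤n

    bounded′ : ∀ {v u k} → View v u k → k ≤ suc r
    bounded′ (before _) = z≤n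
    bounded′ (now _ _) = s≤s z≤n
    bounded′ (after _) = s≤s (H.bounded _)

    edge′ : ∀ {v u k} → View v u k → v ∉ I → Adj G u v
    edge′ (before i) ¬i = ⊥-elim (¬i i)
    edge′ (now _ e) _ = proj₂ (proj₂ (R.valid _ _ e))
    edge′ (after j) _ = H.edge _ j

    later′ : ∀ {v u k u′ k′} → View v u k → View u u′ k′ → v ∉ I → k′ < k
    later′ (before i) _ ¬i = ⊥-elim (¬i i)
    later′ (now _ e) w _ = subst (_< 1) (sym (proj₂ (old′ w (proj₁ (R.valid _ _ e))))) (s≤s z≤n)
    later′ (after j) (before _) _ = s≤s z≤n
    later′ (after j) (now _ _) _ = s≤s (H.positive _ j)
    later′ (after j) (after _) _ = s≤s (H.later _ j)

    distinct′ : ∀ {v u k w u′ k′} → View v u k → View w u′ k′ →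
                v ∉ I → w ∉ I → v ≢ w → u ≡ u′ → k ≢ k′
    distinct′ (before i) _ ¬i = ⊥-elim (¬i i)
    distinct′ (now _ _) (before i) _ ¬i = ⊥-elim (¬i i)
    distinct′ (after _) (before i) _ ¬i = ⊥-elim (¬i i)
    distinct′ (now _ e) (now _ e′) _ _ v≢w refl _ = v≢w (just-injective (trans (sym e) e′))
    distinct′ (now _ e) (after j) _ _ _ _ q = <⇒≢ (H.positive _ j) (suc-injective q)
    distinct′ (after j) (now _ e) _ _ _ _ q = <⇒≢ (H.positive _ j) (sym (suc-injective q))
    distinct′ (after j) (after j′) _ _ v≢w e q = H.distinct _ _ j j′ v≢w e (suc-injective q)

  rounds⇒broadcast : ∀ {r s} → Rounds G r ⁅ s ⁆ Subset.⊤ →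
                     ∃[ p ] ∃[ f ] Broadcast (adj G) s p f × (∀ v → f v ≤ r)
  rounds⇒broadcast {s = s} R = H.p , H.f , record
    { root = proj₁ (H.old s (x∈⁅x⁆ s)) ; rootTime = proj₂ (H.old s (x∈⁅x⁆ s))
    ; edge = λ v q → H.edge v (out q) ; later = λ v q → H.later v (out q)
    ; distinct = λ v w q q′ → H.distinct v w (out q) (out q′) } , H.bounded
    where
    module H = History (history R)
    out : ∀ {v} → v ≢ s → v ∉ ⁅ s ⁆
    out q m = q (x∈⁅y⁆⇒x≡y s m)

  -- Rounds that inform nobody can be dropped.
  shorten : ∀ {r I} → Rounds G r I Subset.⊤ → ∃[ r′ ] Rounds G r′ I Subset.⊤ × r′ + ∣ I ∣ ≤ n
  shorten done = 0 , done , ∣p∣≤n Subset.⊤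
  shorten (next {I = I} {J} R rest) with shorten rest
  ... | r′ , rest′ , le with any? (λ v → (v ∈? J) ×-dec ¬? (v ∈? I))
  ...   | yes (v , j , ¬i) = suc r′ , next R rest′ , ≤-trans
            (≤-reflexive (sym (+-suc r′ ∣ I ∣)))
            (≤-trans (+-monoʳ-≤ r′ (p⊂q⇒∣p∣<∣q∣ ((λ {x} i → Equivalence.from (Round.informs R x) (inj₁ i)) , v , j , ¬i))) le)
  ...   | no none = r′ , subst (λ K → Rounds G r′ K Subset.⊤) J≡I rest′ , subst (λ K → r′ + ∣ K ∣ ≤ n) J≡I le
    where
    J≡I : J ≡ I
    J≡I = ⊆-antisym (λ {v} j → decidable-stable (v ∈? I) (λ ¬i → none (v , j , ¬i)))
                    (λ {v} i → Equivalence.from (Round.informs R v) (inj₁ i))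

  -- Rounds without effect can be removed, and the others inform at least one vertex each. Hence b
  -- is an index: it occurs among the limits of `assign`, and the search can represent the times of
  -- an optimal protocol.
  broadcastTime< : ∀ {s b} → IsBroadcastTime G s b → b < n
  broadcastTime< {s} (R , minimal) = let r′ , R′ , le = shorten R in
    ≤-trans (s≤s (minimal r′ R′))
      (≤-trans (≤-reflexive (trans (+-comm 1 r′) (cong (λ z → r′ + z) (sym (∣⁅x⁆∣≡1 s))))) le)

module _ {n} {a : Fin n → Fin n → Bool} {s : Fin n} {p f} (B : Broadcast a s p f) where
  open Broadcast B

  f≡0⇒source : ∀ v → f v ≤ 0 → v ≡ s
  f≡0⇒source v q = decidable-stable (v ≟ s) (λ v≢s → n≮0 (≤-trans (later v v≢s) q))

  -- The vertices of time j + 1 are mapped injectively to their parents, which have time at most j,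
  -- since siblings have different times. So the number at most doubles in each round.
  count-informed : ∀ j → count (λ v → f v ≤ᴮ j) ≤ 2 ^ j
  count-informed zero = count-unique (λ v w q r →
    trans (f≡0⇒source v (≤ᴮ⇒≤ (f v) q)) (sym (f≡0⇒source w (≤ᴮ⇒≤ (f w) r))))
  count-informed (suc j) = begin
    count (λ v → f v ≤ᴮ suc j)          ≤⟨ count-union {Q = P} {R = new} split ⟩
    count P + count new                 ≤⟨ +-monoʳ-≤ (count P) (count-fibres≤ {P = new} {Q = P} (λ v y → p v == y) 1 parent fibre) ⟩
    2 * count P                         ≤⟨ *-monoʳ-≤ 2 (count-informed j) ⟩
    2 ^ suc j                           ∎
    where
    open ≤-Reasoning
    P new : Fin n → Bool
    P v = f v ≤ᴮ j
    new v = (f v ≤ᴮ suc j) & not (f v ≤ᴮ j)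
    split : ∀ v → T (f v ≤ᴮ suc j) → T (P v) ⊎ T (new v)
    split v q with T? (P v)
    ... | yes r = inj₁ r
    ... | no r = inj₂ (&-intro q (not-intro r))
    exact : ∀ v → T (new v) → f v ≡ suc j
    exact v q = let q₁ , q₂ = &-elim q in
      ≤-antisym (≤ᴮ⇒≤ (f v) q₁) (≰⇒> (λ r → not-elim q₂ (≤⇒≤ᴮ r)))
    inner : ∀ v → T (new v) → v ≢ s
    inner v q refl = 1+n≢0 (trans (sym (exact v q)) rootTime)
    parent : ∀ v → T (new v) → ∃[ y ] T (P y) × T (p v == y)
    parent v q = p v , ≤⇒≤ᴮ (≤-pred (subst (f (p v) <_) (exact v q) (later v (inner v q)))) , ==-refl (p v)
    fibre : ∀ y → T (P y) → count (λ v → new v & (p v == y)) ≤ 1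
    fibre y _ = count-unique {P = λ v → new v & (p v == y)} (λ v w q r →
      let q₁ , q₂ = &-elim q; r₁ , r₂ = &-elim r in
      decidable-stable (v ≟ w) (λ v≢w → distinct v w (inner v q₁) (inner w r₁) v≢w
        (trans (==⇒≡ (p v) y q₂) (sym (==⇒≡ (p w) y r₂))) (trans (exact v q₁) (sym (exact w r₁)))))

  order≤2^time : ∀ {b} → (∀ v → f v ≤ b) → n ≤ 2 ^ b
  order≤2^time {b} bounded = ≤-trans (≤-reflexive (sym (count-true n)))
    (≤-trans (count-mono {P = λ _ → true} (λ v _ → ≤⇒≤ᴮ (bounded v))) (count-informed b))

-- From parents and times to a spanning tree with a coloring

positive : ℕ → Bool
positive zero = false
positive (suc _) = true

if-positive : ∀ k → (if positive k then k else 0) ≡ k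
if-positive zero = refl
if-positive (suc k) = refl

0<⇒positive : ∀ {k} → 0 < k → T (positive k)
0<⇒positive (s≤s _) = tt

module FromBroadcast {N} (G : Graph (suc N)) {s p f} (B : Broadcast (adj G) s p f) where
  open Algorithm {N}
  open Broadcast B

  private
    M : V → V → ℕ
    M = matrix (p , f)

  Up : V → V → Set
  Up u v = p u ≡ v × u ≢ s

  Up-functional : ∀ {a b c} → Up a b → Up a c → b ≡ c
  Up-functional (p₁ , _) (p₂ , _) = trans (sym p₁) p₂

  Up-< : ∀ {a b} → Up a b → f b < f a
  Up-< (refl , q) = later _ q

  -- The first test of `matrix` fails here: otherwise u and v would be parents of each other,
  -- against the decrease of times, or u would be the root.
  M-up : ∀ {u v} → Up u v → M u v ≡ f u
  M-up {u} {v} up@(e , u≢s) = trans (if-F other) (if-T (≡⇒== e))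
    where
    other : ¬ T (p v == u)
    other q with v ≟ s
    ... | yes refl = u≢s (trans (sym (==⇒≡ (p v) u q)) root)
    ... | no v≢s = <-asym (Up-< up) (Up-< {v} {u} (==⇒≡ (p v) u q , v≢s))

  M-down : ∀ {u v} → Up u v → M v u ≡ f u
  M-down (e , _) = if-T (≡⇒== e)

  data EdgeView (u v : V) : Set where
    up   : Up u v → EdgeView u v
    down : Up v u → EdgeView u v
    none : M u v ≡ 0 → M v u ≡ 0 → EdgeView u v

  edgeView : ∀ u v → EdgeView u v
  edgeView u v with u ≟ s | v ≟ s | T? (p v == u) | T? (p u == v)
  ... | no u≢s | _ | _ | yes q = up (==⇒≡ (p u) v q , u≢s)
  ... | _ | no v≢s | yes q | _ = down (==⇒≡ (p v) u q , v≢s)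
  -- The root is its own parent, but its time 0 stands for a missing edge.
  ... | yes refl | yes refl | _ | _ = none loop loop
    where
    loop : M s s ≡ 0
    loop = trans (if-T (≡⇒== root)) rootTime
  ... | _ | _ | no q | no q′ = none (trans (if-F q) (if-F q′)) (trans (if-F q′) (if-F q))
  ... | yes refl | no v≢s | no q | yes q′ = none (trans (if-F q) (trans (if-T q′) rootTime)) (trans (if-T q′) rootTime)
  ... | no u≢s | yes refl | yes q | no q′ = none (trans (if-T q) rootTime) (trans (if-F q′) (trans (if-T q) rootTime))

  M-sym : ∀ u v → M u v ≡ M v u
  M-sym u v with edgeView u v
  ... | up e = trans (M-up e) (sym (M-down e))
  ... | down e = trans (M-down e) (sym (M-up e))
  ... | none e e′ = trans e (sym e′)

  tree : Graph (suc N)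
  tree = record
    { adj = λ u v → positive (M u v)
    ; symmetric = λ u v → cong positive (M-sym u v)
    ; loopless = λ v → loopless′ v (edgeView v v) }
    where
    loopless′ : ∀ v → EdgeView v v → positive (M v v) ≡ false
    loopless′ v (up e) = ⊥-elim (<-irrefl refl (Up-< e))
    loopless′ v (down e) = ⊥-elim (<-irrefl refl (Up-< e))
    loopless′ v (none e _) = cong positive e

  E : V → V → Set
  E = Adj tree

  E-elim : ∀ {u v} → E u v → Up u v ⊎ Up v u
  E-elim {u} {v} e with edgeView u v
  ... | up q = inj₁ q
  ... | down q = inj₂ q
  ... | none q _ = ⊥-elim (subst (T ∘ positive) q e)

  0<f : ∀ {v} → v ≢ s → 0 < f v
  0<f v≢s = ≤-<-trans z≤n (later _ v≢s)

  E-up : ∀ {u v} → Up u v → E u v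
  E-up e = 0<⇒positive (subst (0 <_) (sym (M-up e)) (0<f (proj₂ e)))

  E-down : ∀ {u v} → Up v u → E u v
  E-down e = 0<⇒positive (subst (0 <_) (sym (M-down e)) (0<f (proj₂ e)))

  rootWalks : ∀ k v → f v ≤ k → Star E s v × Star E v s
  rootWalks k v le with v ≟ s
  ... | yes refl = ε , ε
  rootWalks zero v le | no v≢s = ⊥-elim (n≮0 (≤-trans (0<f v≢s) le))
  rootWalks (suc k) v le | no v≢s =
    let from , to = rootWalks k (p v) (≤-pred (≤-trans (later v v≢s) le))
    in from ◅◅ E-down (refl , v≢s) ◅ ε , E-up (refl , v≢s) ◅ to

  connected : Connected tree
  connected u v = proj₂ (rootWalks (f u) u ≤-refl) ◅◅ proj₁ (rootWalks (f v) v ≤-refl)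

  -- Walks that never step straight back. Paths are of this kind, and so is a cycle of length at
  -- least three written as a closed walk, although its end vertex is repeated.
  data Straight : List V → Set where
    empty : Straight []
    one   : ∀ {a} → Straight (a ∷ [])
    two   : ∀ {a b} → Straight (a ∷ b ∷ [])
    turn  : ∀ {a b c xs} → a ≢ c → Straight (b ∷ c ∷ xs) → Straight (a ∷ b ∷ c ∷ xs)

  data LastStep (y z : V) : List V → Set where
    end  : LastStep y z (y ∷ z ∷ [])
    more : ∀ {a b c xs} → LastStep y z (b ∷ c ∷ xs) → LastStep y z (a ∷ b ∷ c ∷ xs)

  -- A walk that does not turn back never approaches the root again after a
  -- step away from it.
  away : ∀ {a b xs y z} → Linked E (a ∷ b ∷ xs) → Straight (a ∷ b ∷ xs) → Up b a →
         LastStep y z (a ∷ b ∷ xs) → f a < f z × Up z y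
  away _ _ e end = Up-< e , e
  away (_ ∷ l@(e′ ∷ _)) (turn a≢c st) e (more last) with E-elim e′
  ... | inj₁ q = ⊥-elim (a≢c (Up-functional e q))
  ... | inj₂ q = let lt , q′ = away l st q last in <-trans (Up-< e) lt , q′

  -- A straight walk climbs towards the root for a while and descends from then on, so it either
  -- climbs all the way or ends with a descent.
  lastStep : ∀ {a b xs y z} → Linked E (a ∷ b ∷ xs) → Straight (a ∷ b ∷ xs) →
             LastStep y z (a ∷ b ∷ xs) → f z < f a ⊎ Up z y
  lastStep l@(e ∷ l′) st last with E-elim e
  ... | inj₂ q = inj₂ (proj₂ (away l st q last))
  lastStep (e ∷ [-]) st end | inj₁ q = inj₁ (Up-< q)
  lastStep (e ∷ l′) (turn _ st) (more last) | inj₁ q =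
    [ (λ lt → inj₁ (<-trans lt (Up-< q))) , inj₂ ]′ (lastStep l′ st last)

  straight : ∀ {xs} → Unique xs → Straight xs
  straight [] = empty
  straight (_ ∷ []) = one
  straight (_ ∷ (_ ∷ [])) = two
  straight ((_ ∷ (a≢c ∷ _)) ∷ u@(_ ∷ (_ ∷ _))) = turn a≢c (straight u)

  straight-∷ʳ : ∀ {xs z} → Unique xs → All (_≢ z) xs → Straight (xs ∷ʳ z)
  straight-∷ʳ [] _ = one
  straight-∷ʳ (_ ∷ []) _ = two
  straight-∷ʳ (_ ∷ u@(_ ∷ [])) (a≢z ∷ n@(_ ∷ [])) = turn a≢z (straight-∷ʳ u n)
  straight-∷ʳ ((_ ∷ (a≢c ∷ _)) ∷ u@(_ ∷ (_ ∷ _))) (_ ∷ n) = turn a≢c (straight-∷ʳ u n)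

  lastStep-∷ʳ : ∀ b xs z → ∃[ y ] y Mem.∈ (b ∷ xs) × LastStep y z (b ∷ xs ∷ʳ z)
  lastStep-∷ʳ b [] z = b , here refl , end
  lastStep-∷ʳ b (c ∷ xs) z with lastStep-∷ʳ c xs z
  lastStep-∷ʳ b (c ∷ []) z | y , m , l = y , there m , more l
  lastStep-∷ʳ b (c ∷ _ ∷ _) z | y , m , l = y , there m , more l

  lastStep-last : ∀ a b xs {z} → last (a ∷ b ∷ xs) ≡ just z → ∃[ y ] LastStep y z (a ∷ b ∷ xs)
  lastStep-last a b [] refl = a , end
  lastStep-last a b (c ∷ xs) e = let y , l = lastStep-last b c xs e in y , more l

  -- A cycle that leaves u downwards would end at a later time than it began. One that leaves u
  -- upwards must return by a descent into u, hence from the parent of u, which it has already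
  -- visited as its second vertex.
  acyclic : Acyclic tree
  acyclic u (x ∷ []) (s≤s ()) _ _
  acyclic u (x ∷ y ∷ xs) _ ((u≢x ∷ u≢y ∷ u≢xs) ∷ uniq@(x≢ ∷ _)) l@(e ∷ _) = contra (E-elim e)
    where
    st : Straight (u ∷ x ∷ y ∷ xs ∷ʳ u)
    st = turn u≢y (straight-∷ʳ uniq (All.map (λ q r → q (sym r)) (u≢x ∷ u≢y ∷ u≢xs)))
    final : ∃[ z ] z Mem.∈ (y ∷ xs) × LastStep z u (y ∷ xs ∷ʳ u)
    final = lastStep-∷ʳ y xs u
    z = proj₁ final
    final′ : LastStep z u (u ∷ x ∷ y ∷ xs ∷ʳ u)
    final′ = more (prepend (proj₂ (proj₂ final)))
      where
      prepend : ∀ {b ys} → LastStep z u (b ∷ ys) → LastStep z u (x ∷ b ∷ ys)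
      prepend end = more end
      prepend (more q) = more (more q)
    contra : Up u x ⊎ Up x u → ⊥
    contra (inj₂ q) = <-irrefl refl (proj₁ (away l st q final′))
    contra (inj₁ q) with lastStep l st final′
    ... | inj₁ lt = <-irrefl refl lt
    ... | inj₂ q′ = All.lookup x≢ (proj₁ (proj₂ final)) (Up-functional q q′)

  -- A path that starts away from the root keeps moving away, so it cannot end at s, whose time is
  -- 0.
  parent-up : ∀ {v u} → v ≢ s → IsParent tree s v u → Up v u
  parent-up {v} {u} v≢s (xs , l@(e ∷ _) , uniq , lst) with E-elim e
  ... | inj₁ q = q
  ... | inj₂ q = ⊥-elim (n≮0 (subst (f v <_) rootTime
                  (proj₁ (away l (straight uniq) q (proj₂ (lastStep-last v u xs lst))))))

  protocol : ∀ {t} → (∀ v → f v ≤ t) → Protocol G s t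
  protocol {t} bounded = record
    { tree = tree ; isTree = connected , acyclic
    ; subgraph = λ u v e → [ (λ { (refl , q) → subst T (Graph.symmetric G (p u) u) (edge u q) })
                           , (λ { (refl , q) → edge v q }) ]′ (E-elim e)
    ; τ = M ; τ-sym = λ u v _ → M-sym u v ; τ-range = range ; proper = proper′ ; parent-min = minimal }
    where
    range : ∀ u v → E u v → 1 ≤ M u v × M u v ≤ t
    range u v e with E-elim e
    ... | inj₁ q = subst (λ k → 1 ≤ k × k ≤ t) (sym (M-up q)) (0<f (proj₂ q) , bounded u)
    ... | inj₂ q = subst (λ k → 1 ≤ k × k ≤ t) (sym (M-down q)) (0<f (proj₂ q) , bounded v)
    proper′ : ∀ u v w → E v u → E v w → u ≢ w → M v u ≢ M v w
    proper′ u v w e e′ u≢w with E-elim e | E-elim e′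
    ... | inj₁ q | inj₁ q′ = λ _ → u≢w (Up-functional q q′)
    ... | inj₁ q | inj₂ q′ = λ k → <⇒≢ (Up-< q′) (trans (sym (M-up q)) (trans k (M-down q′)))
    ... | inj₂ q | inj₁ q′ = λ k → <⇒≢ (Up-< q) (trans (sym (M-up q′)) (trans (sym k) (M-down q)))
    ... | inj₂ q | inj₂ q′ = λ k → distinct u w (proj₂ q) (proj₂ q′) u≢w (trans (proj₁ q) (sym (proj₁ q′)))
                                     (trans (sym (M-down q)) (trans k (M-down q′)))
    minimal : ∀ v u w → v ≢ s → IsParent tree s v u → E v w → M v u ≤ M v w
    minimal v u w v≢s ip e with parent-up v≢s ip | E-elim e
    ... | q | inj₁ q′ = ≤-reflexive (cong (M v) (Up-functional q q′))
    ... | q | inj₂ q′ = subst₂ _≤_ (sym (M-up q)) (sym (M-down q′)) (<⇒≤ (Up-< q′))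

  encode-protocol : ∀ {t} (bounded : ∀ v → f v ≤ t) →
                    enc (arr (arr num)) M ≡ encodeProtocol (protocol bounded)
  encode-protocol bounded = cong encodeList (tabulate-cong (λ u →
    cong encodeList (tabulate-cong (λ v → cong encodeℕ (sym (if-positive (M u v)))))))

-- Invariants of sending with clocks

module Sending {N} (a : Fin (suc N) → Fin (suc N) → Bool) (s : Fin (suc N)) where
  open Algorithm {N}

  -- `called` and `awake` keep the clock of a vertex at or above its arrival and all its calls, so
  -- its next call is later than these. `busy` bounds clocks by the number of informed vertices,
  -- which in the end shows that the spreading loop has run long enough.
  record Inv (st : State) : Set where
    field
      source   : T (inf st s)
      root     : par st s ≡ s
      rootTime : birth st s ≡ 0
      informer : ∀ v → T (inf st v) → v ≢ s → T (inf st (par st v))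
      edge     : ∀ v → T (inf st v) → v ≢ s → T (a (par st v) v)
      later    : ∀ v → T (inf st v) → v ≢ s → birth st (par st v) < birth st v
      called   : ∀ v → T (inf st v) → v ≢ s → birth st v ≤ clk st (par st v)
      awake    : ∀ v → T (inf st v) → birth st v ≤ clk st v
      distinct : ∀ v w → T (inf st v) → T (inf st w) → v ≢ s → w ≢ s → v ≢ w →
                 par st v ≡ par st w → birth st v ≢ birth st w
      busy     : ∀ v → clk st v < count (inf st)

  Ready : V → V → State → Set
  Ready u v st = T (inf st u) × ¬ T (inf st v) × T (a u v)

  module _ {u v : V} {st : State} where

    extend-new : extend u v st v ≡ (true , u , suc (clk st u) , suc (clk st u))
    extend-new = if-T (==-refl v)

    extend-caller : u ≢ v → extend u v st u ≡ (inf st u , par st u , birth st u , suc (clk st u))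
    extend-caller q = trans (if-F (λ e → q (==⇒≡ u v e))) (if-T (==-refl u))

    extend-other : ∀ {w} → w ≢ u → w ≢ v → extend u v st w ≡ st w
    extend-other {w} q r = trans (if-F (λ e → r (==⇒≡ w v e))) (if-F (λ e → q (==⇒≡ w u e)))

    module _ {w : V} (w≢v : w ≢ v) where

      inf-extend : inf (extend u v st) w ≡ inf st w
      inf-extend with w ≟ u
      ... | yes refl = cong proj₁ (extend-caller w≢v)
      ... | no w≢u = cong proj₁ (extend-other w≢u w≢v)

      par-extend : par (extend u v st) w ≡ par st w
      par-extend with w ≟ u
      ... | yes refl = cong (proj₁ ∘ proj₂) (extend-caller w≢v)
      ... | no w≢u = cong (proj₁ ∘ proj₂) (extend-other w≢u w≢v)

      birth-extend : birth (extend u v st) w ≡ birth st w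
      birth-extend with w ≟ u
      ... | yes refl = cong (proj₁ ∘ proj₂ ∘ proj₂) (extend-caller w≢v)
      ... | no w≢u = cong (proj₁ ∘ proj₂ ∘ proj₂) (extend-other w≢u w≢v)

      clk-extend≥ : clk st w ≤ clk (extend u v st) w
      clk-extend≥ with w ≟ u
      ... | yes refl = ≤-trans (n≤1+n _) (≤-reflexive (sym (cong (proj₂ ∘ proj₂ ∘ proj₂) (extend-caller w≢v))))
      ... | no w≢u = ≤-reflexive (sym (cong (proj₂ ∘ proj₂ ∘ proj₂) (extend-other w≢u w≢v)))

    clk-new : clk (extend u v st) v ≡ suc (clk st u)
    clk-new = cong (proj₂ ∘ proj₂ ∘ proj₂) extend-new

    clk-caller : u ≢ v → clk (extend u v st) u ≡ suc (clk st u)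
    clk-caller q = cong (proj₂ ∘ proj₂ ∘ proj₂) (extend-caller q)

    clk-other : ∀ {w} → w ≢ u → w ≢ v → clk (extend u v st) w ≡ clk st w
    clk-other q r = cong (proj₂ ∘ proj₂ ∘ proj₂) (extend-other q r)

    inf-new : T (inf (extend u v st) v)
    inf-new = subst T (sym (cong proj₁ extend-new)) tt

    inf-old : ∀ {w} → T (inf st w) → T (inf (extend u v st) w)
    inf-old {w} q with w ≟ v
    ... | yes refl = inf-new
    ... | no w≢v = subst T (sym (inf-extend w≢v)) q

    inf-back : ∀ {w} → w ≢ v → T (inf (extend u v st) w) → T (inf st w)
    inf-back w≢v = subst T (inf-extend w≢v)

    clk-extend≤ : ∀ {k} → (∀ w → clk st w ≤ k) → ∀ w → clk (extend u v st) w ≤ suc k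
    clk-extend≤ le w with w ≟ v | w ≟ u
    ... | yes refl | _ = ≤-trans (≤-reflexive clk-new) (s≤s (le u))
    ... | no w≢v | yes refl = ≤-trans (≤-reflexive (clk-caller w≢v)) (s≤s (le u))
    ... | no w≢v | no w≢u = ≤-trans (≤-reflexive (clk-other w≢u w≢v)) (m≤n⇒m≤1+n (le w))

    send-elim : (P : State → Set) → (Ready u v st → P (extend u v st)) → (¬ Ready u v st → P st) →
                P (send a u v st)
    send-elim P yes′ no′ with T? (inf st u & not (inf st v) & a u v)
    ... | yes q = subst P (sym (if-T q)) (yes′ (let q₁ , q₂ = &-elim q; q₃ , q₄ = &-elim q₂ in q₁ , not-elim q₃ , q₄))
    ... | no q = subst P (sym (if-F q)) (no′ (λ (r₁ , r₂ , r₃) → q (&-intro r₁ (&-intro (not-intro r₂) r₃))))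

    inf-send : ∀ {w} → T (inf st w) → T (inf (send a u v st) w)
    inf-send {w} q = send-elim (λ st′ → T (inf st′ w)) (λ _ → inf-old q) (λ _ → q)

    clk-send : ∀ {k} → (∀ w → clk st w ≤ k) → ∀ w → clk (send a u v st) w ≤ suc k
    clk-send {k} le = send-elim (λ st′ → ∀ w → clk st′ w ≤ suc k) (λ _ → clk-extend≤ le) (λ _ w → m≤n⇒m≤1+n (le w))

    send-informs : T (inf st u) → T (a u v) → T (inf (send a u v st) v)
    send-informs q r = send-elim (λ st′ → T (inf st′ v)) (λ _ → inf-new)
      (λ ¬ready → decidable-stable (T? (inf st v)) (λ ¬q → ¬ready (q , ¬q , r)))

    module _ (I : Inv st) (R : Ready u v st) where
      open Inv I

      private
        st′ = extend u v st

        caller≢ : u ≢ v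
        caller≢ refl = proj₁ (proj₂ R) (proj₁ R)

        s≢v : s ≢ v
        s≢v refl = proj₁ (proj₂ R) source

        par′ : par st′ v ≡ u
        par′ = cong (proj₁ ∘ proj₂) extend-new

        birth′ : birth st′ v ≡ suc (clk st u)
        birth′ = cong (proj₁ ∘ proj₂ ∘ proj₂) extend-new

        par≢ : ∀ {w} → T (inf st w) → w ≢ s → par st w ≢ v
        par≢ {w} q w≢s e = proj₁ (proj₂ R) (subst (T ∘ inf st) e (informer w q w≢s))

        grow : count (inf st) < count (inf st′)
        grow = count-< {P = inf st} {Q = inf st′} v inf-new (proj₁ (proj₂ R)) (λ _ → inf-old)

        fresh : ∀ w → T (inf st w) → w ≢ v → w ≢ s → par st w ≡ u → birth st w < birth st′ v
        fresh w q w≢v w≢s e = subst (birth st w <_) (sym birth′)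
          (s≤s (subst (λ z → birth st w ≤ clk st z) e (called w q w≢s)))

      extend-inv : Inv st′
      extend-inv .Inv.source = inf-old source
      extend-inv .Inv.root = trans (par-extend s≢v) root
      extend-inv .Inv.rootTime = trans (birth-extend s≢v) rootTime
      extend-inv .Inv.informer w q w≢s with w ≟ v
      ... | yes refl = subst (T ∘ inf st′) (sym par′) (inf-old (proj₁ R))
      ... | no w≢v = subst (T ∘ inf st′) (sym (par-extend w≢v)) (inf-old (informer w (inf-back w≢v q) w≢s))
      extend-inv .Inv.edge w q w≢s with w ≟ v
      ... | yes refl = subst (λ z → T (a z v)) (sym par′) (proj₂ (proj₂ R))
      ... | no w≢v = subst (λ z → T (a z w)) (sym (par-extend w≢v)) (edge w (inf-back w≢v q) w≢s)
      extend-inv .Inv.later w q w≢s with w ≟ v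
      ... | yes refl = subst₂ _<_ (sym (trans (cong (birth st′) par′) (birth-extend caller≢))) (sym birth′)
                         (s≤s (awake u (proj₁ R)))
      ... | no w≢v = let q′ = inf-back w≢v q in
        subst₂ _<_ (sym (trans (cong (birth st′) (par-extend w≢v)) (birth-extend (par≢ q′ w≢s))))
          (sym (birth-extend w≢v)) (later w q′ w≢s)
      extend-inv .Inv.called w q w≢s with w ≟ v
      ... | yes refl = ≤-reflexive (trans birth′ (sym (trans (cong (clk st′) par′) (clk-caller caller≢))))
      ... | no w≢v = let q′ = inf-back w≢v q in
        subst₂ _≤_ (sym (birth-extend w≢v)) (cong (clk st′) (sym (par-extend w≢v)))
          (≤-trans (called w q′ w≢s) (clk-extend≥ (par≢ q′ w≢s)))
      extend-inv .Inv.awake w q with w ≟ v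
      ... | yes refl = ≤-reflexive (trans birth′ (sym clk-new))
      ... | no w≢v = subst (_≤ clk st′ w) (sym (birth-extend w≢v)) (≤-trans (awake w (inf-back w≢v q)) (clk-extend≥ w≢v))
      extend-inv .Inv.distinct x y q r x≢s y≢s x≢y e with x ≟ v | y ≟ v
      ... | yes refl | yes refl = ⊥-elim (x≢y refl)
      ... | yes refl | no y≢v = λ k → <⇒≢ (fresh y (inf-back y≢v r) y≢v y≢s
              (trans (sym (par-extend y≢v)) (trans (sym e) par′))) (trans (sym (birth-extend y≢v)) (sym k))
      ... | no x≢v | yes refl = λ k → <⇒≢ (fresh x (inf-back x≢v q) x≢v x≢s
              (trans (sym (par-extend x≢v)) (trans e par′))) (trans (sym (birth-extend x≢v)) k)
      ... | no x≢v | no y≢v = λ k → distinct x y (inf-back x≢v q) (inf-back y≢v r) x≢s y≢s x≢y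
              (trans (sym (par-extend x≢v)) (trans e (par-extend y≢v)))
              (trans (sym (birth-extend x≢v)) (trans k (birth-extend y≢v)))
      -- A call raises clocks by at most one, and it raises the number of informed vertices too.
      extend-inv .Inv.busy w = <-≤-trans (s≤s (clk-extend≤ {k = count (inf st) ∸ 1} (λ w → <⇒≤pred′ (busy w)) w))
                                (subst (λ z → suc z ≤ count (inf st′)) (sym (suc-pred′ (busy w))) grow)
        where
        <⇒≤pred′ : ∀ {m n} → m < n → m ≤ n ∸ 1
        <⇒≤pred′ (s≤s q) = q
        suc-pred′ : ∀ {m n} → m < n → suc (n ∸ 1) ≡ n
        suc-pred′ (s≤s q) = refl

    send-inv : Inv st → Inv (send a u v st)
    send-inv I = send-elim Inv (extend-inv I) (λ _ → I)

  initial-inv : Inv (initial s)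
  initial-inv = record
    { source = ==-refl s ; root = refl ; rootTime = refl
    ; informer = other ; edge = other ; later = other ; called = other
    ; awake = λ _ _ → ≤-refl ; distinct = λ v w q _ v≢s → ⊥-elim (v≢s (==⇒≡ v s q))
    ; busy = λ v → subst (0 <_) (sym (count-single s)) ≤-refl }
    where
    other : ∀ {P : V → Set} v → T (v == s) → v ≢ s → P v
    other v q v≢s = ⊥-elim (v≢s (==⇒≡ v s q))

  inv⇒broadcast : ∀ {st} → Inv st → (∀ v → T (inf st v)) → Broadcast a s (par st) (birth st)
  inv⇒broadcast I all = record
    { root = root ; rootTime = rootTime ; edge = λ v → edge v (all v) ; later = λ v → later v (all v)
    ; distinct = λ v w → distinct v w (all v) (all w) }
    where open Inv I

-- The modulator: a maximal packing of induced P₃s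

module _ {N} (a : Fin (suc N) → Fin (suc N) → Bool) where
  open Algorithm {N}

  Hits : (V → Bool) → Set
  Hits D = ∀ u v w → ¬ T (D u) → ¬ T (D v) → ¬ T (D w) → T (a u v) → T (a v w) → u ≢ w → T (a u w)

  module _ (u v w : V) (S : V → Bool) where

    IsP₃ : Set
    IsP₃ = ¬ T (S u) × ¬ T (S v) × ¬ T (S w) × T (a u v) × T (a v w) × u ≢ w × ¬ T (a u w)

    isP₃-elim : T (isP₃ a u v w S) → IsP₃
    isP₃-elim t₁ =
      let x₁ , t₂ = &-elim t₁; x₂ , t₃ = &-elim t₂; x₃ , t₄ = &-elim t₃; x₄ , t₅ = &-elim t₄
          x₅ , t₆ = &-elim t₅; x₆ , x₇ = &-elim t₆
      in not-elim x₁ , not-elim x₂ , not-elim x₃ , x₄ , x₅ , (λ e → not-elim x₆ (≡⇒== e)) , not-elim x₇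

    isP₃-intro : IsP₃ → T (isP₃ a u v w S)
    isP₃-intro (x₁ , x₂ , x₃ , x₄ , x₅ , x₆ , x₇) =
      &-intro (not-intro x₁) (&-intro (not-intro x₂) (&-intro (not-intro x₃) (&-intro x₄ (&-intro x₅
        (&-intro (not-intro (λ e → x₆ (==⇒≡ u w e))) (not-intro x₇))))))

    triple : V → Bool
    triple z = z == u or (z == v or z == w)

    addP₃-elim : (P : (V → Bool) → Set) → (IsP₃ → P (λ z → S z or triple z)) → (¬ IsP₃ → P S) → P (addP₃ a u v w S)
    addP₃-elim P yes′ no′ with T? (isP₃ a u v w S)
    ... | yes q = subst P (sym (if-T q)) (yes′ (isP₃-elim q))
    ... | no q = subst P (sym (if-F q)) (no′ (q ∘ isP₃-intro))

    addP₃-mono : ∀ {z} → T (S z) → T (addP₃ a u v w S z)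
    addP₃-mono {z} q = addP₃-elim (λ S′ → T (S′ z)) (λ _ → or-introˡ q) (λ _ → q)

  module _ {u v w : V} where

    private
      Done : (V → Bool) → Set
      Done S = ¬ IsP₃ u v w S

      keep : ∀ x y z S → Done S → Done (addP₃ a x y z S)
      keep x y z S d (x₁ , x₂ , x₃ , x₄) =
        d (x₁ ∘ addP₃-mono x y z S , x₂ ∘ addP₃-mono x y z S , x₃ ∘ addP₃-mono x y z S , x₄)

      hit : ∀ S → Done (addP₃ a u v w S)
      hit S = addP₃-elim u v w S Done
        (λ _ p → proj₁ p (or-introʳ {a = S u} (or-introˡ (==-refl u)))) (λ ¬p p → ¬p p)

    -- A single sweep suffices: right after its own turn a triple is no induced P₃ outside S, and S
    -- only grows later.
    modulator-noP₃ : Done (modulator a)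
    modulator-noP₃ = foldFin-hit u (λ _ → ⊤) Done (λ _ _ _ → tt)
      (λ _ _ → foldFin-hit v (λ _ → ⊤) Done (λ _ _ _ → tt)
        (λ _ _ → foldFin-hit w (λ _ → ⊤) Done (λ _ _ _ → tt) (λ S _ → hit S) (λ z S _ → keep u v z S) tt)
        (λ y S _ d → foldFin-inv Done (λ z S → keep u y z S) d) tt)
      (λ x S _ d → foldFin-inv Done (λ y S d → foldFin-inv Done (λ z S → keep x y z S) d) d) tt

  modulator-hits : Hits (modulator a)
  modulator-hits u v w p q r e e′ u≢w = decidable-stable (T? (a u w))
    (λ ¬e → modulator-noP₃ (p , q , r , e , e′ , u≢w , ¬e))

  -- Every induced P₃ contains a vertex of D.
  modulator-size : ∀ {D} → Hits D → count (modulator a) ≤ 3 * count D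
  modulator-size {D} hits = ≤-trans
    (foldFin-inv Small (λ u S d → foldFin-inv Small (λ v S d → foldFin-inv Small (λ w S → small u v w S) d) d)
      (≤-trans (≤-reflexive (sum-zero {f = λ _ → 0} (λ (_ : V) → refl))) z≤n))
    (*-monoʳ-≤ 3 (count-mono {P = λ z → modulator a z & D z} {Q = D} (λ z q → proj₂ (&-elim q))))
    where
    -- Measuring S against the part of D inside S makes the bound an invariant: a new triple adds at
    -- most three vertices to S and at least one to this part.
    Small : (V → Bool) → Set
    Small S = count S ≤ 3 * count (λ z → S z & D z)
    small : ∀ u v w S → Small S → Small (addP₃ a u v w S)
    small u v w S le = addP₃-elim u v w S Small grow (λ _ → le)
      where
      S′ : V → Bool
      S′ z = S z or triple u v w S z
      new : ∀ z → ¬ T (S z) → T (triple u v w S z) → T (D z) → suc (count (λ z → S z & D z)) ≤ count (λ z → S′ z & D z)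
      new z ¬q t d = count-< {P = λ z → S z & D z} {Q = λ z → S′ z & D z} z (&-intro (or-introʳ {a = S z} t) d)
        (λ q → ¬q (proj₁ (&-elim q))) (λ i q → let q₁ , q₂ = &-elim q in &-intro (or-introˡ q₁) q₂)
      found : IsP₃ u v w S → suc (count (λ z → S z & D z)) ≤ count (λ z → S′ z & D z)
      found (x₁ , x₂ , x₃ , x₄ , x₅ , x₆ , x₇) with T? (D u) | T? (D v) | T? (D w)
      ... | yes d | _ | _ = new u x₁ (or-introˡ (==-refl u)) d
      ... | _ | yes d | _ = new v x₂ (or-introʳ {a = v == u} (or-introˡ (==-refl v))) d
      ... | _ | _ | yes d = new w x₃ (or-introʳ {a = w == u} (or-introʳ {a = w == v} (==-refl w))) d
      ... | no p | no q | no r = ⊥-elim (x₇ (hits u v w p q r x₄ x₅ x₆))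
      three : count (triple u v w S) ≤ 3
      three = ≤-trans (count-union {Q = _== u} {R = λ z → z == v or z == w} (λ z → or-elim))
        (+-mono-≤ (≤-reflexive (count-single u)) (≤-trans (count-union {Q = _== v} {R = _== w} (λ z → or-elim))
          (+-mono-≤ (≤-reflexive (count-single v)) (≤-reflexive (count-single w)))))
      grow : IsP₃ u v w S → Small S′
      grow p = begin
        count S′                               ≤⟨ count-union {Q = S} {R = triple u v w S} (λ z → or-elim) ⟩
        count S + count (triple u v w S)       ≤⟨ +-mono-≤ le three ⟩
        3 * count (λ z → S z & D z) + 3        ≡⟨ eq (count (λ z → S z & D z)) ⟩
        3 * suc (count (λ z → S z & D z))      ≤⟨ *-monoʳ-≤ 3 (found p) ⟩
        3 * count (λ z → S′ z & D z)           ∎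
        where
        open ≤-Reasoning
        eq : ∀ x → 3 * x + 3 ≡ 3 * suc x
        eq = solve-∀

module _ {n} (G : Graph n) where

  deletionSet-hits : ∀ {D} → IsClusterVertexDeletionSet G D → ∀ u v w →
    ¬ T (Vec.lookup D u) → ¬ T (Vec.lookup D v) → ¬ T (Vec.lookup D w) →
    Adj G u v → Adj G v w → u ≢ w → Adj G u w
  deletionSet-hits {D} del u v w p q r e e′ =
    del u w (out p) (out r) ((out p , out q , e) ◅ (out q , out r , e′) ◅ ε)
    where
    out : ∀ {x} → ¬ T (Vec.lookup D x) → x ∉ D
    out ¬t m = ¬t (subst T (sym ([]=⇒lookup m)) tt)

count-lookup : ∀ {n} (D : Subset n) → count (Vec.lookup D) ≡ ∣ D ∣
count-lookup [] = refl
count-lookup (true ∷ D) = cong suc (count-lookup D)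
count-lookup (false ∷ D) = count-lookup D

-- Informing the modulator within 3 |S| rounds

module Clusters {N} (G : Graph (suc N)) (s : Fin (suc N)) (S : Fin (suc N) → Bool) (hits : Hits (adj G) S) where
  open Algorithm {N} public
  open Sending (adj G) s public

  a : V → V → Bool
  a = adj G

  a-sym : ∀ {u v} → T (a u v) → T (a v u)
  a-sym {u} {v} = subst T (Graph.symmetric G u v)

  near-refl : ∀ v → T (near a v v)
  near-refl v = or-introʳ {a = a v v} (==-refl v)

  near-edge : ∀ {u v} → T (a u v) → T (near a u v)
  near-edge = or-introˡ

  near-elim : ∀ {u v} → T (near a u v) → T (a u v) ⊎ u ≡ v
  near-elim {u} {v} q = [ inj₁ , (λ e → inj₂ (==⇒≡ u v e)) ]′ (or-elim q)

  near-sym : ∀ {u v} → T (near a u v) → T (near a v u)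
  near-sym q with near-elim q
  ... | inj₁ e = near-edge (a-sym e)
  ... | inj₂ refl = near-refl _

  near-trans : ∀ {u v w} → ¬ T (S u) → ¬ T (S v) → ¬ T (S w) → T (near a u v) → T (near a v w) → T (near a u w)
  near-trans {u} {v} {w} p q r e e′ with near-elim e | near-elim e′
  ... | inj₂ refl | _ = e′
  ... | inj₁ _ | inj₂ refl = e
  ... | inj₁ x | inj₁ y with u ≟ w
  ...   | yes refl = near-refl u
  ...   | no u≢w = near-edge (hits u v w p q r x y u≢w)

  send-near : ∀ {u v st} → T (inf st u) → T (near a u v) → T (inf (send a u v st) v)
  send-near q e with near-elim e
  ... | inj₁ e = send-informs q e
  ... | inj₂ refl = inf-send q

  -- As `near` includes equality, shorter walks are covered as well, with repeated vertices.
  record Walk (u c d x : V) : Set where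
    constructor walk
    field
      target : T (S x)
      first  : T (near a u c)
      second : T (near a c d)
      third  : T (near a d x)

  informedS : State → V → Bool
  informedS st z = inf st z & S z

  module _ {u c d x : V} {st : State} where

    thrice : State
    thrice = send a d x (send a c d (send a u c st))

    reachStep-elim : (P : State → Set) →
      (T (inf st u) → ¬ T (inf st x) → Walk u c d x → P thrice) →
      (¬ (T (inf st u) × ¬ T (inf st x) × Walk u c d x) → P st) → P (reachStep a S u c d x st)
    reachStep-elim P yes′ no′ with T? (inf st u & S x & not (inf st x) & near a u c & near a c d & near a d x)
    ... | yes t₁ = subst P (sym (if-T t₁)) (let
            x₁ , t₂ = &-elim t₁; x₂ , t₃ = &-elim t₂; x₃ , t₄ = &-elim t₃; x₄ , t₅ = &-elim t₄; x₅ , x₆ = &-elim t₅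
            in yes′ x₁ (not-elim x₃) (walk x₂ x₄ x₅ x₆))
    ... | no q = subst P (sym (if-F q)) (no′ (λ (x₁ , x₃ , walk x₂ x₄ x₅ x₆) →
            q (&-intro x₁ (&-intro x₂ (&-intro (not-intro x₃) (&-intro x₄ (&-intro x₅ x₆)))))))

    thrice-informs : T (inf st u) → Walk u c d x → T (inf thrice x)
    thrice-informs q (walk _ e₁ e₂ e₃) = send-near (send-near (send-near q e₁) e₂) e₃

    thrice-mono : ∀ {w} → T (inf st w) → T (inf thrice w)
    thrice-mono q = inf-send (inf-send (inf-send q))

    reachStep-mono : ∀ {w} → T (inf st w) → T (inf (reachStep a S u c d x st) w)
    reachStep-mono {w} q = reachStep-elim (λ st′ → T (inf st′ w)) (λ _ _ _ → thrice-mono q) (λ _ → q)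

    reachStep-hit : T (inf st u) → Walk u c d x → T (inf (reachStep a S u c d x st) x)
    reachStep-hit q w = reachStep-elim (λ st′ → T (inf st′ x)) (λ _ _ → thrice-informs q)
      (λ no′ → decidable-stable (T? (inf st x)) (λ ¬r → no′ (q , ¬r , w)))

  Reaching : State → Set
  Reaching st = Inv st × (∀ w → clk st w ≤ 3 * count (informedS st))

  -- Three calls raise every clock by at most three, and the newly informed vertex x of S pays for
  -- them.
  reachStep-inv : ∀ {u c d x st} → Reaching st → Reaching (reachStep a S u c d x st)
  reachStep-inv {u} {c} {d} {x} {st} (I , le) = reachStep-elim Reaching
    (λ q ¬r w → send-inv (send-inv (send-inv I)) , λ z → ≤-trans (clk-send (clk-send (clk-send le)) z) (begin
      3 + 3 * count (informedS st)               ≡⟨ eq (count (informedS st)) ⟩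
      3 * suc (count (informedS st))             ≤⟨ *-monoʳ-≤ 3 (more q ¬r w) ⟩
      3 * count (informedS (thrice {u} {c} {d} {x} {st}))    ∎))
    (λ _ → I , le)
    where
    open ≤-Reasoning
    eq : ∀ x → 3 + 3 * x ≡ 3 * suc x
    eq = solve-∀
    more : T (inf st u) → ¬ T (inf st x) → Walk u c d x →
           count (informedS st) < count (informedS (thrice {u} {c} {d} {x} {st}))
    more q ¬r w = count-< {P = informedS st} {Q = informedS thrice} x
      (&-intro (thrice-informs q w) (Walk.target w)) (λ t → ¬r (proj₁ (&-elim t)))
      (λ i t → let t₁ , t₂ = &-elim t in &-intro (thrice-mono t₁) t₂)

  reachPass-inv : (P : State → Set) → (∀ {u c d x st} → P st → P (reachStep a S u c d x st)) →
                  ∀ {st} → P st → P (reachPass a S st)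
  reachPass-inv P step p = foldFin-inv P (λ u st p → foldFin-inv P (λ c st p → foldFin-inv P (λ d st p →
    foldFin-inv P (λ x st p → step p) p) p) p) p

  reachPass-hit : ∀ {u c d x st} → T (inf st u) → Walk u c d x → T (inf (reachPass a S st) x)
  reachPass-hit {u} {c} {d} {x} q w =
    foldFin-hit u P Q
      (λ u st p → foldFin-inv P (λ c st p → foldFin-inv P (λ d st p → foldFin-inv P (λ x st → reachStep-mono) p) p) p)
      (λ st p → foldFin-hit c P Q
        (λ c st p → foldFin-inv P (λ d st p → foldFin-inv P (λ x st → reachStep-mono) p) p)
        (λ st p → foldFin-hit d P Q
          (λ d st p → foldFin-inv P (λ x st → reachStep-mono) p)
          (λ st p → foldFin-hit x P Q (λ x st → reachStep-mono) (λ st p → reachStep-hit p w)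
                      (λ x st _ → reachStep-mono) p)
          (λ d st _ q → foldFin-inv Q (λ x st → reachStep-mono) q) p)
        (λ c st _ q → foldFin-inv Q (λ d st q → foldFin-inv Q (λ x st → reachStep-mono) q) q) p)
      (λ u st _ q → foldFin-inv Q (λ c st q → foldFin-inv Q (λ d st q → foldFin-inv Q (λ x st → reachStep-mono) q) q) q) q
    where
    P Q : State → Set
    P st = T (inf st u)
    Q st = T (inf st x)

  reachPass-mono : ∀ {w st} → T (inf st w) → T (inf (reachPass a S st) w)
  reachPass-mono {w} = reachPass-inv (λ st → T (inf st w)) reachStep-mono

  -- Outside S an uninformed stretch of a walk stays in one clique, so it can be shortcut.
  module _ {st : State} where

    data Frontier (y : V) : Set where
      informed  : T (inf st y) → Frontier y
      clustered : ∀ u c → T (inf st u) → T (near a u c) → ¬ T (S c) → ¬ T (S y) → T (near a c y) → Frontier y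

    findWalk : ∀ {y x₀} → Frontier y → Star (Adj G) y x₀ → T (S x₀) → ¬ T (inf st x₀) →
               ∃[ u ] ∃[ c ] ∃[ d ] ∃[ x ] T (inf st u) × ¬ T (inf st x) × Walk u c d x
    findWalk (informed q) ε _ ¬i = ⊥-elim (¬i q)
    findWalk (clustered _ _ _ _ _ ¬S _) ε x∈S _ = ⊥-elim (¬S x∈S)
    findWalk {y} F (_◅_ {j = z} e path) x∈S ¬i with T? (inf st z) | T? (S z)
    ... | yes q | _ = findWalk (informed q) path x∈S ¬i
    findWalk {y} (informed q) (_◅_ {j = z} e path) _ _ | no ¬q | yes z∈S =
      y , y , y , z , q , ¬q , walk z∈S (near-refl y) (near-refl y) (near-edge e)
    findWalk {y} (clustered u c q e₁ c∉S y∉S e₂) (_◅_ {j = z} e path) _ _ | no ¬q | yes z∈S =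
      u , c , y , z , q , ¬q , walk z∈S e₁ e₂ (near-edge e)
    findWalk {y} (informed q) (_◅_ {j = z} e path) x∈S ¬i | no ¬q | no z∉S =
      findWalk (clustered y z q (near-edge e) z∉S z∉S (near-refl z)) path x∈S ¬i
    findWalk {y} (clustered u c q e₁ c∉S y∉S e₂) (_◅_ {j = z} e path) x∈S ¬i | no ¬q | no z∉S =
      findWalk (clustered u c q e₁ c∉S z∉S (near-trans c∉S y∉S z∉S e₂ (near-edge e))) path x∈S ¬i

  Reached : State → Set
  Reached st = ∀ x → T (S x) → T (inf st x)

  -- As long as some vertex of S is uninformed, a pass informs a new vertex. As many passes as there
  -- are vertices are therefore enough.
  reach-correct : Connected G → Reaching (reach a S (initial s)) × Reached (reach a S (initial s))
  reach-correct conn = conclude (foldFin-ind P step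
    ((initial-inv , λ _ → z≤n) , inj₂ (subst (0 <_) (sym (count-single s)) ≤-refl)))
    where
    P : ℕ → State → Set
    P k st = Reaching st × (Reached st ⊎ k < count (inf st))
    step : ∀ (i : V) st → P (toℕ i) st → P (suc (toℕ i)) (reachPass a S st)
    step i st (R , inj₁ all) = reachPass-inv Reaching reachStep-inv R , inj₁ (λ x q → reachPass-mono (all x q))
    step i st (R , inj₂ lt) with any? (λ x → T? (S x & not (inf st x)))
    ... | no none = reachPass-inv Reaching reachStep-inv R , inj₁ (λ x q → reachPass-mono
            (decidable-stable (T? (inf st x)) (λ ¬i → none (x , &-intro q (not-intro ¬i)))))
    ... | yes (x₀ , t) =
      let x∈S , ¬i = &-elim t
          u , c , d , x , q , ¬r , w = findWalk {st} (informed {st} (Inv.source (proj₁ R))) (conn s x₀) x∈S (not-elim ¬i)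
      in reachPass-inv Reaching reachStep-inv R ,
         inj₂ (<-≤-trans (s≤s lt) (count-< {P = inf st} {Q = inf (reachPass a S st)} x (reachPass-hit q w) ¬r
           (λ _ → reachPass-mono)))
    conclude : ∀ {st} → P (suc N) st → Reaching st × Reached st
    conclude (R , inj₁ all) = R , all
    conclude {st} (R , inj₂ lt) = ⊥-elim (<⇒≱ lt (count≤ (inf st)))

-- Assignments of bounded load by augmenting paths

module Assignments {N : ℕ} where
  open Algorithm {N}

  dom : Assignment → V → Bool
  dom A i = proj₁ (A i)

  assigned-elim : ∀ {A i x} → T (assigned A i x) → T (dom A i) × proj₂ (A i) ≡ x
  assigned-elim {A} {i} {x} t = let t₁ , t₂ = &-elim t in t₁ , ==⇒≡ (proj₂ (A i)) x t₂

  assigned-intro : ∀ {A i} → T (dom A i) → T (assigned A i (proj₂ (A i)))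
  assigned-intro t = &-intro t (==-refl _)

  assigned-cong : ∀ {A A′ i x} → A i ≡ A′ i → T (assigned A i x) → T (assigned A′ i x)
  assigned-cong {x = x} e = subst (λ z → T (proj₁ z & (proj₂ z == x))) e

  load-count : ∀ A x → load A x ≡ count (λ i → assigned A i x)
  load-count A x = foldFin-count (λ i → assigned A i x)

module Matching {N} (E : Fin (suc N) → Fin (suc N) → Bool) (L : Fin (suc N)) where
  open Algorithm {N}
  open Assignments {N}

  private
    Nonfull : Assignment → V → Set
    Nonfull A x = T (nonfull L A x)

    Good : Assignment → Next → V → Set
    Good A nx x = T (good L A nx x)

  module _ (A : Assignment) where

    Closed : Next → Set
    Closed nx = ∀ i y → T (dom A i) → T (E i y) → Good A nx y → Good A nx (proj₂ (A i))

    -- The rank of a server bounds the length of the path that frees it.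
    record Entry (nx : Next) (rank : V → ℕ) (x i y : V) : Set where
      constructor entry
      field
        full    : ¬ Nonfull A x
        from    : T (assigned A i x)
        allowed    : T (E i y)
        to      : Good A nx y
        descend : rank y < rank x

    record Ranked (nx : Next) : Set where
      field
        rank    : V → ℕ
        entries : ∀ x → T (proj₁ (nx x)) → Entry nx rank x (proj₁ (proj₂ (nx x))) (proj₂ (proj₂ (nx x)))
        bounded : ∀ x → Good A nx x → rank x < count (good L A nx)

    module _ {nx : Next} (i y : V) where

      private
        x = proj₂ (A i)
        nx′ : Next
        nx′ z = if z == x then (true , i , y) else nx z

      Opens : Set
      Opens = T (dom A i) × ¬ Good A nx x × T (E i y) × Good A nx y

      closeStep-elim : (P : Next → Set) → (Opens → P nx′) → (¬ Opens → P nx) → P (closeStep E L A i y nx)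
      closeStep-elim P yes′ no′ with T? (proj₁ (A i) & not (good L A nx x) & E i y & good L A nx y)
      ... | yes t₁ = subst P (sym (if-T t₁)) (let x₁ , t₂ = &-elim t₁; x₂ , t₃ = &-elim t₂; x₃ , x₄ = &-elim t₃
                       in yes′ (x₁ , not-elim x₂ , x₃ , x₄))
      ... | no q = subst P (sym (if-F q)) (no′ (λ (x₁ , x₂ , x₃ , x₄) →
                       q (&-intro x₁ (&-intro (not-intro x₂) (&-intro x₃ x₄)))))

      private
        new : nx′ x ≡ (true , i , y)
        new = if-T (==-refl x)

        keep : ∀ {z} → z ≢ x → nx′ z ≡ nx z
        keep {z} q = if-F (λ e → q (==⇒≡ z x e))

        good-new : Good A nx′ x
        good-new = or-introʳ {a = nonfull L A x} (subst (T ∘ proj₁) (sym new) tt)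

        good-mono : ∀ {z} → Good A nx z → Good A nx′ z
        good-mono {z} g with z ≟ x
        ... | yes refl = good-new
        ... | no q = subst (λ e → T (nonfull L A z or proj₁ e)) (sym (keep q)) g

        good-back : ∀ {z} → z ≢ x → Good A nx′ z → Good A nx z
        good-back {z} q = subst (λ e → T (nonfull L A z or proj₁ e)) (keep q)

      closeStep-mono : ∀ {z} → Good A nx z → Good A (closeStep E L A i y nx) z
      closeStep-mono {z} g = closeStep-elim (λ nx → Good A nx z) (λ _ → good-mono g) (λ _ → g)

      closeStep-hit : T (dom A i) → T (E i y) → Good A nx y → Good A (closeStep E L A i y nx) x
      closeStep-hit d e g = closeStep-elim (λ nx → Good A nx x) (λ _ → good-new)
        (λ no′ → decidable-stable (T? (good L A nx x)) (λ ¬g → no′ (d , ¬g , e , g)))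

      -- The newly opened server gets the rank of its successor plus one. Servers that were good
      -- keep their ranks, so older entries still descend, and ranks of good servers stay below the
      -- number of good servers.
      closeStep-ranked : Ranked nx → Ranked (closeStep E L A i y nx)
      closeStep-ranked R = closeStep-elim Ranked update (λ _ → R)
        where
        open Ranked R
        update : Opens → Ranked nx′
        update (d , ¬g , e , g) = record { rank = rank′ ; entries = entries′ ; bounded = bounded′ }
          where
          rank′ : V → ℕ
          rank′ z with z ≟ x
          ... | yes _ = suc (rank y)
          ... | no _ = rank z
          rank-new : rank′ x ≡ suc (rank y)
          rank-new with x ≟ x
          ... | yes _ = refl
          ... | no q = ⊥-elim (q refl)
          rank-old : ∀ {z} → Good A nx z → rank′ z ≡ rank z
          rank-old {z} h with z ≟ x
          ... | yes refl = ⊥-elim (¬g h)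
          ... | no _ = refl
          grow : count (good L A nx) < count (good L A nx′)
          grow = count-< {P = good L A nx} {Q = good L A nx′} x good-new ¬g (λ _ → good-mono)
          entries′ : ∀ z → T (proj₁ (nx′ z)) → Entry nx′ rank′ z (proj₁ (proj₂ (nx′ z))) (proj₂ (proj₂ (nx′ z)))
          entries′ z t with z ≟ x
          ... | yes refl = subst (λ e → Entry nx′ rank′ x (proj₁ (proj₂ e)) (proj₂ (proj₂ e))) (sym new)
                  (entry (λ h → ¬g (or-introˡ h)) (assigned-intro {A} d) e (good-mono g)
                    (subst₂ _<_ (sym (rank-old g)) (sym rank-new) ≤-refl))
          ... | no q = subst (λ e → Entry nx′ rank′ z (proj₁ (proj₂ e)) (proj₂ (proj₂ e))) (sym (keep q))
                  (let t′ = subst (T ∘ proj₁) (keep q) t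
                       entry h₁ h₂ h₃ h₄ h₅ = entries z t′
                   in entry h₁ h₂ h₃ (good-mono h₄)
                        (subst₂ _<_ (sym (rank-old h₄)) (sym (rank-old (or-introʳ {a = nonfull L A z} t′))) h₅))
          bounded′ : ∀ z → Good A nx′ z → rank′ z < count (good L A nx′)
          bounded′ z h with z ≟ x
          ... | yes refl = <-≤-trans (s≤s (bounded y g)) grow
          ... | no q = <-trans (bounded z (good-back q h)) grow

    -- A pass over a table that is not closed opens a server, and a table in which all servers are
    -- good is closed, so `suc N` passes reach a closed table.
    close-correct : Ranked (close E L A) × Closed (close E L A)
    close-correct = conclude (foldFin-ind P step (start₀ , inj₂ z≤n))
      where
      P : ℕ → Next → Set
      P k nx = Ranked nx × (Closed nx ⊎ k ≤ count (good L A nx))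
      start₀ : Ranked (λ z → false , z , z)
      start₀ = record { rank = λ _ → 0 ; entries = λ _ ()
        ; bounded = λ x g → ≤-trans (≤-reflexive (sym (count-single x)))
                      (count-mono {P = _== x} {Q = good L A (λ z → false , z , z)}
                        (λ z e → subst (Good A (λ z → false , z , z)) (sym (==⇒≡ z x e)) g)) }
      pass-inv : (Q : Next → Set) → (∀ i y nx → Q nx → Q (closeStep E L A i y nx)) → ∀ {nx} → Q nx → Q (closePass E L A nx)
      pass-inv Q s q = foldFin-inv Q (λ i nx q → foldFin-inv Q (λ y nx q → s i y nx q) q) q
      pass-ranked : ∀ {nx} → Ranked nx → Ranked (closePass E L A nx)
      pass-ranked = pass-inv Ranked (λ i y nx → closeStep-ranked i y)
      step : ∀ (k : V) nx → P (toℕ k) nx → P (suc (toℕ k)) (closePass E L A nx)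
      step k nx (R , inj₁ c) = pass-ranked R , inj₁ (subst Closed (sym same) c)
        where
        same : closePass E L A nx ≡ nx
        same = pass-inv (_≡ nx) (λ { i y _ refl → closeStep-elim i y (_≡ nx)
                 (λ (d , ¬g , e , g) → ⊥-elim (¬g (c i y d e g))) (λ _ → refl) }) refl
      step k nx (R , inj₂ le)
        with any? (λ i → any? (λ y → T? (dom A i & E i y & good L A nx y & not (good L A nx (proj₂ (A i))))))
      ... | no none = step k nx (R , inj₁ (λ i y d e g → decidable-stable (T? _)
              (λ ¬g → none (i , y , &-intro d (&-intro e (&-intro g (not-intro ¬g)))))))
      ... | yes (i , y , t₁) =
        let d , t₂ = &-elim t₁; e , t₃ = &-elim t₂; g , ¬g = &-elim t₃ in
        pass-ranked R ,
        inj₂ (≤-<-trans le (count-< {P = good L A nx} {Q = good L A (closePass E L A nx)} (proj₂ (A i))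
          (foldFin-hit i (λ nx → Good A nx y) (λ nx → Good A nx (proj₂ (A i)))
            (λ i nx q → foldFin-inv (λ nx → Good A nx y) (λ y nx → closeStep-mono i y) q)
            (λ nx q → foldFin-hit y (λ nx → Good A nx y) (λ nx → Good A nx (proj₂ (A i)))
              (λ y nx → closeStep-mono i y) (λ nx → closeStep-hit i y d e) (λ y nx _ → closeStep-mono i y) q)
            (λ i nx _ q → foldFin-inv (λ nx → Good A nx _) (λ y nx → closeStep-mono i y) q) g)
          (not-elim ¬g) (λ z → pass-inv (λ nx → Good A nx z) (λ i y nx → closeStep-mono i y))))
      conclude : ∀ {nx} → P (suc N) nx → Ranked nx × Closed nx
      conclude (R , inj₁ c) = R , c
      conclude {nx} (R , inj₂ le) = R , λ i y d e g → decidable-stable (T? _)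
        (λ ¬g → <⇒≱ (count-missing {P = good L A nx} (proj₂ (A i)) ¬g) le)

    module _ (nx : Next) (j : V) where

      Found : Bool × V → Set
      Found r = T (E j (proj₂ r)) × Good A nx (proj₂ r)

      private
        Sound : Bool × V → Set
        Sound r = T (proj₁ r) → Found r

        search : V → Bool × V → Bool × V
        search x acc = if not (proj₁ acc) & E j x & good L A nx x then (true , x) else acc

        search-elim : ∀ x acc (P : Bool × V → Set) →
                      (¬ T (proj₁ acc) → T (E j x) → Good A nx x → P (true , x)) →
                      (¬ (¬ T (proj₁ acc) × T (E j x) × Good A nx x) → P acc) → P (search x acc)
        search-elim x acc P yes′ no′ with T? (not (proj₁ acc) & E j x & good L A nx x)
        ... | yes t = subst P (sym (if-T t)) (let t₁ , t₂ = &-elim t; t₃ , t₄ = &-elim t₂ in yes′ (not-elim t₁) t₃ t₄)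
        ... | no q = subst P (sym (if-F q)) (no′ (λ (x₁ , x₂ , x₃) → q (&-intro (not-intro x₁) (&-intro x₂ x₃))))

      findServer-sound : Sound (findServer E L A nx j)
      findServer-sound = foldFin-inv Sound
        (λ x acc s → search-elim x acc Sound (λ _ e g _ → e , g) (λ _ → s)) (λ ())

      findServer-complete : ∀ {x} → T (E j x) → Good A nx x → T (proj₁ (findServer E L A nx j))
      findServer-complete {x} e g = foldFin-hit x (λ _ → ⊤) (T ∘ proj₁) (λ _ _ _ → tt)
        (λ acc _ → search-elim x acc (T ∘ proj₁) (λ _ _ _ → tt)
          (λ no′ → decidable-stable (T? (proj₁ acc)) (λ ¬t → no′ (¬t , e , g))))
        (λ y acc _ t → search-elim y acc (T ∘ proj₁) (λ _ _ _ → tt) (λ _ → t)) tt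

  module _ {A₀ : Assignment} {j₀ : V} (fresh : ¬ T (dom A₀ j₀))
           (edges₀ : ∀ i → T (dom A₀ i) → T (E i (proj₂ (A₀ i)))) where

    Dom : V → Set
    Dom i = T (dom A₀ i) ⊎ i ≡ j₀

    record Placed (A : Assignment) : Set where
      field
        sound    : ∀ i → T (dom A i) → Dom i
        complete : ∀ i → Dom i → T (dom A i)
        edges    : ∀ i → T (dom A i) → T (E i (proj₂ (A i)))
        loads    : ∀ y → load A y ≤ load A₀ y ⊎ load A y ≤ toℕ L

    module _ {nx : Next} (R : Ranked A₀ nx) where
      open Ranked R

      -- The situation after k exchanges: all jobs but j are assigned, and j is to go to x. The
      -- table was computed for A₀, but ranks fall along the path, so by `intact` the entries still
      -- to be followed describe A as well. By `short` the path ends within the loop.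
      record Pending (k : ℕ) (A : Assignment) (j x : V) : Set where
        field
          sound    : ∀ i → T (dom A i) → Dom i
          complete : ∀ i → Dom i → i ≢ j → T (dom A i)
          edges    : ∀ i → T (dom A i) → T (E i (proj₂ (A i)))
          loads    : ∀ y → load A y ≤ load A₀ y
          idle     : ¬ T (dom A j)
          member   : Dom j
          allowed     : T (E j x)
          server   : Good A₀ nx x
          intact   : ∀ z → T (proj₁ (nx z)) → rank z ≤ rank x → T (assigned A (proj₁ (proj₂ (nx z))) z)
          short    : rank x + k < suc N

      module _ {k A j x} (P : Pending k A j x) where
        open Pending P

        private
          A′ : Assignment
          A′ = place E L A j x

          atj : A′ j ≡ (true , x)
          atj = if-T (==-refl j)

          off : ∀ {i} → i ≢ j → A′ i ≡ A i
          off {i} q = if-F (λ e → q (==⇒≡ i j e))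

        -- Being good without an entry, x was not full under A₀, and no load has grown since.
        place-placed : ¬ T (proj₁ (nx x)) → Placed A′
        place-placed ¬n = record { sound = sound′ ; complete = complete′ ; edges = edges′ ; loads = loads′ }
          where
          sound′ : ∀ i → T (dom A′ i) → Dom i
          sound′ i t with i ≟ j
          ... | yes refl = member
          ... | no q = sound i (subst (T ∘ proj₁) (off q) t)
          complete′ : ∀ i → Dom i → T (dom A′ i)
          complete′ i d with i ≟ j
          ... | yes refl = subst (T ∘ proj₁) (sym atj) tt
          ... | no q = subst (T ∘ proj₁) (sym (off q)) (complete i d q)
          edges′ : ∀ i → T (dom A′ i) → T (E i (proj₂ (A′ i)))
          edges′ i t with i ≟ j
          ... | yes refl = subst (T ∘ E j ∘ proj₂) (sym atj) allowed
          ... | no q = subst (T ∘ E i ∘ proj₂) (sym (off q)) (edges i (subst (T ∘ proj₁) (off q) t))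
          loads′ : ∀ y → load A′ y ≤ load A₀ y ⊎ load A′ y ≤ toℕ L
          loads′ y with y ≟ x
          ... | yes refl = inj₂ (≤-trans (subst₂ _≤_ (sym (load-count A′ x)) (cong suc (sym (load-count A x)))
                  (count-insert {P = λ i → assigned A i x} {Q = λ i → assigned A′ i x} j added))
                (≤-trans (s≤s (loads x)) (≤ᴮ⇒≤ _ ([ id , (λ n → ⊥-elim (¬n n)) ]′ (or-elim server)))))
            where
            added : ∀ i → T (assigned A′ i x) → T (assigned A i x) ⊎ i ≡ j
            added i t with i ≟ j
            ... | yes e = inj₂ e
            ... | no q = inj₁ (assigned-cong {A′} {A} (off q) t)
          ... | no y≢x = inj₁ (≤-trans (subst₂ _≤_ (sym (load-count A′ y)) (sym (load-count A y))
                  (count-mono {P = λ i → assigned A′ i y} {Q = λ i → assigned A i y} same)) (loads y))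
            where
            same : ∀ i → T (assigned A′ i y) → T (assigned A i y)
            same i t with i ≟ j
            ... | yes refl = ⊥-elim (y≢x (trans (sym (proj₂ (assigned-elim {A′} t))) (cong proj₂ atj)))
            ... | no q = assigned-cong {A′} {A} (off q) t

        private
          j′ = proj₁ (proj₂ (nx x))
          y′ = proj₂ (proj₂ (nx x))
          A″ : Assignment
          A″ = exchange E L A j x j′

        -- The server x gains j and gives up j′, so its load does not grow, and the server proposed
        -- for j′ has smaller rank.
        exchange-pending : T (proj₁ (nx x)) → Pending (suc k) A″ j′ y′
        exchange-pending n = record
          { sound = sound′ ; complete = complete′ ; edges = edges′ ; loads = loads′
          ; idle = λ t → subst (T ∘ proj₁) atj′ t
          ; member = sound j′ (proj₁ held) ; allowed = Entry.allowed e ; server = Entry.to e ; intact = intact′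
          ; short = <-≤-trans (s≤s (≤-reflexive (+-suc (rank y′) k))) (≤-<-trans (+-monoˡ-≤ k (Entry.descend e)) short) }
          where
          e = entries x n
          heldT : T (assigned A j′ x)
          heldT = intact x n ≤-refl
          held : T (dom A j′) × proj₂ (A j′) ≡ x
          held = assigned-elim {A} heldT
          j≢j′ : j ≢ j′
          j≢j′ q = idle (subst (T ∘ dom A) (sym q) (proj₁ held))
          atj′ : A″ j′ ≡ (false , j′)
          atj′ = if-T (==-refl j′)
          atj″ : A″ j ≡ (true , x)
          atj″ = trans (if-F (λ q → j≢j′ (==⇒≡ j j′ q))) (if-T (==-refl j))
          off″ : ∀ {i} → i ≢ j′ → i ≢ j → A″ i ≡ A i
          off″ {i} q r = trans (if-F (λ t → q (==⇒≡ i j′ t))) (if-F (λ t → r (==⇒≡ i j t)))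
          sound′ : ∀ i → T (dom A″ i) → Dom i
          sound′ i t with i ≟ j′ | i ≟ j
          ... | yes refl | _ = ⊥-elim (subst (T ∘ proj₁) atj′ t)
          ... | no _ | yes refl = member
          ... | no q | no r = sound i (subst (T ∘ proj₁) (off″ q r) t)
          complete′ : ∀ i → Dom i → i ≢ j′ → T (dom A″ i)
          complete′ i d q with i ≟ j
          ... | yes refl = subst (T ∘ proj₁) (sym atj″) tt
          ... | no r = subst (T ∘ proj₁) (sym (off″ q r)) (complete i d r)
          edges′ : ∀ i → T (dom A″ i) → T (E i (proj₂ (A″ i)))
          edges′ i t with i ≟ j′ | i ≟ j
          ... | yes refl | _ = ⊥-elim (subst (T ∘ proj₁) atj′ t)
          ... | no _ | yes refl = subst (T ∘ E j ∘ proj₂) (sym atj″) allowed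
          ... | no q | no r = subst (T ∘ E i ∘ proj₂) (sym (off″ q r)) (edges i (subst (T ∘ proj₁) (off″ q r) t))
          loads′ : ∀ y → load A″ y ≤ load A₀ y
          loads′ y = ≤-trans (subst₂ _≤_ (sym (load-count A″ y)) (sym (load-count A y)) (le (y ≟ x))) (loads y)
            where
            le : Dec (y ≡ x) → count (λ i → assigned A″ i y) ≤ count (λ i → assigned A i y)
            le (no y≢x) = count-mono {P = λ i → assigned A″ i y} {Q = λ i → assigned A i y} same
              where
              same : ∀ i → T (assigned A″ i y) → T (assigned A i y)
              same i t with i ≟ j′ | i ≟ j
              ... | yes refl | _ = ⊥-elim (subst (T ∘ proj₁) atj′ (proj₁ (assigned-elim {A″} t)))
              ... | no _ | yes refl = ⊥-elim (y≢x (trans (sym (proj₂ (assigned-elim {A″} t))) (cong proj₂ atj″)))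
              ... | no q | no r = assigned-cong {A″} {A} (off″ q r) t
            le (yes refl) = ≤-trans (count-insert {P = rest} {Q = λ i → assigned A″ i x} j added)
              (count-< {P = rest} {Q = λ i → assigned A i x} j′ heldT
                (λ t → not-elim (proj₂ (&-elim t)) (==-refl j′)) (λ i t → proj₁ (&-elim t)))
              where
              rest : V → Bool
              rest i = assigned A i x & not (i == j′)
              added : ∀ i → T (assigned A″ i x) → T (rest i) ⊎ i ≡ j
              added i t with i ≟ j′ | i ≟ j
              ... | yes refl | _ = ⊥-elim (subst (T ∘ proj₁) atj′ (proj₁ (assigned-elim {A″} t)))
              ... | no _ | yes r = inj₂ r
              ... | no q | no r = inj₁ (&-intro (assigned-cong {A″} {A} (off″ q r) t)
                                     (not-intro (λ e → q (==⇒≡ i j′ e))))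
          -- The job recorded for z is neither j′, held by x, whose rank is larger, nor j, which is
          -- unassigned; so the exchange leaves it alone.
          intact′ : ∀ z → T (proj₁ (nx z)) → rank z ≤ rank y′ → T (assigned A″ (proj₁ (proj₂ (nx z))) z)
          intact′ z m le = assigned-cong {A} {A″} (sym (off″ other idle′)) was
            where
            lt : rank z < rank x
            lt = ≤-<-trans le (Entry.descend e)
            was : T (assigned A (proj₁ (proj₂ (nx z))) z)
            was = intact z m (<⇒≤ lt)
            other : proj₁ (proj₂ (nx z)) ≢ j′
            other q = <⇒≢ lt (cong rank (trans (sym (proj₂ (assigned-elim {A} was)))
              (trans (cong (λ i → proj₂ (A i)) q) (proj₂ held))))
            idle′ : proj₁ (proj₂ (nx z)) ≢ j
            idle′ q = idle (subst (T ∘ dom A) q (proj₁ (assigned-elim {A} was)))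

      FollowInv : ℕ → Assignment × Bool × V × V → Set
      FollowInv k (A , active , j , x) = (T active × Pending k A j x) ⊎ (¬ T active × Placed A)

      follow-inv : ∀ k z → FollowInv k z → FollowInv (suc k) (follow E L nx z)
      follow-inv k (A , true , j , x) (inj₁ (_ , P)) with proj₁ (nx x) in eq
      ... | true = inj₁ (tt , exchange-pending P (subst T (sym eq) tt))
      ... | false = inj₂ (id , place-placed P (subst T eq))
      follow-inv k (A , true , j , x) (inj₂ (¬t , _)) = ⊥-elim (¬t tt)
      follow-inv k (A , false , j , x) (inj₂ P) = inj₂ P

      augment-placed : ∀ {x} → T (E j₀ x) → Good A₀ nx x → Placed (augment E L nx A₀ j₀ (true , x))
      augment-placed {x} e g = conclude (foldFin-ind {m = suc N} FollowInv (λ i z → follow-inv (toℕ i) z)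
        (inj₁ (tt , record
          { sound = λ _ → inj₁ ; complete = λ i d q → [ id , (λ r → ⊥-elim (q r)) ]′ d ; edges = edges₀
          ; loads = λ _ → ≤-refl ; idle = fresh ; member = inj₂ refl ; allowed = e ; server = g
          ; intact = λ z t _ → Entry.from (entries z t)
          ; short = subst (_< suc N) (sym (+-identityʳ (rank x))) (<-≤-trans (bounded x g) (count≤ (good L A₀ nx))) })))
        where
        conclude : ∀ {z} → FollowInv (suc N) z → Placed (proj₁ z)
        conclude (inj₁ (_ , P)) = ⊥-elim (<⇒≱ (Pending.short P) (m≤n+m (suc N) _))
        conclude (inj₂ (_ , P)) = P

    record Stuck : Set where
      field
        nexts     : Next
        closed    : Closed A₀ nexts
        hopeless  : ∀ x → T (E j₀ x) → ¬ Good A₀ nexts x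

    -- If the search finds no server for j₀, the inactive loop leaves A₀ as it is, and the closed
    -- table witnesses the failure.
    insert-result : Placed (insert E L j₀ A₀) ⊎ (insert E L j₀ A₀ ≡ A₀ × Stuck)
    insert-result = go (findServer E L A₀ nx j₀) (findServer-sound A₀ nx j₀) (findServer-complete A₀ nx j₀)
      where
      nx = close E L A₀
      Result : Assignment → Set
      Result A = Placed A ⊎ (A ≡ A₀ × Stuck)
      go : ∀ r → (T (proj₁ r) → Found A₀ nx j₀ r) → (∀ {x} → T (E j₀ x) → Good A₀ nx x → T (proj₁ r)) →
           Result (augment E L nx A₀ j₀ r)
      go (true , x) sound _ = inj₁ (augment-placed (proj₁ (close-correct A₀)) (proj₁ (sound tt)) (proj₂ (sound tt)))
      go (false , x) _ complete = inj₂ (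
        foldFin-inv {m = suc N} {f = λ _ z → follow E L nx z} {x = A₀ , false , j₀ , x}
          (λ z → proj₁ z ≡ A₀ × ¬ T (proj₁ (proj₂ z))) (λ _ → unchanged) (refl , id) .proj₁ ,
        record { nexts = nx ; closed = proj₂ (close-correct A₀) ; hopeless = λ x e g → complete e g })
        where
        unchanged : ∀ z → proj₁ z ≡ A₀ × ¬ T (proj₁ (proj₂ z)) →
                    proj₁ (follow E L nx z) ≡ A₀ × ¬ T (proj₁ (proj₂ (follow E L nx z)))
        unchanged (A , true , j , x) (_ , ¬t) = ⊥-elim (¬t tt)
        unchanged (A , false , j , x) q = q

    -- Hall's condition: the servers that cannot be freed are saturated by jobs
    -- that, together with j₀, have no other servers.
    stuck-impossible : Stuck → (σ : V → V) → (∀ i → Dom i → T (E i (σ i))) →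
      (∀ x → count (λ i → (dom A₀ i or (i == j₀)) & (σ i == x)) ≤ toℕ L) → ⊥
    stuck-impossible stuck σ σ-edge σ-load = <-irrefl refl (begin-strict
      toℕ L * count bad ≤⟨ count-fibres≥ {P = served} {Q = bad} (assigned A₀) (toℕ L)
                             (λ i y z _ p q → trans (sym (proj₂ (assigned-elim {A₀} p))) (proj₂ (assigned-elim {A₀} q)))
                             (λ y b → ≤-trans (≮⇒≥ (λ lt → not-elim b (or-introˡ (≤⇒≤ᴮ lt))))
                               (subst (_≤ count (λ i → served i & assigned A₀ i y)) (sym (load-count A₀ y))
                               (count-mono {P = λ i → assigned A₀ i y} {Q = λ i → served i & assigned A₀ i y}
                                 (λ i t → let d , e = assigned-elim {A₀} t in
                                   &-intro (&-intro d (subst (T ∘ bad) (sym e) b)) t)))) ⟩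
      count served      <⟨ count-< {P = served} {Q = all} j₀ (or-introʳ {a = served j₀} (==-refl j₀))
                             (λ t → fresh (proj₁ (&-elim t))) (λ i → or-introˡ) ⟩
      count all         ≤⟨ count-fibres≤ {P = all} {Q = bad} (λ i y → σ i == y) (toℕ L)
                             (λ i t → σ i , σ-bad i (or-elim t) , ==-refl (σ i))
                             (λ y _ → ≤-trans (count-mono {P = λ i → all i & (σ i == y)}
                               {Q = λ i → (dom A₀ i or (i == j₀)) & (σ i == y)}
                               (λ i t → let t₁ , t₂ = &-elim t in &-intro (job i (or-elim t₁)) t₂)) (σ-load y)) ⟩
      toℕ L * count bad ∎)
      where
      open ≤-Reasoning
      open Stuck stuck
      bad served all : V → Bool
      bad x = not (good L A₀ nexts x)
      served i = dom A₀ i & bad (proj₂ (A₀ i))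
      all i = served i or (i == j₀)
      job : ∀ i → T (served i) ⊎ T (i == j₀) → T (dom A₀ i or (i == j₀))
      job i (inj₁ t) = or-introˡ (proj₁ (&-elim t))
      job i (inj₂ t) = or-introʳ {a = dom A₀ i} t
      σ-bad : ∀ i → T (served i) ⊎ T (i == j₀) → T (bad (σ i))
      σ-bad i (inj₁ t) = let d , b = &-elim t in
        not-intro (λ g → not-elim b (closed i (σ i) d (σ-edge i (inj₁ d)) g))
      σ-bad i (inj₂ t) = not-intro (hopeless (σ i) (subst (λ z → T (E z (σ i))) (==⇒≡ i j₀ t) (σ-edge i (inj₂ (==⇒≡ i j₀ t)))))

-- Entering the cliques and spreading inside them

module Finishing {N} (G : Graph (suc N)) (s : Fin (suc N)) (S : Fin (suc N) → Bool) (hits : Hits (adj G) S)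
                 {p : Fin (suc N) → Fin (suc N)} {f : Fin (suc N) → ℕ} (B : Broadcast (adj G) s p f)
                 {b : ℕ} (f≤b : ∀ v → f v ≤ b) (b<n : b < suc N) where
  open Clusters G s S hits
  open Assignments {N}

  private
    module B = Broadcast B
    module Match = Matching (link a S)

  touched-intro : ∀ {st c j} → ¬ T (S c) → T (near a c j) → T (inf st c) → T (touched a S st j)
  touched-intro {c = c} p q r = anyB-intro _ c (&-intro (not-intro p) (&-intro q r))

  touched-elim : ∀ {st j} → T (touched a S st j) → ∃[ c ] ¬ T (S c) × T (near a c j) × T (inf st c)
  touched-elim t = let c , t₁ = anyB-elim _ t; p , t₂ = &-elim t₁; q , r = &-elim t₂ in c , not-elim p , q , r

  touched-mono : ∀ {st st′ j} → (∀ {w} → T (inf st w) → T (inf st′ w)) → T (touched a S st j) → T (touched a S st′ j)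
  touched-mono {st} {st′} mono t = let c , p , q , r = touched-elim {st} t in touched-intro {st′} p q (mono r)

  handled-intro : ∀ {st A c j} → ¬ T (S c) → T (near a c j) → T (inf st c) ⊎ T (dom A c) → T (handled a S st A j)
  handled-intro {st} {c = c} p q r = anyB-intro _ c (&-intro (not-intro p) (&-intro q
    ([ or-introˡ , or-introʳ {a = inf st c} ]′ r)))

  handled-elim : ∀ {st A j} → T (handled a S st A j) →
                 ∃[ c ] ¬ T (S c) × T (near a c j) × (T (inf st c) ⊎ T (dom A c))
  handled-elim t = let c , t₁ = anyB-elim _ t; p , t₂ = &-elim t₁; q , r = &-elim t₂ in c , not-elim p , q , or-elim r

  link-intro : ∀ {j x c} → T (S x) → ¬ T (S c) → T (near a c j) → T (a x c) → T (link a S j x)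
  link-intro {c = c} p q r e = &-intro p (anyB-intro _ c (&-intro (not-intro q) (&-intro r e)))

  link-elim : ∀ {j x} → T (link a S j x) → T (S x) × ∃[ c ] ¬ T (S c) × T (near a c j) × T (a x c)
  link-elim t = let p , t₁ = &-elim t; c , t₂ = anyB-elim _ t₁; q , t₃ = &-elim t₂; r , e = &-elim t₃ in
    p , c , not-elim q , r , e

  -- The vertex of the clique of v whose parent in the optimal protocol is in S.
  entrance : ℕ → V → V
  entrance zero v = v
  entrance (suc k) v = if S (p v) then v else entrance k (p v)

  module Assigning {st : State} (source : T (inf st s)) where

    Untouched : V → Set
    Untouched i = ¬ T (S i) × ¬ T (touched a S st i)

    module _ {i : V} (U : Untouched i) where

      IsEntrance : V → Set
      IsEntrance v = ¬ T (S v) × T (near a v i) × v ≢ s × T (S (p v))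

      -- A parent outside S stays in the clique of i, and times decrease along parents. The climb
      -- cannot meet s inside the clique, since s is informed and the clique has no informed vertex.
      entrance-correct : ∀ k v → f v ≤ k → ¬ T (S v) → T (near a v i) → IsEntrance (entrance k v)
      entrance-correct k v le v∉S e with v ≟ s
      ... | yes refl = ⊥-elim (proj₂ U (touched-intro {st} v∉S e source))
      entrance-correct zero v le v∉S e | no v≢s = ⊥-elim (n≮0 (≤-trans (B.later v v≢s) le))
      entrance-correct (suc k) v le v∉S e | no v≢s with S (p v) in eq
      ... | true = v∉S , e , v≢s , subst T (sym eq) tt
      ... | false = entrance-correct k (p v) (≤-pred (≤-trans (B.later v v≢s) le)) p∉S
                      (near-trans p∉S v∉S (proj₁ U) (near-edge (B.edge v v≢s)) e)
        where
        p∉S : ¬ T (S (p v))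
        p∉S = subst T eq

    top σ : V → V
    top i = entrance b i
    σ i = p (top i)

    top-correct : ∀ {i} (U : Untouched i) → IsEntrance U (top i)
    top-correct {i} U = entrance-correct U b i (f≤b i) (proj₁ U) (near-refl i)

    σ-link : ∀ {i} → Untouched i → T (link a S i (σ i))
    σ-link {i} U = let q , e , v≢s , r = top-correct U in link-intro r q e (B.edge (top i) v≢s)

    -- Jobs in different cliques have different entrances. The entrances of those sent to x are
    -- children of x in the optimal protocol, so their times differ and lie between 1 and b.
    σ-load : (J : V → Bool) → (∀ i → T (J i) → Untouched i) →
             (∀ i j → T (J i) → T (J j) → T (near a i j) → i ≡ j) → ∀ x → count (λ i → J i & (σ i == x)) ≤ b
    σ-load J U apart x = ≤-trans
      (count-fibres≤ {P = P} {Q = λ _ → true} R 1 total fibre)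
      (≤-reflexive (trans (*-identityˡ _) (count-true b)))
      where
      P : V → Bool
      P i = J i & (σ i == x)
      R : V → Fin b → Bool
      R i y = (f (top i) ≤ᴮ suc (toℕ y)) & (suc (toℕ y) ≤ᴮ f (top i))
      exact : ∀ {i y} → T (R i y) → f (top i) ≡ suc (toℕ y)
      exact {i} {y} t = let t₁ , t₂ = &-elim t in ≤-antisym (≤ᴮ⇒≤ (f (top i)) t₁) (≤ᴮ⇒≤ (suc (toℕ y)) t₂)
      total : ∀ i → T (P i) → ∃[ y ] T true × T (R i y)
      total i t = y , tt , &-intro (≤⇒≤ᴮ (≤-reflexive eq)) (≤⇒≤ᴮ (≤-reflexive (sym eq)))
        where
        v≢s = proj₁ (proj₂ (proj₂ (top-correct (U i (proj₁ (&-elim t))))))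
        pos : 0 < f (top i)
        pos = ≤-<-trans z≤n (B.later (top i) v≢s)
        suc-pred′ : ∀ {m} → 0 < m → suc (m ∸ 1) ≡ m
        suc-pred′ (s≤s _) = refl
        lt : f (top i) ∸ 1 < b
        lt = subst (_≤ b) (sym (suc-pred′ pos)) (f≤b (top i))
        y : Fin b
        y = fromℕ< lt
        eq : f (top i) ≡ suc (toℕ y)
        eq = trans (sym (suc-pred′ pos)) (cong suc (sym (toℕ-fromℕ< lt)))
      fibre : ∀ y → T true → count (λ i → P i & R i y) ≤ 1
      fibre y _ = count-unique {P = λ i → P i & R i y} (λ i j t u → same i j (&-elim t) (&-elim u))
        where
        same : ∀ i j → T (P i) × T (R i y) → T (P j) × T (R j y) → i ≡ j
        same i j (t , r) (u , r′) = apart i j (proj₁ (&-elim t)) (proj₁ (&-elim u))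
          (near-trans (proj₁ Ui) (proj₁ ti) (proj₁ Uj) (near-sym (proj₁ (proj₂ ti)))
            (subst (λ v → T (near a v j)) (sym tops) (proj₁ (proj₂ tj))))
          where
          Ui = U i (proj₁ (&-elim t))
          Uj = U j (proj₁ (&-elim u))
          ti = top-correct Ui
          tj = top-correct Uj
          tops : top i ≡ top j
          tops = decidable-stable (top i ≟ top j) (λ ne →
            B.distinct (top i) (top j) (proj₁ (proj₂ (proj₂ ti))) (proj₁ (proj₂ (proj₂ tj))) ne
              (trans (==⇒≡ (σ i) x (proj₂ (&-elim t))) (sym (==⇒≡ (σ j) x (proj₂ (&-elim u)))))
              (trans (exact {i} {y} r) (sym (exact {j} {y} r′))))

    record Fair (A : Assignment) : Set where
      field
        edges     : ∀ i → T (dom A i) → T (link a S i (proj₂ (A i)))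
        untouched : ∀ i → T (dom A i) → Untouched i
        apart     : ∀ i j → T (dom A i) → T (dom A j) → T (near a i j) → i ≡ j
        loads     : ∀ x → load A x ≤ b

    Complete : Assignment → Set
    Complete A = ∀ j → ¬ T (S j) → T (handled a S st A j)

    module _ (L j : V) {A : Assignment} where

      assignStep-elim : (P : Assignment → Set) → (¬ T (S j) → ¬ T (handled a S st A j) → P (insert (link a S) L j A)) →
                        (¬ (¬ T (S j) × ¬ T (handled a S st A j)) → P A) → P (assignStep a S st L j A)
      assignStep-elim P yes′ no′ with T? (not (S j) & not (handled a S st A j))
      ... | yes t = subst P (sym (if-T t)) (let t₁ , t₂ = &-elim t in yes′ (not-elim t₁) (not-elim t₂))
      ... | no q = subst P (sym (if-F q)) (no′ (λ (x , y) → q (&-intro (not-intro x) (not-intro y))))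

      module _ (F : Fair A) (j∉S : ¬ T (S j)) (¬h : ¬ T (handled a S st A j)) where
        open Fair F

        new-untouched : Untouched j
        new-untouched = j∉S , λ t → let c , q , e , i = touched-elim {st} t in ¬h (handled-intro {st} {A} q e (inj₁ i))

        new-apart : ∀ i → T (dom A i) → ¬ T (near a i j)
        new-apart i d e = ¬h (handled-intro {st} {A} (proj₁ (untouched i d)) e (inj₂ d))

        new-fresh : ¬ T (dom A j)
        new-fresh d = new-apart j d (near-refl j)

        Dom : V → Set
        Dom i = T (dom A i) ⊎ i ≡ j

        Dom-untouched : ∀ i → Dom i → Untouched i
        Dom-untouched i (inj₁ d) = untouched i d
        Dom-untouched i (inj₂ refl) = new-untouched

        Dom-apart : ∀ i k → Dom i → Dom k → T (near a i k) → i ≡ k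
        Dom-apart i k (inj₁ d) (inj₁ d′) e = apart i k d d′ e
        Dom-apart i k (inj₁ d) (inj₂ refl) e = ⊥-elim (new-apart i d e)
        Dom-apart i k (inj₂ refl) (inj₁ d) e = ⊥-elim (new-apart k d (near-sym e))
        Dom-apart i k (inj₂ refl) (inj₂ refl) e = refl

        result : Match.Placed L new-fresh edges (insert (link a S) L j A)
                 ⊎ (insert (link a S) L j A ≡ A × Match.Stuck L new-fresh edges)
        result = Match.insert-result L new-fresh edges

        placed-fair : toℕ L ≤ b → ∀ {A′} → Match.Placed L new-fresh edges A′ → Fair A′
        placed-fair L≤b {A′} P = record
          { edges = P.edges ; untouched = λ i d → Dom-untouched i (P.sound i d)
          ; apart = λ i k d d′ → Dom-apart i k (P.sound i d) (P.sound k d′)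
          ; loads = λ x → [ (λ le → ≤-trans le (loads x)) , (λ le → ≤-trans le L≤b) ]′ (P.loads x) }
          where module P = Match.Placed L P

        -- At the limit b a stuck search would contradict the assignment σ read off the optimal
        -- protocol.
        never-stuck : toℕ L ≡ b → ¬ Match.Stuck L new-fresh edges
        never-stuck L≡b stuck = Match.stuck-impossible L new-fresh edges stuck σ
          (λ i d → σ-link (Dom-untouched i d))
          (λ x → ≤-trans (σ-load (λ i → dom A i or (i == j)) (λ i t → Dom-untouched i (dec i (or-elim t)))
            (λ i k t u → Dom-apart i k (dec i (or-elim t)) (dec k (or-elim u))) x) (≤-reflexive (sym L≡b)))
          where
          dec : ∀ i → T (dom A i) ⊎ T (i == j) → Dom i
          dec i = [ inj₁ , (λ t → inj₂ (==⇒≡ i j t)) ]′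

      assignStep-fair : toℕ L ≤ b → Fair A → Fair (assignStep a S st L j A)
      assignStep-fair L≤b F = assignStep-elim Fair
        (λ p q → [ placed-fair F p q L≤b , (λ (e , _) → subst Fair (sym e) F) ]′ (result F p q)) (λ _ → F)

      assignStep-mono : Fair A → ∀ {i} → T (handled a S st A i) → T (handled a S st (assignStep a S st L j A) i)
      assignStep-mono F {i} h = assignStep-elim (λ A′ → T (handled a S st A′ i))
        (λ p q → [ (λ P → let c , x , y , z = handled-elim {st} {A} h in
                     handled-intro {st} {insert (link a S) L j A} x y
                       ([ inj₁ , (λ d → inj₂ (Match.Placed.complete P c (inj₁ d))) ]′ z))
                 , (λ (e , _) → subst (λ A′ → T (handled a S st A′ i)) (sym e) h) ]′ (result F p q))
        (λ _ → h)

      assignStep-hit : toℕ L ≡ b → Fair A → ¬ T (S j) → T (handled a S st (assignStep a S st L j A) j)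
      assignStep-hit L≡b F j∉S = assignStep-elim (λ A′ → T (handled a S st A′ j))
        (λ p q → [ (λ P → handled-intro {st} {insert (link a S) L j A} j∉S (near-refl j)
                             (inj₂ (Match.Placed.complete P j (inj₂ refl))))
                 , (λ (_ , stuck) → ⊥-elim (never-stuck F p q L≡b stuck)) ]′ (result F p q))
        (λ no′ → decidable-stable (T? _) (λ ¬h → no′ (j∉S , ¬h)))

      assignStep-complete : Complete A → assignStep a S st L j A ≡ A
      assignStep-complete C = assignStep-elim (_≡ A) (λ p q → ⊥-elim (q (C j p))) (λ _ → refl)

    -- Loads stay below b because only limits up to b have an effect: once the limit b has been
    -- processed the assignment is complete, and a complete assignment is never touched again.
    assign-correct : Fair (assign a S st) × Complete (assign a S st)
    assign-correct = let F , C = foldFin-ind P step (fair₀ , λ ()) in F , C b<n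
      where
      P : ℕ → Assignment → Set
      P k A = Fair A × (b < k → Complete A)
      fair₀ : Fair (λ j → false , j)
      fair₀ = record { edges = λ _ () ; untouched = λ _ () ; apart = λ _ _ ()
        ; loads = λ x → ≤-trans (≤-reflexive (trans (load-count (λ j → false , j) x)
                    (sum-zero {f = λ i → [ assigned (λ j → false , j) i x ]ᴮ}
                      (λ i → if-F (λ t → proj₁ (assigned-elim {λ j → false , j} t)))))) z≤n }
      step : ∀ L A → P (toℕ L) A → P (suc (toℕ L)) (foldFin A (λ j A → assignStep a S st L j A))
      step L A (F , C) with toℕ L ≤? b
      ... | no q = subst (λ A′ → Fair A′ × (b < suc (toℕ L) → Complete A′)) (sym same) (F , λ _ → C (≰⇒> q))
        where
        same : foldFin A (λ j A → assignStep a S st L j A) ≡ A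
        same = foldFin-inv (_≡ A) (λ { j _ refl → assignStep-complete L j (C (≰⇒> q)) }) refl
      ... | yes q = foldFin-inv Fair (λ j A → assignStep-fair L j q) F ,
        λ lt j j∉S → foldFin-hit j Fair (λ A → T (handled a S st A j)) (λ j A → assignStep-fair L j q)
          (λ A F → assignStep-hit L j (≤-antisym q (≤-pred lt)) F j∉S)
          (λ k A F → assignStep-mono L k F) F

  module Serving {st : State} (I : Inv st) (reached : Reached st) {base : ℕ} (clk≤ : ∀ w → clk st w ≤ base) where
    open Assigning {st} (Inv.source I)

    module _ {A : Assignment} (F : Fair A) (C : Complete A) where

      private
        module F = Fair F

      called-by : State → V → V → Bool
      called-by st′ x j = assigned A j x & touched a S st′ j

      -- A server calls into a clique only while it is untouched, so the number of touched cliques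
      -- among those assigned to it bounds the number of its calls.
      record Served (st′ : State) : Set where
        field
          inv      : Inv st′
          mono     : ∀ {w} → T (inf st w) → T (inf st′ w)
          servers  : ∀ x → T (S x) → clk st′ x ≤ base + count (called-by st′ x)
          clients  : ∀ y → ¬ T (S y) → clk st′ y ≤ base + b

      server∈S : ∀ {j} → T (dom A j) → T (S (proj₂ (A j)))
      server∈S d = proj₁ (link-elim (F.edges _ d))

      called-by≤ : ∀ st′ x → count (called-by st′ x) ≤ b
      called-by≤ st′ x = ≤-trans (count-mono {P = called-by st′ x} {Q = λ j → assigned A j x} (λ j t → proj₁ (&-elim t)))
        (≤-trans (≤-reflexive (sym (load-count A x))) (F.loads x))

      module _ (j c : V) {st′ : State} where

        private
          x = proj₂ (A j)

        serveStep-elim : (P : State → Set) →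
          (T (dom A j) → ¬ T (S c) → T (near a c j) → ¬ T (touched a S st′ j) → P (send a x c st′)) →
          (¬ (T (dom A j) × ¬ T (S c) × T (near a c j) × ¬ T (touched a S st′ j)) → P st′) →
          P (serveStep a S A j c st′)
        serveStep-elim P yes′ no′ with T? (proj₁ (A j) & not (S c) & near a c j & not (touched a S st′ j))
        ... | yes t₁ = subst P (sym (if-T t₁)) (let x₁ , t₂ = &-elim t₁; x₂ , t₃ = &-elim t₂; x₃ , x₄ = &-elim t₃ in
                         yes′ x₁ (not-elim x₂) x₃ (not-elim x₄))
        ... | no q = subst P (sym (if-F q)) (no′ (λ (x₁ , x₂ , x₃ , x₄) →
                         q (&-intro x₁ (&-intro (not-intro x₂) (&-intro x₃ (not-intro x₄))))))

        serveStep-mono : ∀ {w} → T (inf st′ w) → T (inf (serveStep a S A j c st′) w)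
        serveStep-mono {w} q = serveStep-elim (λ st → T (inf st w)) (λ _ _ _ _ → inf-send q) (λ _ → q)

        serveStep-hit : ¬ T (S c) → T (near a c j) → T (a x c) → T (inf st′ x) → T (dom A j) →
                        T (touched a S (serveStep a S A j c st′) j)
        serveStep-hit c∉S e ex i d = serveStep-elim (λ st → T (touched a S st j))
          (λ _ _ _ _ → touched-intro {send a x c st′} c∉S e (send-informs {x} {c} {st′} i ex))
          (λ no′ → decidable-stable (T? _) (λ ¬t → no′ (d , c∉S , e , ¬t)))

        serveStep-served : Served st′ → Served (serveStep a S A j c st′)
        serveStep-served V = serveStep-elim Served (λ d q e ¬t → send-elim Served (extended d q e ¬t) (λ _ → V)) (λ _ → V)
          where
          open Served V
          extended : T (dom A j) → ¬ T (S c) → T (near a c j) → ¬ T (touched a S st′ j) → Ready x c st′ → Served (extend x c st′)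
          extended d c∉S e ¬t R = record
            { inv = extend-inv inv R ; mono = λ {w} q → inf-old {x} {c} {st′} (mono {w} q) ; servers = servers′ ; clients = clients′ }
            where
            st″ = extend x c st′
            called-mono : ∀ y k → T (called-by st′ y k) → T (called-by st″ y k)
            called-mono y k t = let t₁ , t₂ = &-elim t in &-intro t₁ (touched-mono {st′} {st″} (λ {w} → inf-old {x} {c} {st′} {w}) t₂)
            more : count (called-by st′ x) < count (called-by st″ x)
            more = count-< {P = called-by st′ x} {Q = called-by st″ x} j
              (&-intro (assigned-intro {A} d) (touched-intro {st″} c∉S e (inf-new {x} {c} {st′}))) (λ t → ¬t (proj₂ (&-elim t))) (called-mono x)
            up : suc (clk st′ x) ≤ base + count (called-by st″ x)
            up = begin
              suc (clk st′ x)                          ≤⟨ s≤s (servers x (server∈S d)) ⟩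
              suc (base + count (called-by st′ x))     ≡⟨ +-suc base _ ⟨
              base + suc (count (called-by st′ x))     ≤⟨ +-monoʳ-≤ base more ⟩
              base + count (called-by st″ x)           ∎
              where open ≤-Reasoning
            servers′ : ∀ y → T (S y) → clk st″ y ≤ base + count (called-by st″ y)
            servers′ y y∈S with y ≟ c | y ≟ x
            ... | yes refl | _ = ⊥-elim (c∉S y∈S)
            ... | no y≢c | yes refl = subst (_≤ base + count (called-by st″ x)) (sym (clk-caller {x} {c} {st′} y≢c)) up
            ... | no y≢c | no y≢x = subst (_≤ base + count (called-by st″ y)) (sym (clk-other {x} {c} {st′} y≢x y≢c))
                    (≤-trans (servers y y∈S) (+-monoʳ-≤ base
                      (count-mono {P = called-by st′ y} {Q = called-by st″ y} (called-mono y))))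
            clients′ : ∀ y → ¬ T (S y) → clk st″ y ≤ base + b
            clients′ y y∉S with y ≟ c | y ≟ x
            ... | yes refl | _ = subst (_≤ base + b) (sym (clk-new {x} {c} {st′})) (≤-trans up (+-monoʳ-≤ base (called-by≤ st″ x)))
            ... | no _ | yes refl = ⊥-elim (y∉S (server∈S d))
            ... | no y≢c | no y≢x = subst (_≤ base + b) (sym (clk-other {x} {c} {st′} y≢x y≢c)) (clients y y∉S)

      served : Served (serve a S A st)
      served = foldFin-inv Served (λ j st q → foldFin-inv Served (λ c st → serveStep-served j c) q)
        (record { inv = I ; mono = id ; servers = λ x _ → ≤-trans (clk≤ x) (m≤m+n base _)
                ; clients = λ y _ → ≤-trans (clk≤ y) (m≤m+n base _) })

      module _ (i : V) (d : T (dom A i)) where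

        private
          Mono Hit : State → Set
          Mono st′ = T (inf st′ (proj₂ (A i)))
          Hit st′ = T (touched a S st′ i)

          keep : ∀ j c st′ → Hit st′ → Hit (serveStep a S A j c st′)
          keep j c st′ = touched-mono {st′} {serveStep a S A j c st′} (λ {w} → serveStep-mono j c {st′} {w})

        serve-hit : ∀ c → ¬ T (S c) → T (near a c i) → T (a (proj₂ (A i)) c) → T (touched a S (serve a S A st) i)
        serve-hit c c∉S e ex = foldFin-hit i Mono Hit
          (λ j st′ q → foldFin-inv Mono (λ c st′ → serveStep-mono j c {st′}) q)
          (λ st′ q → foldFin-hit c Mono Hit (λ c st′ → serveStep-mono i c {st′})
            (λ st′ q → serveStep-hit i c {st′} c∉S e ex q d) (λ c st′ _ → keep i c st′) q)
          (λ j st′ _ q → foldFin-inv Hit (λ c st′ → keep j c st′) q)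
          (reached (proj₂ (A i)) (server∈S d))

      serve-touches : ∀ j → ¬ T (S j) → T (touched a S (serve a S A st) j)
      serve-touches j j∉S = touch (handled-elim {st} {A} (C j j∉S))
        where
        st′ : State
        st′ = serve a S A st
        spread-touch : ∀ {i} → ¬ T (S i) → T (near a i j) → T (touched a S st′ i) → T (touched a S st′ j)
        spread-touch i∉S e t = let k , k∉S , e′ , q = touched-elim {st′} t in
          touched-intro {st′} k∉S (near-trans k∉S i∉S j∉S e′ e) q
        touch : (∃[ c ] ¬ T (S c) × T (near a c j) × (T (inf st c) ⊎ T (dom A c))) → T (touched a S st′ j)
        touch (c , c∉S , e , inj₁ q) = touched-intro {st′} c∉S e (Served.mono served {c} q)
        touch (i , i∉S , e , inj₂ d) = let x∈S , c , c∉S , e′ , ex = link-elim {i} {proj₂ (A i)} (F.edges i d) in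
          spread-touch i∉S e (serve-hit i d c c∉S e′ ex)

  module Spreading {st : State} (I : Inv st) (reached : Reached st) {base : ℕ} (clk≤ : ∀ w → clk st w ≤ base)
                   (all-touched : ∀ j → ¬ T (S j) → T (touched a S st j)) where

    K : ℕ
    K = base + b

    -- If every call found a new vertex, u and the vertices informed through it from now on would
    -- number 2 ^ (K ∸ clk) by round K. The sum over the clique of z is thus its capacity.
    weight : V → State → V → ℕ
    weight z st′ u = if not (S u) & near a u z & inf st′ u then 2 ^ (K ∸ clk st′ u) else 0

    -- A call from u to v replaces the weight of u by two halves of it, as long
    -- as the weight of u is not yet 1.
    potential : V → State → ℕ
    potential z st′ = sum (weight z st′)

    record Spread (st′ : State) : Set where
      field
        inv   : Inv st′
        mono  : ∀ {w} → T (inf st w) → T (inf st′ w)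
        clk≤K : ∀ w → clk st′ w ≤ K
        heavy : ∀ z → ¬ T (S z) → 2 ^ b ≤ potential z st′

    start-spread : Spread st
    start-spread = record { inv = I ; mono = id ; clk≤K = λ w → ≤-trans (clk≤ w) (m≤m+n base b) ; heavy = heavy₀ }
      where
      heavy₀ : ∀ z → ¬ T (S z) → 2 ^ b ≤ potential z st
      heavy₀ z z∉S = let u , u∉S , e , i = touched-elim {st} (all-touched z z∉S) in begin
        2 ^ b                    ≤⟨ ^-monoʳ-≤ 2 (subst (_≤ K ∸ clk st u) (m+n∸m≡n base b) (∸-monoʳ-≤ K (clk≤ u))) ⟩
        2 ^ (K ∸ clk st u)       ≡⟨ if-T (&-intro (not-intro u∉S) (&-intro e i)) ⟨
        weight z st u            ≤⟨ term≤sum (weight z st) u ⟩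
        potential z st           ∎
        where open ≤-Reasoning

    Full : State → V → Set
    Full st′ u = ∀ v → ¬ T (S v) → T (a u v) → T (inf st′ v)

    -- A vertex whose neighbours outside S are all informed stops calling, and its clock may stay
    -- behind; every other informed vertex outside S has been busy up to t.
    Late : ℕ → State → V → Set
    Late t st′ u = ¬ T (S u) → T (inf st′ u) → t ≤ clk st′ u ⊎ Full st′ u

    module _ {st′ : State} {t : ℕ} {u v : V} (P : Spread st′) (late : ∀ w → Late t st′ w)
             (u∉S : ¬ T (S u)) (v∉S : ¬ T (S v)) (clk≡t : clk st′ u ≡ t) (R : Ready u v st′) where
      open Spread P

      private
        st″ = extend u v st′

        u≢v : u ≢ v
        u≢v refl = proj₁ (proj₂ R) (proj₁ R)

        late-near : ∀ w → ¬ T (S w) → T (near a w u) → T (inf st′ w) → t ≤ clk st′ w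
        late-near w w∉S e i with late w w∉S i
        ... | inj₁ le = le
        ... | inj₂ full with near-elim (near-trans w∉S u∉S v∉S e (near-edge (proj₂ (proj₂ R))))
        ...   | inj₁ wv = ⊥-elim (proj₁ (proj₂ R) (full v v∉S wv))
        ...   | inj₂ refl = ⊥-elim (proj₁ (proj₂ R) i)

      -- Every informed vertex of the clique of u still has the uninformed neighbour v, so its clock
      -- is at least t. With t at least K all weights would be at most 1, and the capacity 2 ^ b
      -- would be bounded by the number of informed vertices, which is smaller than n ≤ 2 ^ b.
      early : t < K
      early = ≰⇒> λ K≤t → <-irrefl refl (begin-strict
        2 ^ b                ≤⟨ heavy u u∉S ⟩
        potential u st′      ≤⟨ sum-mono {g = λ w → [ inf st′ w ]ᴮ} (light K≤t) ⟩
        count (inf st′)      <⟨ count-missing {P = inf st′} v (proj₁ (proj₂ R)) ⟩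
        suc N                ≤⟨ order≤2^time B f≤b ⟩
        2 ^ b                ∎)
        where
        open ≤-Reasoning
        light : K ≤ t → ∀ w → weight u st′ w ≤ [ inf st′ w ]ᴮ
        light K≤t w with T? (not (S w) & near a w u & inf st′ w)
        ... | no q = ≤-trans (≤-reflexive (if-F q)) z≤n
        ... | yes q = let q₁ , q₂ = &-elim q; q₃ , q₄ = &-elim q₂ in ≤-reflexive (trans (if-T q)
          (trans (cong (2 ^_) (m≤n⇒m∸n≡0 (≤-trans K≤t (late-near w (not-elim q₁) q₃ q₄)))) (sym (if-T q₄))))

      extend-spread : Spread st″
      extend-spread = record
        { inv = extend-inv inv R ; mono = λ {w} q → inf-old {u} {v} {st′} (mono {w} q) ; clk≤K = clk≤K′
        ; heavy = λ z z∉S → ≤-trans (heavy z z∉S) (heavier z z∉S) }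
        where
        clk≤K′ : ∀ w → clk st″ w ≤ K
        clk≤K′ w with w ≟ v | w ≟ u
        ... | yes refl | _ = ≤-trans (≤-reflexive (trans (clk-new {u} {v} {st′}) (cong suc clk≡t))) early
        ... | no w≢v | yes refl = ≤-trans (≤-reflexive (trans (clk-caller {u} {v} {st′} w≢v) (cong suc clk≡t))) early
        ... | no w≢v | no w≢u = ≤-trans (≤-reflexive (clk-other {u} {v} {st′} w≢u w≢v)) (clk≤K w)
        heavier : ∀ z → ¬ T (S z) → potential z st′ ≤ potential z st″
        heavier z z∉S = sum-merge u v u≢v other
          (if-F (λ q → proj₁ (proj₂ R) (proj₂ (&-elim (proj₂ (&-elim q)))))) split
          where
          open ≤-Reasoning
          other : ∀ i → i ≢ u → i ≢ v → weight z st′ i ≤ weight z st″ i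
          other i i≢u i≢v = ≤-reflexive (cong₂ (λ x y → if not (S i) & near a i z & x then 2 ^ (K ∸ y) else 0)
            (sym (inf-extend {u} {v} {st′} i≢v)) (sym (clk-other {u} {v} {st′} i≢u i≢v)))
          halves : 2 ^ (K ∸ t) ≡ 2 ^ (K ∸ suc t) + 2 ^ (K ∸ suc t)
          halves = trans (cong (2 ^_) (trans (cong (_∸ t) (sym (m∸n+n≡m early)))
              (trans (cong (_∸ t) (+-suc (K ∸ suc t) t)) (m+n∸n≡m (suc (K ∸ suc t)) t))))
            (cong (2 ^ (K ∸ suc t) +_) (+-identityʳ _))
          split : weight z st′ u ≤ weight z st″ u + weight z st″ v
          split with T? (not (S u) & near a u z & inf st′ u)
          ... | no q = ≤-trans (≤-reflexive (if-F q)) z≤n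
          ... | yes q = begin
            weight z st′ u                          ≡⟨ if-T q ⟩
            2 ^ (K ∸ clk st′ u)                     ≡⟨ cong (λ y → 2 ^ (K ∸ y)) clk≡t ⟩
            2 ^ (K ∸ t)                             ≡⟨ halves ⟩
            2 ^ (K ∸ suc t) + 2 ^ (K ∸ suc t)       ≡⟨ cong₂ _+_ (half-at (clk-caller {u} {v} {st′} u≢v) qu) (half-at (clk-new {u} {v} {st′}) qv) ⟩
            weight z st″ u + weight z st″ v         ∎
            where
            e : T (near a u z)
            e = proj₁ (&-elim (proj₂ (&-elim q)))
            qu : T (not (S u) & near a u z & inf st″ u)
            qu = &-intro (not-intro u∉S) (&-intro e (inf-old {u} {v} {st′} (proj₁ R)))
            qv : T (not (S v) & near a v z & inf st″ v)
            qv = &-intro (not-intro v∉S)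
              (&-intro (near-trans v∉S u∉S z∉S (near-sym (near-edge (proj₂ (proj₂ R)))) e) (inf-new {u} {v} {st′}))
            half-at : ∀ {w} → clk st″ w ≡ suc (clk st′ u) → T (not (S w) & near a w z & inf st″ w) →
                      2 ^ (K ∸ suc t) ≡ weight z st″ w
            half-at r q = trans (cong (λ y → 2 ^ (K ∸ y)) (sym (trans r (cong suc clk≡t)))) (sym (if-T q))

      extend-late : ∀ {m w} → m ≤ suc t → Late m st′ w → Late m st″ w
      extend-late {m} {w} m≤ l w∉S i with w ≟ v | w ≟ u
      ... | yes refl | _ = inj₁ (≤-trans m≤ (≤-reflexive (sym (trans (clk-new {u} {v} {st′}) (cong suc clk≡t)))))
      ... | no w≢v | yes refl = inj₁ (≤-trans m≤ (≤-reflexive (sym (trans (clk-caller {u} {v} {st′} w≢v) (cong suc clk≡t)))))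
      ... | no w≢v | no w≢u = [ (λ le → inj₁ (≤-trans le (≤-reflexive (sym (clk-other {u} {v} {st′} w≢u w≢v)))))
                              , (λ full → inj₂ (λ x x∉S e → inf-old {u} {v} {st′} (full x x∉S e))) ]′ (l w∉S (inf-back {u} {v} {st′} w≢v i))

      extend-caller-late : suc t ≤ clk st″ u
      extend-caller-late = ≤-reflexive (sym (trans (clk-caller {u} {v} {st′} u≢v) (cong suc clk≡t)))

    -- The invariants of the three nested loops of `spread`, over the clock value t, over callers
    -- and over receivers.
    Outer : ℕ → State → Set
    Outer t st′ = Spread st′ × (∀ w → Late t st′ w)

    Middle : V → ℕ → State → Set
    Middle t k st′ = Outer (toℕ t) st′ × (∀ w → toℕ w < k → Late (suc (toℕ t)) st′ w)

    Inner : V → V → ℕ → State → Set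
    Inner t u k st′ = Middle t (toℕ u) st′ ×
      (¬ T (S u) → T (inf st′ u) →
        suc (toℕ t) ≤ clk st′ u ⊎ (∀ v → toℕ v < k → ¬ T (S v) → T (a u v) → T (inf st′ v)))

    spreadStep-inner : ∀ t u v st′ → Inner t u (toℕ v) st′ → Inner t u (suc (toℕ v)) (spreadStep a S t u v st′)
    spreadStep-inner t u v st′ M@(((P , late) , passed) , cur)
      with T? (not (S u) & not (S v) & inf st′ u & (clk st′ u ≤ᴮ toℕ t) & not (suc (clk st′ u) ≤ᴮ toℕ t))
    ... | no q = subst (Inner t u (suc (toℕ v))) (sym (if-F q)) (((P , late) , passed) , λ u∉S i → go u∉S i (cur u∉S i) (late u u∉S i))
      where
      go : ¬ T (S u) → T (inf st′ u) →
           suc (toℕ t) ≤ clk st′ u ⊎ (∀ w → toℕ w < toℕ v → ¬ T (S w) → T (a u w) → T (inf st′ w)) →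
           toℕ t ≤ clk st′ u ⊎ Full st′ u →
           suc (toℕ t) ≤ clk st′ u ⊎ (∀ w → toℕ w < suc (toℕ v) → ¬ T (S w) → T (a u w) → T (inf st′ w))
      go u∉S i (inj₁ le) _ = inj₁ le
      go u∉S i _ (inj₂ full) = inj₂ (λ w _ → full w)
      go u∉S i (inj₂ c) (inj₁ le) with T? (S v) | suc (toℕ t) ≤? clk st′ u
      ... | _ | yes le′ = inj₁ le′
      ... | no v∉S | no ¬le = ⊥-elim (q (&-intro (not-intro u∉S) (&-intro (not-intro v∉S) (&-intro i
              (&-intro (≤⇒≤ᴮ (≤-pred (≰⇒> ¬le))) (not-intro (λ t′ → <⇒≱ (≤ᴮ⇒≤ (suc (clk st′ u)) t′) le)))))))
      ... | yes v∈S | no _ = inj₂ (λ w lt w∉S → c w (≤∧≢⇒< (≤-pred lt)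
              (λ e → w∉S (subst (T ∘ S) (sym (toℕ-injective e)) v∈S))) w∉S)
    ... | yes q₁ = subst (Inner t u (suc (toℕ v))) (sym (if-T q₁))
      (send-elim (Inner t u (suc (toℕ v))) extended stay)
      where
      q₂ = &-elim q₁
      q₃ = &-elim (proj₂ q₂)
      q₄ = &-elim (proj₂ q₃)
      q₅ = &-elim (proj₂ q₄)
      u∉S : ¬ T (S u)
      u∉S = not-elim (proj₁ q₂)
      v∉S : ¬ T (S v)
      v∉S = not-elim (proj₁ q₃)
      clk≡t : clk st′ u ≡ toℕ t
      clk≡t = ≤-antisym (≤ᴮ⇒≤ (clk st′ u) (proj₁ q₅)) (≤-pred (≰⇒> (λ le → not-elim (proj₂ q₅) (≤⇒≤ᴮ le))))
      extended : Ready u v st′ → Inner t u (suc (toℕ v)) (extend u v st′)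
      extended R = ((extend-spread P late u∉S v∉S clk≡t R ,
                     λ w → extend-late P late u∉S v∉S clk≡t R {toℕ t} {w} (n≤1+n _) (late w)) ,
                    λ w lt → extend-late P late u∉S v∉S clk≡t R {suc (toℕ t)} {w} ≤-refl (passed w lt)) ,
                   -- A call moves the clock of u to t + 1, which settles u for this value of t.
                   λ _ _ → inj₁ (extend-caller-late P late u∉S v∉S clk≡t R)
      stay : ¬ Ready u v st′ → Inner t u (suc (toℕ v)) st′
      stay ¬R = ((P , late) , passed) , λ u∉S i → [ inj₁ , (λ c → inj₂ (λ w lt w∉S e → go i c w lt w∉S e)) ]′ (cur u∉S i)
        where
        go : T (inf st′ u) → (∀ w → toℕ w < toℕ v → ¬ T (S w) → T (a u w) → T (inf st′ w)) →
             ∀ w → toℕ w < suc (toℕ v) → ¬ T (S w) → T (a u w) → T (inf st′ w)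
        go i c w lt w∉S e with w ≟ v
        ... | yes refl = decidable-stable (T? _) (λ ¬i → ¬R (i , ¬i , e))
        ... | no w≢v = c w (≤∧≢⇒< (≤-pred lt) (λ r → w≢v (toℕ-injective r))) w∉S e

    -- After the loop, an informed vertex with an uninformed neighbour in its clique would have a
    -- clock of at least n, but clocks are smaller than the number of informed vertices. As every
    -- clique contains an informed vertex, everyone is informed.
    spread-correct : Inv (spread a S st) × (∀ w → clk (spread a S st) w ≤ K) × (∀ w → T (inf (spread a S st) w))
    spread-correct = let P , late = final in
      Spread.inv P , Spread.clk≤K P , λ w → everyone P late w (T? (S w))
      where
      afterInner : ∀ {t u st′} → Inner t u (suc N) st′ → Middle t (suc (toℕ u)) st′
      afterInner {t} {u} {st′} ((O , passed) , cur) = O , passed′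
        where
        passed′ : ∀ w → toℕ w < suc (toℕ u) → Late (suc (toℕ t)) st′ w
        passed′ w lt w∉S i with w ≟ u
        ... | yes refl = [ inj₁ , (λ c → inj₂ (λ v → c v (toℕ<n v))) ]′ (cur w∉S i)
        ... | no w≢u = passed w (≤∧≢⇒< (≤-pred lt) (λ r → w≢u (toℕ-injective r))) w∉S i
      inner : ∀ t u st′ → Middle t (toℕ u) st′ → Middle t (suc (toℕ u)) (foldFin st′ (λ v st → spreadStep a S t u v st))
      inner t u st′ M = afterInner {t} {u} (foldFin-ind (Inner t u) (spreadStep-inner t u) (M , λ _ _ → inj₂ (λ _ ())))
      afterMiddle : ∀ {t st′} → Middle t (suc N) st′ → Outer (suc (toℕ t)) st′
      afterMiddle ((P , _) , passed) = P , λ w → passed w (toℕ<n w)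
      middle : ∀ t st′ → Outer (toℕ t) st′ → Outer (suc (toℕ t)) (foldFin st′ (λ u st → foldFin st (λ v st → spreadStep a S t u v st)))
      middle t st′ O = afterMiddle {t} (foldFin-ind (Middle t) (inner t) (O , λ _ ()))
      final : Outer (suc N) (spread a S st)
      final = foldFin-ind Outer middle (start-spread , λ _ _ _ → inj₁ z≤n)
      everyone : ∀ {st′} → Spread st′ → (∀ w → Late (suc N) st′ w) → ∀ w → Dec (T (S w)) → T (inf st′ w)
      everyone P late w (yes w∈S) = Spread.mono P (reached w w∈S)
      everyone {st′} P late w (no w∉S) with touched-elim {st} (all-touched w w∉S)
      ... | u , u∉S , e , i with near-elim e | late u u∉S (Spread.mono P i)
      ...   | inj₂ refl | _ = Spread.mono P i
      ...   | inj₁ uw | inj₂ full = full w w∉S uw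
      ...   | inj₁ uw | inj₁ le = ⊥-elim (<⇒≱ (<-≤-trans (Inv.busy (Spread.inv P) u) (count≤ (inf st′))) le)

  finish-correct : ∀ {st} → Inv st → Reached st → ∀ {base} → (∀ w → clk st w ≤ base) →
    Inv (finish a S st) × (∀ w → clk (finish a S st) w ≤ base + b + b) × (∀ w → T (inf (finish a S st) w))
  finish-correct {st} I reached {base} clk≤ = go (Assigning.assign-correct (Inv.source I))
    where
    open Assigning {st} (Inv.source I)
    open Serving I reached clk≤
    go : ∀ {A} → Fair A × Complete A → let st′ = spread a S (serve a S A st) in
         Inv st′ × (∀ w → clk st′ w ≤ base + b + b) × (∀ w → T (inf st′ w))
    go {A} (F , C) = Spreading.spread-correct V.inv (λ x q → V.mono (reached x q)) (λ w → bound w (T? (S w)))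
                       (serve-touches F C)
      where
      module V = Served (served F C)
      bound : ∀ w → Dec (T (S w)) → clk (serve a S A st) w ≤ base + b
      bound w (yes q) = ≤-trans (V.servers w q) (+-monoʳ-≤ base (called-by≤ F C (serve a S A st) w))
      bound w (no q) = V.clients w q

  approximation : Connected G →
    let st = finish a S (reach a S (initial s)) in
    Broadcast a s (par st) (birth st) × (∀ v → birth st v ≤ 3 * count S + b + b)
  approximation conn = go (reach-correct conn)
    where
    go : ∀ {st} → Reaching st × Reached st →
         Broadcast a s (par (finish a S st)) (birth (finish a S st)) ×
         (∀ v → birth (finish a S st) v ≤ 3 * count S + b + b)
    go {st} ((I , clk≤) , reached) =
      let inv , clk≤K , all = finish-correct I reached (λ w → ≤-trans (clk≤ w)
            (*-monoʳ-≤ 3 (count-mono {P = informedS st} {Q = S} (λ z t → proj₂ (&-elim t)))))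
      in inv⇒broadcast inv all , λ v → ≤-trans (Inv.awake inv v (all v)) (clk≤K v)

-- Exhaustive search

private
  variable
    N : ℕ

module _ {A : Set} {f : (Fin (suc N) → Fin (suc N)) → A → A} where

  foldLists-inv : (P : A → Set) → (∀ h acc → P acc → P (f h acc)) →
                  ∀ j {xs acc} → P acc → P (foldLists j xs acc f)
  foldLists-inv P s zero p = s _ _ p
  foldLists-inv P s (suc j) p = foldFin-inv P (λ v acc → foldLists-inv P s j) p

  module _ (g : Fin (suc N) → Fin (suc N)) (P Q : A → Set)
           (s : ∀ h acc → P acc → P (f h acc))
           (hit : ∀ h acc → (∀ i → h i ≡ g i) → P acc → Q (f h acc))
           (t : ∀ h acc → P acc → Q acc → Q (f h acc)) where

    private
      nth-tabulate : ∀ {k} (h : Fin k → Fin (suc N)) i → nth (tabulate h) i ≡ h i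
      nth-tabulate h zero = refl
      nth-tabulate h (suc i) = nth-tabulate (h ∘ suc) i

      drop-tabulate : ∀ {k} (h : Fin k → Fin (suc N)) {j} (lt : j < k) →
                      h (fromℕ< lt) ∷ List.drop (suc j) (tabulate h) ≡ List.drop j (tabulate h)
      drop-tabulate {suc k} h {zero} (s≤s lt) = refl
      drop-tabulate {suc k} h {suc j} (s≤s lt) = drop-tabulate (h ∘ suc) lt

      drop-all′ : ∀ {k} (h : Fin k → Fin (suc N)) → [] ≡ List.drop k (tabulate h)
      drop-all′ {zero} h = refl
      drop-all′ {suc k} h = drop-all′ (h ∘ suc)

      go : ∀ j {acc} → j ≤ suc N → P acc → Q (foldLists j (List.drop j (tabulate g)) acc f)
      go zero le p = hit _ _ (nth-tabulate g) p
      go (suc j) {acc} lt p = foldFin-hit (g (fromℕ< lt)) P Q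
        (λ v acc p → foldLists-inv P s j p)
        (λ acc p → subst (λ l → Q (foldLists j l acc f)) (sym (drop-tabulate g lt)) (go j (<⇒≤ lt) p))
        (λ v acc p q → proj₂ (foldLists-inv (λ acc → P acc × Q acc)
          (λ { h acc (p , q) → s h acc p , t h acc p q }) j (p , q))) p

    -- Values are prepended, so the branch leading to g chooses the last value of g first. The
    -- function formed at its leaf is read off a list and agrees with g pointwise, which is why
    -- `hit` speaks of pointwise equality.
    foldLists-hit : ∀ {acc} → P acc → Q (foldLists (suc N) [] acc f)
    foldLists-hit {acc} p = subst (λ l → Q (foldLists (suc N) l acc f)) (sym (drop-all′ g)) (go (suc N) ≤-refl p)

module _ {n} {a : Fin n → Fin n → Bool} {s : Fin n} where

  broadcast-cong : ∀ {p p′ f f′} → (∀ v → p v ≡ p′ v) → (∀ v → f v ≡ f′ v) →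
                   Broadcast a s p f → Broadcast a s p′ f′
  broadcast-cong {p} {p′} {f} {f′} ep ef B = record
    { root = trans (sym (ep s)) root ; rootTime = trans (sym (ef s)) rootTime
    ; edge = λ v q → subst (λ u → T (a u v)) (ep v) (edge v q)
    ; later = λ v q → subst₂ _<_ (trans (ef (p v)) (cong f′ (ep v))) (ef v) (later v q)
    ; distinct = λ v w q r v≢w e k → distinct v w q r v≢w (trans (ep v) (trans e (sym (ep w))))
                   (trans (ef v) (trans k (sym (ef w)))) }
    where open Broadcast B

module Search {N} (a : Fin (suc N) → Fin (suc N) → Bool) (s : Fin (suc N)) where
  open Algorithm {N}

  within-elim : ∀ {t f} → T (within t f) → ∀ v → f v ≤ toℕ t
  within-elim t v = ≤ᴮ⇒≤ _ (allB-elim _ t v)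

  within-intro : ∀ {t f} → (∀ v → f v ≤ toℕ t) → T (within t f)
  within-intro le = allB-intro _ (λ v → ≤⇒≤ᴮ (le v))

  valid-elim : ∀ {p f} → T (valid a s p f) → Broadcast a s p (toℕ ∘ f)
  valid-elim {p} {f} t₁ = record
    { root = ==⇒≡ (p s) s (proj₁ (&-elim t₁))
    ; rootTime = n≤0⇒n≡0 (≤ᴮ⇒≤ (toℕ (f s)) (proj₁ (&-elim t₂)))
    ; edge = λ v q → proj₁ (edges v q)
    ; later = λ v q → proj₂ (edges v q)
    ; distinct = λ v w v≢s w≢s v≢w e k → not-elim
        (clean (clean (clean (clean (allB-elim _ (allB-elim _ (proj₂ (&-elim t₃)) v) w)
          (v≢s ∘ ==⇒≡ v s)) (w≢s ∘ ==⇒≡ w s)) (v≢w ∘ ==⇒≡ v w)) (λ t → not-elim t (≡⇒== e)))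
        (≡⇒== (toℕ-injective k)) }
    where
    t₂ = proj₂ (&-elim t₁)
    t₃ = proj₂ (&-elim t₂)
    clean : ∀ {x y} → T (x or y) → ¬ T x → T y
    clean t ¬x = [ (λ x → ⊥-elim (¬x x)) , id ]′ (or-elim t)
    edges : ∀ v → v ≢ s → T (a (p v) v) × suc (toℕ (f (p v))) ≤ toℕ (f v)
    edges v v≢s = let e , l = &-elim (clean (allB-elim _ (proj₁ (&-elim t₃)) v) (v≢s ∘ ==⇒≡ v s))
                  in e , ≤ᴮ⇒≤ (suc (toℕ (f (p v)))) l

  valid-intro : ∀ {p f} → Broadcast a s p (toℕ ∘ f) → T (valid a s p f)
  valid-intro {p} {f} B = &-intro (≡⇒== root) (&-intro (≤⇒≤ᴮ (≤-reflexive rootTime))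
    (&-intro (allB-intro _ edges) (allB-intro _ (λ v → allB-intro _ (siblings v)))))
    where
    open Broadcast B
    edges : ∀ v → T (v == s or (a (p v) v & suc (toℕ (f (p v))) ≤ᴮ toℕ (f v)))
    edges v with v ≟ s
    ... | yes e = or-introˡ (≡⇒== e)
    ... | no v≢s = or-introʳ {a = v == s} (&-intro (edge v v≢s) (≤⇒≤ᴮ (later v v≢s)))
    siblings : ∀ v w → T (v == s or w == s or v == w or not (p v == p w) or not (f v == f w))
    siblings v w with v ≟ s | w ≟ s | v ≟ w | p v ≟ p w
    ... | yes e | _ | _ | _ = or-introˡ (≡⇒== e)
    ... | _ | yes e | _ | _ = or-introʳ {a = v == s} (or-introˡ (≡⇒== e))
    ... | _ | _ | yes e | _ = or-introʳ {a = v == s} (or-introʳ {a = w == s} (or-introˡ (≡⇒== e)))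
    ... | _ | _ | _ | no e = or-introʳ {a = v == s} (or-introʳ {a = w == s} (or-introʳ {a = v == w}
                               (or-introˡ (not-intro (λ t → e (==⇒≡ (p v) (p w) t))))))
    ... | no q | no r | no q≢r | yes e = or-introʳ {a = v == s} (or-introʳ {a = w == s} (or-introʳ {a = v == w}
            (or-introʳ {a = not (p v == p w)} (not-intro (λ t → distinct v w q r q≢r e (cong toℕ (==⇒≡ (f v) (f w) t)))))))

  IsBroadcast : (V → V) × (V → ℕ) → Set
  IsBroadcast (p , f) = Broadcast a s p f

  module _ {p* : V → V} {f* : V → ℕ} (B : Broadcast a s p* f*) {b : ℕ} (f*≤b : ∀ v → f* v ≤ b) (b<n : b < suc N) where

    Fast : (V → V) × (V → ℕ) → Set
    Fast (_ , f) = ∀ v → f v ≤ b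

    improve-elim : ∀ p f best (P : (V → V) × (V → ℕ) → Set) →
      (T (valid a s p f) → T (better (toℕ ∘ f) (proj₂ best)) → P (p , toℕ ∘ f)) →
      (¬ (T (valid a s p f) × T (better (toℕ ∘ f) (proj₂ best))) → P best) → P (improve a s p f best)
    improve-elim p f best P yes′ no′ with T? (valid a s p f & better (toℕ ∘ f) (proj₂ best))
    ... | yes t = subst P (sym (if-T t)) (let x , y = &-elim t in yes′ x y)
    ... | no q = subst P (sym (if-F q)) (no′ (λ (x , y) → q (&-intro x y)))

    improve-broadcast : ∀ p f best → IsBroadcast best → IsBroadcast (improve a s p f best)
    improve-broadcast p f best B′ = improve-elim p f best IsBroadcast (λ t _ → valid-elim t) (λ _ → B′)

    improve-fast : ∀ p f best → Fast best → Fast (improve a s p f best)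
    improve-fast p f best F = improve-elim p f best Fast new (λ _ → F)
      where
      new : T (valid a s p f) → T (better (toℕ ∘ f) (proj₂ best)) → Fast (p , toℕ ∘ f)
      -- The threshold is met by the new candidate and missed by the old one, which is within b; so
      -- the threshold lies below b.
      new _ t v = let t₀ , t₁ = anyB-elim _ t; t₂ , t₃ = &-elim t₁ in
        ≤-trans (within-elim {t₀} {toℕ ∘ f} t₂ v) (<⇒≤ (≰⇒> (λ b≤t → not-elim t₃ (within-intro {t₀} {proj₂ best} (λ v → ≤-trans (F v) b≤t)))))

    improve-hit : ∀ p f best → (∀ v → p v ≡ p* v) → (∀ v → toℕ (f v) ≡ f* v) → Fast (improve a s p f best)
    improve-hit p f best ep ef = improve-elim p f best Fast (λ _ _ → fast) old
      where
      fast : Fast (p , toℕ ∘ f)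
      fast v = subst (_≤ b) (sym (ef v)) (f*≤b v)
      t₀ : V
      t₀ = fromℕ< b<n
      -- If the optimal candidate is rejected although it is valid, then b does not separate it from
      -- the current best, which is therefore within b already.
      old : ¬ (T (valid a s p f) × T (better (toℕ ∘ f) (proj₂ best))) → Fast best
      old no′ v = subst (proj₂ best v ≤_) (toℕ-fromℕ< b<n) (within-elim {t₀} {proj₂ best}
        (decidable-stable (T? (within t₀ (proj₂ best))) (λ ¬w → no′
          (valid-intro (broadcast-cong (λ v → sym (ep v)) (λ v → sym (ef v)) B) ,
           anyB-intro _ t₀ (&-intro (within-intro {t₀} {toℕ ∘ f} (λ v → subst (toℕ (f v) ≤_) (sym (toℕ-fromℕ< b<n)) (fast v)))
             (not-intro ¬w))))) v)

    optimum-correct : IsBroadcast (approximate a s) → IsBroadcast (optimum a s) × Fast (optimum a s)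
    optimum-correct B₀ =
      foldLists-inv IsBroadcast (λ p acc → foldLists-inv IsBroadcast (λ f acc → improve-broadcast p f acc) (suc N)) (suc N) B₀ ,
      foldLists-hit p* (λ _ → ⊤) Fast (λ _ _ _ → tt)
        (λ p acc ep _ → foldLists-hit f′ (λ _ → ⊤) Fast (λ _ _ _ → tt)
          (λ f acc ef _ → improve-hit p f acc ep (λ v → trans (cong toℕ (ef v)) (toℕ-fromℕ< (f*<n v))))
          (λ f acc _ → improve-fast p f acc) tt)
        (λ p acc _ F → foldLists-inv Fast (λ f acc → improve-fast p f acc) (suc N) F) tt
      where
      f*<n : ∀ v → f* v < suc N
      f*<n v = ≤-<-trans (f*≤b v) b<n
      f′ : V → V
      f′ v = fromℕ< (f*<n v)

-- Comparing n with 2 ^ (3 M |S|) by halving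

toℕ-lastIdx : ∀ N → toℕ (lastIdx N) ≡ N
toℕ-lastIdx N = conclude (foldFin-ind P (λ i x _ → inj₂ refl) (inj₁ refl))
  where
  P : ℕ → Fin (suc N) → Set
  P k x = k ≡ 0 ⊎ k ≡ suc (toℕ x)
  conclude : ∀ {x} → P (suc N) x → toℕ x ≡ N
  conclude (inj₂ e) = sym (suc-injective e)

module _ {A : Set} (P : ℕ → A → Set) where

  private
    at : ∀ {k l x} → k ≡ l → P k x → P l x
    at refl p = p

  foldFin-count-ind : ∀ {m} (S : Fin m → Bool) (d : ℕ) (f : Fin m → A → A) →
    (∀ i k x → T (S i) → P k x → P (k + d) (f i x)) → (∀ i k x → ¬ T (S i) → P k x → P k (f i x)) →
    ∀ {k x} → P k x → P (k + count S * d) (foldFin x f)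
  foldFin-count-ind {m} S d f s t {k} {x} p = subst (P _) (foldFin-foldl x f) (go id p)
    where
    go : ∀ {n} (g : Fin n → Fin m) {k x} → P k x →
         P (k + count (S ∘ g) * d) (foldl (λ acc i → f i acc) x (tabulate g))
    go {zero} g {k} {x} p = at (sym (+-identityʳ k)) p
    go {suc n} g {k} {x} p with T? (S (g zero))
    ... | no q = at (cong (λ z → k + (z + count (S ∘ g ∘ suc)) * d) (sym (if-F q))) (go (g ∘ suc) (t _ k x q p))
    ... | yes q = at (trans (+-assoc k d _) (cong (λ z → k + (z + count (S ∘ g ∘ suc)) * d) (sym (if-T q))))
                    (go (g ∘ suc) (s _ k x q p))

  iter-ind : ∀ M (d : ℕ) (f : A → A) → (∀ k x → P k x → P (k + d) (f x)) → ∀ {k x} → P k x → P (k + M * d) (iter M x f)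
  iter-ind zero d f s {k} p = at (sym (+-identityʳ k)) p
  iter-ind (suc M) d f s {k} {x} p = at (+-assoc k d (M * d)) (iter-ind M d f s (s k x p))

module _ {N} (a : Fin (suc N) → Fin (suc N) → Bool) (M : ℕ) where
  open Algorithm {N}

  halvings : ℕ
  halvings = M * (count (modulator a) * 3)

  private
    -- Integer division of N by 2 ^ h, expressed by two inequalities that are easily carried through
    -- a halving.
    record Quotient (h : ℕ) (y : V) : Set where
      constructor _,_
      field
        lower : toℕ y * 2 ^ h ≤ N
        upper : N < suc (toℕ y) * 2 ^ h

    halve-quotient : ∀ {h y} → Quotient h y → Quotient (suc h) (halve y)
    halve-quotient {h} {y} (lo , hi) =
      subst (λ z → z * 2 ^ suc h ≤ N) (sym q≡)
      (≤-trans (≤-trans (≤-reflexive (sym (*-assoc q 2 (2 ^ h)))) (*-monoˡ-≤ (2 ^ h) q2≤)) lo) ,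
      subst (λ z → N < suc z * 2 ^ suc h) (sym q≡)
      (<-≤-trans hi (≤-trans (*-monoˡ-≤ (2 ^ h) ≤2q) (≤-reflexive (*-assoc (suc q) 2 (2 ^ h)))))
      where
      q = ⌊ toℕ y /2⌋
      q≡ : toℕ (halve y) ≡ q
      q≡ = toℕ-fromℕ< _
      double : q * 2 ≡ q + q
      double = trans (*-comm q 2) (cong (q +_) (+-identityʳ q))
      q2≤ : q * 2 ≤ toℕ y
      q2≤ = ≤-trans (≤-reflexive double) (≤-trans (+-monoʳ-≤ q (⌊n/2⌋≤⌈n/2⌉ (toℕ y))) (≤-reflexive (⌊n/2⌋+⌈n/2⌉≡n (toℕ y))))
      ≤2q : suc (toℕ y) ≤ suc q * 2
      ≤2q = s≤s (≤-trans (bound (toℕ y)) (≤-reflexive (cong suc (*-comm 2 q))))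
        where
        bound : ∀ x → x ≤ suc (2 * ⌊ x /2⌋)
        bound zero = z≤n
        bound (suc zero) = ≤-refl
        bound (suc (suc x)) = ≤-trans (s≤s (s≤s (bound x))) (≤-reflexive (cong suc (eq ⌊ x /2⌋)))
          where
          eq : ∀ q → 2 + 2 * q ≡ 2 * suc q
          eq = solve-∀

    quotient : ∃[ y ] Quotient halvings y × large a M ≡ not (toℕ y ≤ᴮ 0)
    quotient = iter M (lastIdx N) body , iter-ind Quotient M (count (modulator a) * 3) body
      (λ k x → foldFin-count-ind Quotient (modulator a) 3 step
        (λ i k x q p → subst₂ Quotient (+-comm 3 k) (sym (if-T q)) (halve-quotient {suc (suc k)} {halve (halve x)}
          (halve-quotient {suc k} {halve x} (halve-quotient {k} {x} p))))
        (λ i k x q p → subst (Quotient k) (sym (if-F q)) p))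
      {0} {lastIdx N} (subst (λ z → z * 1 ≤ N) (sym (toℕ-lastIdx N)) (≤-reflexive (*-identityʳ N)) ,
        subst (λ z → N < suc z * 1) (sym (toℕ-lastIdx N)) (≤-reflexive (sym (*-identityʳ (suc N))))) , refl
      where
      step : V → V → V
      step i y = if modulator a i then halve (halve (halve y)) else y
      body : V → V
      body y = foldFin y step

  large-sound : T (large a M) → 2 ^ halvings ≤ N
  large-sound t =
    let y , (lo , _) , e = quotient
        y≢0 : 0 < toℕ y
        y≢0 = ≰⇒> (λ le → not-elim (subst T e t) (≤⇒≤ᴮ {toℕ y} {0} le))
    in ≤-trans (≤-trans (≤-reflexive (sym (+-identityʳ (2 ^ halvings)))) (*-monoˡ-≤ (2 ^ halvings) y≢0)) lo

  large-complete : ¬ T (large a M) → suc N ≤ 2 ^ halvings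
  large-complete ¬t =
    let y , (_ , hi) , e = quotient
        y≡0 : toℕ y ≡ 0
        y≡0 = n≤0⇒n≡0 (≤ᴮ⇒≤ (toℕ y) (decidable-stable (T? (toℕ y ≤ᴮ 0)) (λ ¬le → ¬t (subst T (sym e) (not-intro ¬le)))))
    in ≤-trans (subst (λ z → N < suc z * 2 ^ halvings) y≡0 hi) (≤-reflexive (+-identityʳ (2 ^ halvings)))

-- Monomial bounds for costs

private
  variable
    m : ℕ
    ρ : Vec Value m

-- A single monomial bounds the cost. For sums, degrees and exponents are added rather than
-- maximised, which is valid because all monomials are at least 1.
coef deg expo : Cost → ℕ
coef (con c) = c
coef (c ⊕ d) = coef c + coef d
coef (n⊛ c) = coef c
coef (X⊛ c) = coef c
coef (m ⊛ c) = m * coef c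
deg (con c) = 0
deg (c ⊕ d) = deg c + deg d
deg (n⊛ c) = suc (deg c)
deg (X⊛ c) = deg c
deg (m ⊛ c) = deg c
expo (con c) = 0
expo (c ⊕ d) = expo c + expo d
expo (n⊛ c) = expo c
expo (X⊛ c) = suc (expo c)
expo (m ⊛ c) = expo c

module _ (N : ℕ) where

  private
    n = suc N

    pos : ∀ {m} k → 1 ≤ m → 1 ≤ m ^ k
    pos {m} k p = subst (_≤ m ^ k) (^-zeroˡ k) (^-monoˡ-≤ k p)

    X-pos : 1 ≤ X n
    X-pos = pos n (s≤s z≤n)

    monomial : ℕ → ℕ → ℕ
    monomial d e = n ^ d * X n ^ e

    monomial-pos : ∀ d e → 1 ≤ monomial d e
    monomial-pos d e = *-mono-≤ (pos d (s≤s z≤n)) (pos e X-pos)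

    monomial-+ : ∀ d e d′ e′ → monomial d e * monomial d′ e′ ≡ monomial (d + d′) (e + e′)
    monomial-+ d e d′ e′ = trans (eq (n ^ d) (X n ^ e) (n ^ d′) (X n ^ e′))
      (sym (cong₂ _*_ (^-distribˡ-+-* n d d′) (^-distribˡ-+-* (X n) e e′)))
      where
      eq : ∀ a b c d → a * b * (c * d) ≡ a * c * (b * d)
      eq = solve-∀

    grow : ∀ x {y} → 1 ≤ y → x ≤ x * y
    grow x p = ≤-trans (≤-reflexive (sym (*-identityʳ x))) (*-monoʳ-≤ x p)

  cost-bound : ∀ c → ⟪ c ⟫ n ≤ coef c * monomial (deg c) (expo c)
  cost-bound (con c) = grow c (monomial-pos 0 0)
  cost-bound (c ⊕ d) = ≤-trans (+-mono-≤
      (≤-trans (cost-bound c) (*-monoʳ-≤ (coef c) (≤-trans (grow _ (monomial-pos (deg d) (expo d)))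
        (≤-reflexive (monomial-+ (deg c) (expo c) (deg d) (expo d))))))
      (≤-trans (cost-bound d) (*-monoʳ-≤ (coef d) (≤-trans (grow _ (monomial-pos (deg c) (expo c)))
        (≤-reflexive (trans (*-comm (monomial (deg d) (expo d)) _) (monomial-+ (deg c) (expo c) (deg d) (expo d))))))))
    (≤-reflexive (sym (*-distribʳ-+ _ (coef c) (coef d))))
  cost-bound (n⊛ c) = ≤-trans (*-monoʳ-≤ n (cost-bound c)) (≤-reflexive (eq n (coef c) (n ^ deg c) (X n ^ expo c)))
    where
    eq : ∀ a b c d → a * (b * (c * d)) ≡ b * (a * c * d)
    eq = solve-∀
  cost-bound (X⊛ c) = ≤-trans (*-monoʳ-≤ (X n) (cost-bound c)) (≤-reflexive (eq (X n) (coef c) (n ^ deg c) (X n ^ expo c)))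
    where
    eq : ∀ a b c d → a * (b * (c * d)) ≡ b * (c * (a * d))
    eq = solve-∀
  cost-bound (m ⊛ c) = ≤-trans (*-monoʳ-≤ m (cost-bound c)) (≤-reflexive (sym (*-assoc m (coef c) _)))

-- The complete program

idsB : Term (2 + m)
idsB = case (var 0F) nil (case (var 0F) nil
  (cons (var 3F) (app (var 5F) (cons (var 1F) (cons nil (var 3F))))))

-- Compiled code expects the list of all indices, which the program has to produce itself; the rows
-- of the matrix tell how long it is.
⇓ids : ∀ {n} (f : Fin n → Value) k →
       (cons (encodeList (tabulate f)) (encodeℕ k) ∷ clo {m} ρ idsB ∷ ρ) ⊢ idsB
       ⇓ encodeList (tabulate {n = n} (λ i → encodeℕ (toℕ i + k))) ≤[ 5 + n * 15 ]
⇓ids {n = zero} f k = ⇓case-cons (⇓var refl) (⇓case-nil (⇓var refl) ⇓nil)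
⇓ids {n = suc n} f k = relax (m≤n+m _ 2)
  (⇓≡ (cong (cons (encodeℕ k) ∘ encodeList) (tabulate-cong
      {n = n} {f = λ i → encodeℕ (toℕ i + suc k)} {g = λ i → encodeℕ (suc (toℕ i + k))} (λ i → cong encodeℕ (+-suc (toℕ i) k))))
    (⇓case-cons (⇓var refl) (⇓case-cons (⇓var refl)
      (⇓cons (⇓var refl) (⇓self refl (⇓cons (⇓var refl) (⇓cons ⇓nil (⇓var refl))) (⇓ids {n = n} (f ∘ suc) (suc k)))))))

approximateOut optimumOut : Exp (graphTy ∷ idx ∷ []) (arr (arr num))
approximateOut = call matrixE (approximateE ∷ [])
optimumOut = call matrixE (optimumE ∷ [])

-- In `branch` the variables are the list of indices, the closure just applied, the matrix, the
-- source and the input, in this order.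
position : Fin 2 → Fin 5
position zero = 2F
position (suc _) = 3F

Output : Ty
Output = arr (arr num)

-- An `ite` of the language would be charged for both branches. The final choice is made outside it,
-- so that the exhaustive search is paid for only when it runs.
branch : Exp (graphTy ∷ idx ∷ []) bool → (e₁ e₂ : Exp (graphTy ∷ idx ∷ []) Output) → Program
branch t e₁ e₂ = case (var 0F) nil
  (app (rec (case (compile t position 0F) (compile e₂ position 0F) (compile e₁ (s2 ∘ position) 2F)))
       (app (rec idsB) (cons (var 0F) nil)))

branchCost : Exp (graphTy ∷ idx ∷ []) bool → Exp (graphTy ∷ idx ∷ []) Output → Cost
branchCost t e = con 30 ⊕ n⊛ con 15 ⊕ cost t ⊕ cost e

module _ {N} (G : Graph (suc N)) (s : Fin (suc N)) where

  input : Env (graphTy ∷ idx ∷ []) N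
  input = adj G , s , tt

  module _ (t : Exp (graphTy ∷ idx ∷ []) bool) (e₁ e₂ : Exp (graphTy ∷ idx ∷ []) Output) where

    private
      F : ∀ {v} → Fits {Γ = graphTy ∷ idx ∷ []} input
            (encIds (suc N) ∷ v ∷ enc graphTy {N} (adj G) ∷ enc idx {N} s ∷ encodeInstance G s ∷ []) position 0F
      F = fits (λ { zero → refl ; (suc zero) → refl }) refl

      ⇓ids′ : ∀ {m} {ρ : Vec Value m} →
              (cons (enc graphTy {N} (adj G)) nil ∷ clo ρ idsB ∷ ρ) ⊢ idsB ⇓ encIds (suc N) ≤[ 5 + suc N * 15 ]
      ⇓ids′ = ⇓≡ (cong encodeList (trans (tabulate-cong {n = suc N} {f = λ i → encodeℕ (toℕ i + 0)} {g = encIdx}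
                     (λ i → cong encodeℕ (+-identityʳ (toℕ i))))
                   (sym (map-tabulate {n = suc N} id encIdx)))) (⇓ids {n = suc N} (λ i → enc (arr bool) {N} (adj G i)) 0)

      sum-shape : ∀ i l x → suc (1 + suc (1 + suc (1 + 3 + (5 + i)) + suc (l + x))) ≤ 30 + (i + (l + x))
      sum-shape i l x = ≤-trans (≤-reflexive (eq i l x)) (m≤n+m _ 15)
        where
        eq : ∀ i l x → suc (1 + suc (1 + suc (1 + 3 + (5 + i)) + suc (l + x))) ≡ 15 + (i + (l + x))
        eq = solve-∀

    branch-true : sem t input ≡ true →
      (encodeInstance G s ∷ []) ⊢ branch t e₁ e₂ ⇓ enc Output {N} (sem e₁ input) ≤[ ⟪ branchCost t e₁ ⟫ (suc N) ]
    branch-true q = relax (sum-shape (suc N * 15) (⟪ cost t ⟫ (suc N)) (⟪ cost e₁ ⟫ (suc N)))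
      (⇓case-cons (⇓var refl) (⇓app ⇓rec (⇓app ⇓rec (⇓cons (⇓var refl) ⇓nil) ⇓ids′)
        (⇓case-cons (⇓≡ (cong encodeBool q) (compile-correct t {input} F))
          (compile-correct e₁ {input} (fits (λ { zero → refl ; (suc zero) → refl }) refl)))))

    branch-false : sem t input ≡ false →
      (encodeInstance G s ∷ []) ⊢ branch t e₁ e₂ ⇓ enc Output {N} (sem e₂ input) ≤[ ⟪ branchCost t e₂ ⟫ (suc N) ]
    branch-false q = relax (sum-shape (suc N * 15) (⟪ cost t ⟫ (suc N)) (⟪ cost e₂ ⟫ (suc N)))
      (⇓case-cons (⇓var refl) (⇓app ⇓rec (⇓app ⇓rec (⇓cons (⇓var refl) ⇓nil) ⇓ids′)
        (⇓case-nil (⇓≡ (cong encodeBool q) (compile-correct t {input} F))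
          (compile-correct e₂ {input} F))))

  open Algorithm {N}

  sem-approximateOut : sem approximateOut input ≡ matrix (approximate (adj G) s)
  sem-approximateOut = trans (sym (apply-def (sem matrixE) (sem approximateE input , tt)))
    (trans (cong (λ t → sem matrixE (t , tt)) (sem-approximate (adj G) s)) (sem-matrix (adj G) (approximate (adj G) s)))

  sem-optimumOut : sem optimumOut input ≡ matrix (optimum (adj G) s)
  sem-optimumOut = trans (sym (apply-def (sem matrixE) (sem optimumE input , tt)))
    (trans (cong (λ t → sem matrixE (t , tt)) (sem-optimum (adj G) s)) (sem-matrix (adj G) (optimum (adj G) s)))

-- Computability of the bound f

addB powB : Term (2 + m)
addB = case (var 0F) nil (case (var 0F) (var 1F) (cons nil (app (var 5F) (cons (var 1F) (var 3F)))))
powB = case (var 0F) (cons nil nil)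
  (app (rec (app (rec addB) (cons (var 0F) (var 0F)))) (app (var 3F) (var 1F)))

add-correct : ∀ x y → ∃[ c ] (cons (encodeℕ x) (encodeℕ y) ∷ clo {m} ρ addB ∷ ρ) ⊢ addB ⇓ encodeℕ (x + y) [ c ]
add-correct zero y = _ , case-cons var (case-nil var var)
add-correct (suc x) y = _ , case-cons var (case-cons var (cons nil (app var (cons var var) (proj₂ (add-correct x y)))))

pow-correct : ∀ x → ∃[ c ] (encodeℕ x ∷ clo {m} ρ powB ∷ ρ) ⊢ powB ⇓ encodeℕ (2 ^ x) [ c ]
pow-correct zero = _ , case-nil var (cons nil nil)
pow-correct {m} {ρ} (suc x) = _ , double (cong (2 ^ x +_) (sym (+-identityʳ (2 ^ x))))
  (case-cons var (app rec (app var var (proj₂ (pow-correct x)))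
    (app rec (cons var var) (proj₂ (add-correct (2 ^ x) (2 ^ x))))))
  where
  double : ∀ {y z c} → y ≡ z → (encodeℕ (suc x) ∷ clo ρ powB ∷ ρ) ⊢ powB ⇓ encodeℕ y [ c ] →
           (encodeℕ (suc x) ∷ clo ρ powB ∷ ρ) ⊢ powB ⇓ encodeℕ z [ c ]
  double refl d = d

unary-correct : ∀ n → ∃[ c ] ρ ⊢ unaryT n ⇓ encodeℕ n [ c ]
unary-correct zero = _ , nil
unary-correct (suc n) = _ , cons nil (proj₂ (unary-correct n))

-- The search costs about a power of `X n`, which for n ≤ 2 ^ h is at most doubly exponential in h.
-- The third exponential turns the product in h ≤ 9 M k, where k stands for cvd, into the sum M + k;
-- Q collects the constants of the program.
tower : ℕ → ℕ → ℕ → ℕ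
tower Q M k = 2 ^ 2 ^ 2 ^ (Q + (M + k))

tower-computable : ∀ Q → Computable (λ k ε → tower Q (ℚ.↧ₙ ε) k)
tower-computable Q =
  case (var 0F) nil (case (var 1F) nil (pow (pow (pow (add (unaryT Q) (add (var 1F) (var 2F))))))) ,
  λ k ε _ → _ , case-cons var (case-cons var
    (proj₂ (⇓pow (proj₂ (⇓pow (proj₂ (⇓pow (proj₂ (⇓add (proj₂ (unary-correct Q)) (proj₂ (⇓add var var)))))))))))
  where
  add : Term m → Term m → Term m
  add e₁ e₂ = app (rec addB) (cons e₁ e₂)
  pow : Term m → Term m
  pow e = app (rec powB) e
  ⇓add : ∀ {e₁ e₂ : Term m} {x y c₁ c₂} → ρ ⊢ e₁ ⇓ encodeℕ x [ c₁ ] → ρ ⊢ e₂ ⇓ encodeℕ y [ c₂ ] →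
         ∃[ c ] ρ ⊢ add e₁ e₂ ⇓ encodeℕ (x + y) [ c ]
  ⇓add {x = x} {y} d₁ d₂ = _ , app rec (cons d₁ d₂) (proj₂ (add-correct x y))
  ⇓pow : ∀ {e : Term m} {x c} → ρ ⊢ e ⇓ encodeℕ x [ c ] → ∃[ c′ ] ρ ⊢ pow e ⇓ encodeℕ (2 ^ x) [ c′ ]
  ⇓pow {x = x} d = _ , app rec d (proj₂ (pow-correct x))

-- Arithmetic of the approximation ratio and of the time bound

n<2^n : ∀ n → n < 2 ^ n
n<2^n zero = ≤-refl
n<2^n (suc n) = ≤-trans (+-mono-≤ (≤-trans (s≤s z≤n) (n<2^n n)) (n<2^n n))
  (≤-reflexive (cong (2 ^ n +_) (sym (+-identityʳ (2 ^ n)))))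

n≤2^n : ∀ n → n ≤ 2 ^ n
n≤2^n n = <⇒≤ (n<2^n n)

2^-pos : ∀ n → 1 ≤ 2 ^ n
2^-pos n = ^-monoʳ-≤ 2 {0} {n} z≤n

-- Cross-multiplied, so that only natural numbers occur.
ratio : ∀ ε → 0ℚ ℚ.< ε → ∀ t b → t * ℚ.↧ₙ ε ≤ (2 * ℚ.↧ₙ ε + 1) * b →
        fromℕ t ℚ.≤ (fromℕ 2 ℚ.+ ε) ℚ.* fromℕ b
ratio (ℚ.mkℚ (ℤ.+ zero) d co) (ℚ.*<* (ℤ.+<+ ())) t b le
ratio (ℚ.mkℚ ℤ.-[1+ k ] d co) (ℚ.*<* ()) t b le
ratio r@(ℚ.mkℚ ℤ.+[1+ k ] d co) _ t b le = toℚᵘ-cancel-≤ (begin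
  ℚ.toℚᵘ (fromℕ t)                                                  ≃⟨ toℚᵘ-fromℚᵘ (integral t) ⟩
  integral t                                                        ≤⟨ ℚᵘ.*≤* cross ⟩
  (integral 2 ℚᵘ.+ ℚ.toℚᵘ r) ℚᵘ.* integral b
    ≃⟨ ℚᵘ-*-cong (ℚᵘ-+-cong {ℚ.toℚᵘ (fromℕ 2)} {integral 2} {ℚ.toℚᵘ r} {ℚ.toℚᵘ r}
         (toℚᵘ-fromℚᵘ (integral 2)) ℚᵘ-refl) (toℚᵘ-fromℚᵘ (integral b)) ⟨
  (ℚ.toℚᵘ (fromℕ 2) ℚᵘ.+ ℚ.toℚᵘ r) ℚᵘ.* ℚ.toℚᵘ (fromℕ b)            ≃⟨ ℚᵘ-*-cong (toℚᵘ-homo-+ (fromℕ 2) r) ℚᵘ-refl ⟨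
  ℚ.toℚᵘ (fromℕ 2 ℚ.+ r) ℚᵘ.* ℚ.toℚᵘ (fromℕ b)                      ≃⟨ toℚᵘ-homo-* (fromℕ 2 ℚ.+ r) (fromℕ b) ⟨
  ℚ.toℚᵘ ((fromℕ 2 ℚ.+ r) ℚ.* fromℕ b)                              ∎)
  where
  open ℚᵘ-Reasoning
  integral : ℕ → ℚᵘ.ℚᵘ
  integral n = ℚᵘ.mkℚᵘ (ℤ.+ n) 0
  q = suc d
  natural : t * (1 * q * 1) ≤ (2 * q + suc k * 1) * b * 1
  -- The numerator of ε is at least 1; this is where 1 / M ≤ ε enters.
  natural = ≤-trans (≤-reflexive (eq₁ t q)) (≤-trans le (≤-trans (*-monoˡ-≤ b (+-monoʳ-≤ (2 * q) (s≤s z≤n)))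
    (≤-reflexive (eq₂ (2 * q) (suc k) b))))
    where
    eq₁ : ∀ t q → t * (1 * q * 1) ≡ t * q
    eq₁ = solve-∀
    eq₂ : ∀ x y b → (x + y) * b ≡ (x + y * 1) * b * 1
    eq₂ = solve-∀
  cross : ℤ.+ t ℤ.* ℚᵘ.↧ ((integral 2 ℚᵘ.+ ℚ.toℚᵘ r) ℚᵘ.* integral b) ℤ.≤
          ℚᵘ.↥ ((integral 2 ℚᵘ.+ ℚ.toℚᵘ r) ℚᵘ.* integral b) ℤ.* ℤ.+ 1
  cross = subst₂ ℤ._≤_ (ℤ-pos-* t (1 * q * 1))
    (trans (ℤ-pos-* ((2 * q + suc k * 1) * b) 1) (cong (ℤ._* ℤ.+ 1) (ℤ-pos-* (2 * q + suc k * 1) b)))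
    (ℤ.+≤+ natural)

module _ (α β M k : ℕ) where

  -- Coefficients are affine in M, because M occurs in the program only as the count of one `rep`.
  affine≤2^ : α + M * β ≤ 2 ^ (α + β + M)
  affine≤2^ = begin
    α + M * β                     ≤⟨ m≤m+n _ _ ⟩
    α + M * β + (β + M * α)       ≡⟨ eq α β M ⟩
    (α + β) * suc M               ≤⟨ *-mono-≤ (n≤2^n (α + β)) (n<2^n M) ⟩
    2 ^ (α + β) * 2 ^ M           ≡⟨ ^-distribˡ-+-* 2 (α + β) M ⟨
    2 ^ (α + β + M)               ∎
    where
    open ≤-Reasoning
    eq : ∀ α β M → α + M * β + (β + M * α) ≡ (α + β) * suc M
    eq = solve-∀

  affine≤tower : ∀ {Q} → α + β ≤ Q → α + M * β ≤ tower Q M k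
  affine≤tower {Q} le = begin
    α + M * β                      ≤⟨ affine≤2^ ⟩
    2 ^ (α + β + M)                ≤⟨ ^-monoʳ-≤ 2 (+-mono-≤ le (m≤m+n M k)) ⟩
    2 ^ (Q + (M + k))              ≤⟨ ^-monoʳ-≤ 2 (≤-trans (n≤2^n (Q + (M + k))) (n≤2^n (2 ^ (Q + (M + k))))) ⟩
    tower Q M k                    ∎
    where open ≤-Reasoning

  module _ (d e h n : ℕ) (h≤ : h ≤ M * (9 * k)) (n≤ : n ≤ 2 ^ h) where

    private
      exponent : ℕ
      exponent = α + β + M + (h * d + suc h * 2 ^ h * e)

      X≤ : X n ≤ 2 ^ (suc h * 2 ^ h)
      X≤ = begin
        (2 * n) ^ n              ≤⟨ ^-monoˡ-≤ n (*-monoʳ-≤ 2 n≤) ⟩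
        (2 ^ suc h) ^ n          ≡⟨ ^-*-assoc 2 (suc h) n ⟩
        2 ^ (suc h * n)          ≤⟨ ^-monoʳ-≤ 2 (*-monoʳ-≤ (suc h) n≤) ⟩
        2 ^ (suc h * 2 ^ h)      ∎
        where open ≤-Reasoning

      monomial≤ : n ^ d * X n ^ e ≤ 2 ^ (h * d + suc h * 2 ^ h * e)
      monomial≤ = begin
        n ^ d * X n ^ e                                  ≤⟨ *-mono-≤ (^-monoˡ-≤ d n≤) (^-monoˡ-≤ e X≤) ⟩
        (2 ^ h) ^ d * (2 ^ (suc h * 2 ^ h)) ^ e          ≡⟨ cong₂ _*_ (^-*-assoc 2 h d) (^-*-assoc 2 (suc h * 2 ^ h) e) ⟩
        2 ^ (h * d) * 2 ^ (suc h * 2 ^ h * e)            ≡⟨ ^-distribˡ-+-* 2 (h * d) (suc h * 2 ^ h * e) ⟨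
        2 ^ (h * d + suc h * 2 ^ h * e)                  ∎
        where open ≤-Reasoning

      W : ℕ
      W = α + β + M + (h + h) + (d + e)

      exponent≤ : exponent ≤ 2 ^ W
      exponent≤ = begin
        a + (h * d + suc h * P * e)              ≤⟨ +-mono-≤ (n≤2^n a) (+-mono-≤ (*-monoˡ-≤ d (n≤2^n h))
                                                      (*-monoˡ-≤ e (*-monoˡ-≤ P (n<2^n h)))) ⟩
        2 ^ a + (P * d + P * P * e)              ≤⟨ +-mono-≤ (grow (2 ^ a) PP) (+-mono-≤ pd ppe) ⟩
        2 ^ a * (P * P) + (2 ^ a * (P * P) * d + 2 ^ a * (P * P) * e)   ≡⟨ eq (2 ^ a * (P * P)) d e ⟩
        2 ^ a * (P * P) * suc (d + e)            ≤⟨ *-monoʳ-≤ (2 ^ a * (P * P)) (n<2^n (d + e)) ⟩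
        2 ^ a * (P * P) * 2 ^ (d + e)            ≡⟨ cong (λ z → 2 ^ a * z * 2 ^ (d + e)) (sym (^-distribˡ-+-* 2 h h)) ⟩
        2 ^ a * 2 ^ (h + h) * 2 ^ (d + e)        ≡⟨ cong (_* 2 ^ (d + e)) (sym (^-distribˡ-+-* 2 a (h + h))) ⟩
        2 ^ (a + (h + h)) * 2 ^ (d + e)          ≡⟨ ^-distribˡ-+-* 2 (a + (h + h)) (d + e) ⟨
        2 ^ W                                    ∎
        where
        open ≤-Reasoning
        a = α + β + M
        P = 2 ^ h
        PP : 1 ≤ P * P
        PP = *-mono-≤ (2^-pos h) (2^-pos h)
        grow : ∀ x {y} → 1 ≤ y → x ≤ x * y
        grow x p = ≤-trans (≤-reflexive (sym (*-identityʳ x))) (*-monoʳ-≤ x p)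
        shrink : ∀ {x y} → 1 ≤ x → y ≤ x * y
        shrink {x} {y} p = ≤-trans (≤-reflexive (sym (*-identityˡ y))) (*-monoˡ-≤ y p)
        pd : P * d ≤ 2 ^ a * (P * P) * d
        pd = *-monoˡ-≤ d (≤-trans (grow P (2^-pos h)) (shrink (2^-pos a)))
        ppe : P * P * e ≤ 2 ^ a * (P * P) * e
        ppe = *-monoˡ-≤ e (shrink (2^-pos a))
        eq : ∀ x d e → x + (x * d + x * e) ≡ x * suc (d + e)
        eq = solve-∀

      -- The constant 19 is 1 + 18: M contributes 1 and h + h ≤ 18 M k contributes 18, both measured
      -- in units of 2 ^ M * 2 ^ k.
      W≤ : W ≤ 2 ^ (α + β + (d + e) + 19 + (M + k))
      W≤ = begin
        α + β + M + (h + h) + (d + e)                      ≤⟨ +-monoˡ-≤ (d + e) (+-monoʳ-≤ (α + β + M) (+-mono-≤ h≤ h≤)) ⟩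
        α + β + M + (M * (9 * k) + M * (9 * k)) + (d + e)  ≡⟨ eq₁ (α + β) (d + e) M k ⟩
        c * 1 + (M + 18 * (M * k))
          ≤⟨ +-mono-≤ (*-monoʳ-≤ c (*-mono-≤ (2^-pos M) (2^-pos k)))
              (+-mono-≤ (≤-trans (≤-reflexive (sym (*-identityʳ M))) (*-mono-≤ (n≤2^n M) (2^-pos k)))
                (*-monoʳ-≤ 18 (*-mono-≤ (n≤2^n M) (n≤2^n k)))) ⟩
        c * U + (U + 18 * U)                               ≡⟨ eq₂ c U ⟩
        (c + 19) * U                                       ≤⟨ *-monoˡ-≤ U (n≤2^n (c + 19)) ⟩
        2 ^ (c + 19) * U                                   ≡⟨ cong (2 ^ (c + 19) *_) (^-distribˡ-+-* 2 M k) ⟨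
        2 ^ (c + 19) * 2 ^ (M + k)                         ≡⟨ ^-distribˡ-+-* 2 (c + 19) (M + k) ⟨
        2 ^ (c + 19 + (M + k))                             ∎
        where
        open ≤-Reasoning
        c = α + β + (d + e)
        U = 2 ^ M * 2 ^ k
        eq₁ : ∀ x y M k → x + M + (M * (9 * k) + M * (9 * k)) + y ≡ (x + y) * 1 + (M + 18 * (M * k))
        eq₁ = solve-∀
        eq₂ : ∀ c U → c * U + (U + 18 * U) ≡ (c + 19) * U
        eq₂ = solve-∀

    monomial≤tower : ∀ {Q} → α + β + (d + e) + 19 ≤ Q → (α + M * β) * (n ^ d * X n ^ e) ≤ tower Q M k
    monomial≤tower {Q} le = begin
      (α + M * β) * (n ^ d * X n ^ e)                                ≤⟨ *-mono-≤ affine≤2^ monomial≤ ⟩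
      2 ^ (α + β + M) * 2 ^ (h * d + suc h * 2 ^ h * e)              ≡⟨ ^-distribˡ-+-* 2 (α + β + M) _ ⟨
      2 ^ exponent                                                   ≤⟨ ^-monoʳ-≤ 2 (≤-trans exponent≤ (^-monoʳ-≤ 2 (≤-trans W≤
                                                                          (^-monoʳ-≤ 2 (+-monoˡ-≤ (M + k) le))))) ⟩
      tower Q M k                                                    ∎
      where open ≤-Reasoning

opaque
  coef-large : ∃[ β ] (∀ M → coef (cost (largeE M)) ≡ 61 + M * β)
  -- 22 is the coefficient of `fold zer v0`, the start value of the halvings; β, the coefficient of
  -- one repetition, is left to be inferred.
  coef-large = _ , λ M → eq 22 _ M
    where
    eq : ∀ x y M → 1 + ((3 + (((10 + (x + M * y)) + 1) + 20)) + (1 + 3)) ≡ 39 + x + M * y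
    eq = solve-∀

bound-at : ∀ N c {x y z} → coef c ≡ x → deg c ≡ y → expo c ≡ z →
           ⟪ c ⟫ (suc N) ≤ x * (suc N ^ y * X (suc N) ^ z)
bound-at N c refl refl refl = cost-bound N c

-- Opaque, since powers with literal exponents get unfolded during conversion checking.
opaque
  slope : ℕ
  intercept degree exponentX : Exp (graphTy ∷ idx ∷ []) Output → ℕ
  slope = proj₁ coef-large
  intercept e = 45 + (61 + coef (cost e))
  degree e = suc (deg (cost (largeE 0)) + deg (cost e))
  exponentX e = expo (cost e)

  coef-branch : ∀ M e → coef (branchCost (largeE M) e) ≡ intercept e + M * slope
  coef-branch M e = trans (cong (λ z → 30 + (15 + (z + coef (cost e)))) (proj₂ coef-large M)) (eq (M * slope) (coef (cost e)))
    where
    eq : ∀ x y → 30 + (15 + (61 + x + y)) ≡ 45 + (61 + y) + x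
    eq = solve-∀

  -- `deg` ignores the factor of `⊛`, so M = 0 gives the degree for every M. The exponent of n has
  -- to be chosen before ε.
  deg-branch : ∀ M e → deg (branchCost (largeE M) e) ≡ degree e
  deg-branch M e = refl

  expo-branch : ∀ M e → expo (branchCost (largeE M) e) ≡ exponentX e
  expo-branch M e = refl

  -- No `enum` occurs in the approximation, so its cost is polynomial in n.
  exponentX-approximate : exponentX approximateOut ≡ 0
  exponentX-approximate = refl

opaque
  height : ℕ
  height = (intercept approximateOut + slope) +
           (intercept optimumOut + slope + (degree optimumOut + exponentX optimumOut) + 19)

  height-approximate : intercept approximateOut + slope ≤ height
  height-approximate = m≤m+n (intercept approximateOut + slope) _

  height-optimum : intercept optimumOut + slope + (degree optimumOut + exponentX optimumOut) + 19 ≤ height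
  height-optimum = m≤n+m (intercept optimumOut + slope + (degree optimumOut + exponentX optimumOut) + 19)
                         (intercept approximateOut + slope)

branch-bound : ∀ M e N → ⟪ branchCost (largeE M) e ⟫ (suc N) ≤
               (intercept e + M * slope) * (suc N ^ degree e * X (suc N) ^ exponentX e)
branch-bound M e N = bound-at N (branchCost (largeE M) e) (coef-branch M e) (deg-branch M e) (expo-branch M e)

-- The two cases of the theorem

module Main {N} (G : Graph (suc N)) (s : Fin (suc N)) (ε : ℚ) (0<ε : 0ℚ ℚ.< ε) where
  open Algorithm {N}

  M : ℕ
  M = ℚ.↧ₙ ε

  Result : ℕ → ℕ → Set
  Result cvd b = Σ[ t ∈ ℕ ] Σ[ P ∈ Protocol G s t ] Σ[ c ∈ ℕ ]
    ((fromℕ t ℚ.≤ (fromℕ 2 ℚ.+ ε) ℚ.* fromℕ b) ×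
     Runs (branch (largeE M) approximateOut optimumOut) (encodeInstance G s) (encodeProtocol P) c ×
     c ≤ tower height M cvd * suc N ^ degree approximateOut)

  result : ∀ {cvd b t v B} (T : (V → V) × (V → ℕ)) → Broadcast (adj G) s (proj₁ T) (proj₂ T) →
           (∀ w → proj₂ T w ≤ t) → v ≡ matrix T →
           (encodeInstance G s ∷ []) ⊢ branch (largeE M) approximateOut optimumOut ⇓ enc Output {N} v ≤[ B ] →
           t * M ≤ (2 * M + 1) * b → B ≤ tower height M cvd * suc N ^ degree approximateOut →
           Result cvd b
  result {b = b} {t} T B f≤t refl (c , run , c≤) fast cheap =
    t , protocol f≤t , c , ratio ε 0<ε t b fast ,
    subst (λ y → Runs (branch (largeE M) approximateOut optimumOut) (encodeInstance G s) y c)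
      (encode-protocol f≤t) run ,
    ≤-trans c≤ cheap
    where open FromBroadcast G B

  main : ∀ cvd b → Connected G → IsClusterVertexDeletionNumber G cvd → IsBroadcastTime G s b → Result cvd b
  main cvd b conn ((D , deletion , ∣D∣≡cvd) , _) bt
    with rounds⇒broadcast G (proj₁ bt) | T? (large (adj G) M)
  ... | p , f , B , f≤b | yes big =
    result (approximate (adj G) s) (proj₁ approx) (proj₂ approx) (sem-approximateOut G s)
      (branch-true G s (largeE M) approximateOut optimumOut (trans (sem-large (adj G) s M) (true-≡ big)))
      fast cheap
    where
    S = modulator (adj G)
    approx = Finishing.approximation G s S (modulator-hits (adj G)) B f≤b (broadcastTime< G bt) conn
    true-≡ : ∀ {x} → T x → x ≡ true
    true-≡ {true} _ = refl
    2^h<2^b : 2 ^ halvings (adj G) M < 2 ^ b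
    2^h<2^b = <-≤-trans (s≤s (large-sound (adj G) M big)) (order≤2^time B f≤b)
    h≤b : M * (count S * 3) ≤ b
    h≤b = ≮⇒≥ (λ lt → <⇒≱ 2^h<2^b (^-monoʳ-≤ 2 (<⇒≤ lt)))
    -- After multiplication by M the additive term 3 |S| is at most b, which is the surplus of the
    -- factor 2 M + 1 over 2 M.
    fast : (3 * count S + b + b) * M ≤ (2 * M + 1) * b
    fast = ≤-trans (≤-reflexive (eq₁ (count S) b M)) (≤-trans (+-monoˡ-≤ (2 * M * b) h≤b) (≤-reflexive (eq₂ b M)))
      where
      eq₁ : ∀ c b M → (3 * c + b + b) * M ≡ M * (c * 3) + 2 * M * b
      eq₁ = solve-∀
      eq₂ : ∀ b M → b + 2 * M * b ≡ (2 * M + 1) * b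
      eq₂ = solve-∀
    cheap : ⟪ branchCost (largeE M) approximateOut ⟫ (suc N) ≤ tower height M cvd * suc N ^ degree approximateOut
    cheap = ≤-trans (branch-bound M approximateOut N)
      (*-mono-≤ (affine≤tower (intercept approximateOut) slope M cvd height-approximate)
                (≤-reflexive (trans (cong (λ z → suc N ^ degree approximateOut * X (suc N) ^ z) exponentX-approximate)
                  (*-identityʳ (suc N ^ degree approximateOut)))))
  ... | p , f , B , f≤b | no small =
    result (optimum (adj G) s) (proj₁ best) (proj₂ best) (sem-optimumOut G s)
      (branch-false G s (largeE M) approximateOut optimumOut (trans (sem-large (adj G) s M) (false-≡ small)))
      fast cheap
    where
    b<n = broadcastTime< G bt
    S = modulator (adj G)
    approx = Finishing.approximation G s S (modulator-hits (adj G)) B f≤b b<n conn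
    best = Search.optimum-correct (adj G) s B f≤b b<n (proj₁ approx)
    false-≡ : ∀ {x} → ¬ T x → x ≡ false
    false-≡ {false} _ = refl
    false-≡ {true} q = ⊥-elim (q tt)
    fast : b * M ≤ (2 * M + 1) * b
    fast = ≤-trans (m≤m+n (b * M) (b * M + b)) (≤-reflexive (eq b M))
      where
      eq : ∀ b M → b * M + (b * M + b) ≡ (2 * M + 1) * b
      eq = solve-∀
    -- The factor 9 is 3 * 3: three halvings for each vertex of S, and |S| ≤ 3 cvd.
    h≤ : halvings (adj G) M ≤ M * (9 * cvd)
    h≤ = *-monoʳ-≤ M (≤-trans (*-monoˡ-≤ 3 (modulator-size (adj G) (deletionSet-hits G deletion)))
      (≤-reflexive (trans (cong (λ z → 3 * z * 3) (trans (count-lookup D) ∣D∣≡cvd)) (eq cvd))))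
      where
      eq : ∀ k → 3 * k * 3 ≡ 9 * k
      eq = solve-∀
    cheap : ⟪ branchCost (largeE M) optimumOut ⟫ (suc N) ≤ tower height M cvd * suc N ^ degree approximateOut
    cheap = ≤-trans (branch-bound M optimumOut N)
      (≤-trans (monomial≤tower (intercept optimumOut) slope M cvd (degree optimumOut) (exponentX optimumOut)
          (halvings (adj G) M) (suc N) h≤ (large-complete (adj G) M small) height-optimum)
        -- As n is bounded in this case, the tower alone covers the cost; the power of n is a factor
        -- of at least 1.
        (≤-trans (≤-reflexive (sym (*-identityʳ (tower height M cvd))))
          (*-monoʳ-≤ (tower height M cvd) (subst (_≤ suc N ^ degree approximateOut) (^-zeroˡ (degree approximateOut))
            (^-monoˡ-≤ (degree approximateOut) (s≤s z≤n))))))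

theorem28 : Σ[ f ∈ (ℕ → ℚ → ℕ) ] Computable f ×
    (Σ[ d ∈ ℕ ]
    (∀ (ε : ℚ) → 0ℚ ℚ.< ε →
    Σ[ p ∈ Program ]
    (∀ (n : ℕ) (G : Graph n) (s : Fin n) (cvd b : ℕ) →
    Connected G →
    IsClusterVertexDeletionNumber G cvd →
    IsBroadcastTime G s b →
    Σ[ t ∈ ℕ ] Σ[ P ∈ Protocol G s t ] Σ[ c ∈ ℕ ]
    ((fromℕ t ℚ.≤ (fromℕ 2 ℚ.+ ε) ℚ.* fromℕ b) ×
    Runs p (encodeInstance G s) (encodeProtocol P) c ×
    c ≤ f cvd ε * n ^ d))))
theorem28 = (λ k ε → tower height (ℚ.↧ₙ ε) k) , tower-computable height , degree approximateOut ,
  λ ε 0<ε → branch (largeE (ℚ.↧ₙ ε)) approximateOut optimumOut ,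
  λ { zero G () ; (suc N) G s cvd b → Main.main G s ε 0<ε cvd b }
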